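{- The following decision problem is undecidable: given a two-dimensional (deterministic) substitution $\sigma$ on a finite alphabet, determine whether $\sigma$ is consistent.
   Context: **Cells and patterns.** Let $\mathcal{A}$ be a finite set of symbols (the alphabet). A $d$-dimensional cell is a pair $c=[v,t]$ with $v\in\mathbb{Z}^d$ (the vector of $c$) and $t\in\mathcal{A}$ (the type of $c$). A $d$-dimensional pattern is a finite set of $d$-dimensional cells with pairwise distinct vectors. Patterns are translated by elements of $\mathbb{Z}^d$ by translating the vectors of their cells. **Substitutions.** A $d$-dimensional substitution $\sigma$ on $\mathcal{A}$ consists of a base rule, i.e. a map $\sigma_{\mathrm{base}}$ from $\mathcal{A}$ to the set of $d$-dimensional patterns, and a finite set of concatenation rules $(t,t',u)\mapsto v$ with $t,t'\in\mathcal{A}$, $u,v\in\mathbb{Z}^d$, $u\neq 0$. All substitutions are assumed deterministic: if a rule has left-hand side $(t,t',u)$, then no other rule has left-hand side $(t,t',u)$ or $(t',t,-u)$. The set of starting patterns of $\sigma$ is $\mathcal{C}_\sigma=\{\{[0,t],[u,t']\} : (t,t',u)\mapsto v \text{ is a rule of } \sigma \text{ for some } v\}$. For cells $c=[u,t]$, $c'=[u',t']$, set $\sigma_{\mathrm{rule}}(c,c')=v$ if $(t,t',u'-u)\mapsto v$ is a rule of $\sigma$, $\sigma_{\mathrm{rule}}(c,c')=-v$ if $(t',t,u-u')\mapsto v$ is a rule of $\sigma$, and leave it undefined otherwise. **Paths.** A $\mathcal{C}_\sigma$-path from $c_1$ to $c_n$ is a finite sequence of cells $\gamma=(c_1,\dots,c_n)$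 such that $\{c_i,c_{i+1}\}$ is a translate of an element of $\mathcal{C}_\sigma$ for all $1\le i\le n-1$, and such that $c_i=c_j$ whenever $c_i$ and $c_j$ have the same vector. It is a $\mathcal{C}_\sigma$-path of a pattern $P$ if all its cells belong to $P$. A pattern $P$ is $\mathcal{C}_\sigma$-covered if for all $c,c'\in P$ there is a $\mathcal{C}_\sigma$-path of $P$ from $c$ to $c'$. The image vector of $\gamma$ is $\omega_\sigma(\gamma)=\sum_{i=1}^{n-1}\sigma_{\mathrm{rule}}(c_i,c_{i+1})$. **Consistency.** $\sigma$ is consistent on a $\mathcal{C}_\sigma$-covered pattern $P$ if for all cells $c,c'\in P$ and all $\mathcal{C}_\sigma$-paths $\gamma,\gamma'$ of $P$ from $c$ to $c'$ we have $\omega_\sigma(\gamma)=\omega_\sigma(\gamma')$. $\sigma$ is consistent if it is consistent on every $\mathcal{C}_\sigma$-covered pattern. -}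

module Defs where

open import Data.Fin as Fin using (Fin; toℕ)
open import Data.Integer as ℤ using (ℤ; +_; -[1+_])
import Data.Integer.Properties as ℤₚ
open import Algebra.Bundles using (AbelianGroup)
import Algebra.Properties.Group as GroupProperties
open import Data.List as List using (List; []; _∷_; head; last)
open import Data.List.Membership.Propositional using (_∈_)
open import Data.List.Properties using (map-∘)
open import Data.List.Relation.Binary.BagAndSetEquality using (_∼[_]_; set)
open import Data.List.Relation.Unary.All using (All; []; _∷_)
open import Data.List.Relation.Unary.AllPairs using (AllPairs; []; _∷_)
open import Data.List.Relation.Unary.Linked using (Linked)
open import Data.List.Relation.Unary.Unique.Propositional using (Unique)
import Data.List.Relation.Unary.Unique.Propositional.Properties as Uniqueₚ
open import Data.Maybe as Maybe using (Maybe; just; nothing; _<∣>_)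
open import Data.Nat using (ℕ; zero; suc; _+_; _*_; _^_; _<_)
open import Data.Product using (∃; ∃-syntax; Σ-syntax; _×_; _,_)
open import Data.Product.Properties using (≡-dec)
open import Data.Sum using (_⊎_)
open import Data.Vec as Vec using (Vec; []; _∷_)
import Data.Vec.Properties as Vecₚ
open import Relation.Binary.Definitions using (DecidableEquality)
open import Relation.Binary.PropositionalEquality
  using (_≡_; _≢_; refl; sym; trans; cong; cong₂; subst)
open import Relation.Nullary using (¬_; yes; no)

------------------------------------------------------------------------
-- The lattice ℤᵈ

ℤ^ : ℕ → Set
ℤ^ d = Vec ℤ d

infixl 6 _⊕_ _⊖_
infix 8 ⊖_

𝟎 : ∀ {d} → ℤ^ d
𝟎 = Vec.replicate _ (+ 0)

_⊕_ _⊖_ : ∀ {d} → ℤ^ d → ℤ^ d → ℤ^ d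
_⊕_ = Vec.zipWith ℤ._+_
_⊖_ = Vec.zipWith ℤ._-_

⊖_ : ∀ {d} → ℤ^ d → ℤ^ d
⊖_ = Vec.map (λ i → ℤ.- i)

⊕-cancelˡ : ∀ {d} (w : ℤ^ d) {x y} → w ⊕ x ≡ w ⊕ y → x ≡ y
⊕-cancelˡ []      {[]}    {[]}    _  = refl
⊕-cancelˡ (i ∷ w) {_ ∷ _} {_ ∷ _} eq = cong₂ _∷_
  (GroupProperties.∙-cancelˡ (AbelianGroup.group ℤₚ.+-0-abelianGroup) i _ _
    (Vecₚ.∷-injectiveˡ eq))
  (⊕-cancelˡ w (Vecₚ.∷-injectiveʳ eq))

------------------------------------------------------------------------
-- Cells and patterns

-- The alphabet with k symbols is Fin k.
record Cell (d k : ℕ) : Set where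
  constructor [_,_]
  field
    vector : ℤ^ d
    type   : Fin k

open Cell public

record Pattern (d k : ℕ) : Set where
  field
    cells    : List (Cell d k)
    distinct : Unique (List.map vector cells)

open Pattern public

shift : ∀ {d k} → ℤ^ d → Cell d k → Cell d k
shift w [ v , t ] = [ w ⊕ v , t ]

translate : ∀ {d k} → ℤ^ d → Pattern d k → Pattern d k
translate w P = record
  { cells    = List.map (shift w) (cells P)
  ; distinct = subst Unique
      (trans (sym (map-∘ (cells P))) (map-∘ (cells P)))
      (Uniqueₚ.map⁺ (⊕-cancelˡ w) (distinct P))
  }

------------------------------------------------------------------------
-- Substitutions

-- The concatenation rule (source , target , offset) ↦ image.
record Rule (d k : ℕ) : Set where
  field
    source target : Fin k
    offset image  : ℤ^ d
    offset≢𝟎      : offset ≢ 𝟎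

open Rule public

LHS : ℕ → ℕ → Set
LHS d k = Fin k × Fin k × ℤ^ d

lhs reversed-lhs : ∀ {d k} → Rule d k → LHS d k
lhs          r = source r , target r , offset r
reversed-lhs r = target r , source r , ⊖ offset r

_≟-lhs_ : ∀ {d k} → DecidableEquality (LHS d k)
_≟-lhs_ = ≡-dec Fin._≟_ (≡-dec Fin._≟_ (Vecₚ.≡-dec ℤ._≟_))

Clash : ∀ {d k} → Rule d k → Rule d k → Set
Clash r r′ = lhs r′ ≡ lhs r ⊎ lhs r′ ≡ reversed-lhs r

-- The finite set of rules is a list; determinism already forces the list
-- to be free of repetitions, because a rule clashes with itself.
record Substitution (d k : ℕ) : Set where
  field
    base          : Fin k → Pattern d k
    rules         : List (Rule d k)
    deterministic : AllPairs (λ r r′ → ¬ Clash r r′) rules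

open Substitution public

startingPattern : ∀ {d k} → Rule d k → Pattern d k
startingPattern r = record
  { cells    = [ 𝟎 , source r ] ∷ [ offset r , target r ] ∷ []
  ; distinct = ((λ eq → offset≢𝟎 r (sym eq)) ∷ []) ∷ [] ∷ []
  }

𝒞 : ∀ {d k} → Substitution d k → List (Pattern d k)
𝒞 σ = List.map startingPattern (rules σ)

-- The image vector of the rule with the given left-hand side, if any.
lookupRule : ∀ {d k} → List (Rule d k) → LHS d k → Maybe (ℤ^ d)
lookupRule []       l = nothing
lookupRule (r ∷ rs) l with lhs r ≟-lhs l
... | yes _ = just (image r)
... | no  _ = lookupRule rs l

-- By determinism at most one of the two alternatives succeeds.
σ-rule : ∀ {d k} → Substitution d k → Cell d k → Cell d k → Maybe (ℤ^ d)
σ-rule σ [ u , t ] [ u′ , t′ ] =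
      lookupRule (rules σ) (t , t′ , u′ ⊖ u)
  <∣> Maybe.map ⊖_ (lookupRule (rules σ) (t′ , t , u ⊖ u′))

------------------------------------------------------------------------
-- Paths and consistency

Adjacent : ∀ {d k} → Substitution d k → Cell d k → Cell d k → Set
Adjacent σ c c′ =
  ∃[ S ] S ∈ 𝒞 σ × (∃[ w ] (c ∷ c′ ∷ []) ∼[ set ] cells (translate w S))

record IsPath {d k} (σ : Substitution d k) (c c′ : Cell d k)
              (γ : List (Cell d k)) : Set where
  field
    starts     : head γ ≡ just c
    ends       : last γ ≡ just c′
    steps      : Linked (Adjacent σ) γ
    nonOverlap : ∀ {a b} → a ∈ γ → b ∈ γ → vector a ≡ vector b → a ≡ b

IsPathOf : ∀ {d k} → Substitution d k → Pattern d k →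
           Cell d k → Cell d k → List (Cell d k) → Set
IsPathOf σ P c c′ γ = IsPath σ c c′ γ × All (_∈ cells P) γ

Covered : ∀ {d k} → Substitution d k → Pattern d k → Set
Covered σ P = ∀ {c c′} → c ∈ cells P → c′ ∈ cells P → ∃ (IsPathOf σ P c c′)

-- The image vector of a sequence of cells; it is defined on every path,
-- since σ-rule is defined on adjacent cells.
ω : ∀ {d k} → Substitution d k → List (Cell d k) → Maybe (ℤ^ d)
ω σ []           = just 𝟎
ω σ (c ∷ [])     = just 𝟎
ω σ (c ∷ c′ ∷ γ) = Maybe.zipWith _⊕_ (σ-rule σ c c′) (ω σ (c′ ∷ γ))

ConsistentOn : ∀ {d k} → Substitution d k → Pattern d k → Set
ConsistentOn σ P = ∀ {c c′} → c ∈ cells P → c′ ∈ cells P →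
  ∀ {γ γ′} → IsPathOf σ P c c′ γ → IsPathOf σ P c c′ γ′ → ω σ γ ≡ ω σ γ′

Consistent : ∀ {d k} → Substitution d k → Set
Consistent σ = ∀ P → Covered σ P → ConsistentOn σ P

------------------------------------------------------------------------
-- Partial recursive functions

data Rec : ℕ → Set where
  zeroᴿ : ∀ {n} → Rec n
  succᴿ : Rec 1
  projᴿ : ∀ {n} → Fin n → Rec n
  compᴿ : ∀ {m n} → Rec m → Vec (Rec n) m → Rec n
  precᴿ : ∀ {n} → Rec n → Rec (suc (suc n)) → Rec (suc n)
  minᴿ  : ∀ {n} → Rec (suc n) → Rec n

infix 4 _·_⇓_ _·_⇓*_

-- f · xs ⇓ y: the partial function f is defined at xs, with value y.
data _·_⇓_  : ∀ {n} → Rec n → Vec ℕ n → ℕ → Set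
data _·_⇓*_ : ∀ {m n} → Vec (Rec n) m → Vec ℕ n → Vec ℕ m → Set

data _·_⇓_ where
  zero⇓ : ∀ {n} {xs : Vec ℕ n} → zeroᴿ · xs ⇓ 0
  succ⇓ : ∀ {x} → succᴿ · x ∷ [] ⇓ suc x
  proj⇓ : ∀ {n} {i : Fin n} {xs} → projᴿ i · xs ⇓ Vec.lookup xs i
  comp⇓ : ∀ {m n} {f : Rec m} {gs : Vec (Rec n) m} {xs ys z} →
          gs · xs ⇓* ys → f · ys ⇓ z → compᴿ f gs · xs ⇓ z
  precZero⇓ : ∀ {n} {g : Rec n} {h xs y} →
          g · xs ⇓ y → precᴿ g h · zero ∷ xs ⇓ y
  precSuc⇓ : ∀ {n} {g : Rec n} {h x xs y z} →
          precᴿ g h · x ∷ xs ⇓ y → h · x ∷ y ∷ xs ⇓ z →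
          precᴿ g h · suc x ∷ xs ⇓ z
  min⇓  : ∀ {n} {f : Rec (suc n)} {xs y} →
          (∀ x → x < y → ∃[ z ] f · x ∷ xs ⇓ suc z) →
          f · y ∷ xs ⇓ 0 → minᴿ f · xs ⇓ y

data _·_⇓*_ where
  []  : ∀ {n} {xs : Vec ℕ n} → [] · xs ⇓* []
  _∷_ : ∀ {m n} {g : Rec n} {gs : Vec (Rec n) m} {xs y ys} →
        g · xs ⇓ y → gs · xs ⇓* ys → g ∷ gs · xs ⇓* y ∷ ys

------------------------------------------------------------------------
-- Decision problems

-- A problem asks whether an instance a : A, presented to the machine as
-- the number code a, satisfies P.
Decides : ∀ {A : Set} → Rec 1 → (A → ℕ) → (A → Set) → Set
Decides f code P = ∀ a →
  (P a → f · code a ∷ [] ⇓ 1) × (¬ P a → f · code a ∷ [] ⇓ 0)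

Undecidable : ∀ {A : Set} → (A → ℕ) → (A → Set) → Set
Undecidable code P = ¬ (∃[ f ] Decides f code P)

------------------------------------------------------------------------
-- Coding substitutions by natural numbers

-- A computable bijection between List ℕ and ℕ.
codeList : List ℕ → ℕ
codeList []       = 0
codeList (x ∷ xs) = 2 ^ x * (1 + 2 * codeList xs)

codeℤ : ℤ → ℕ
codeℤ (+ n)    = 2 * n
codeℤ -[1+ n ] = 1 + 2 * n

codeℤ^ : ∀ {d} → ℤ^ d → ℕ
codeℤ^ v = codeList (List.map codeℤ (Vec.toList v))

codeCell : ∀ {d k} → Cell d k → ℕ
codeCell [ v , t ] = codeList (codeℤ^ v ∷ toℕ t ∷ [])

codePattern : ∀ {d k} → Pattern d k → ℕ
codePattern P = codeList (List.map codeCell (cells P))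

codeRule : ∀ {d k} → Rule d k → ℕ
codeRule r = codeList
  (toℕ (source r) ∷ toℕ (target r) ∷ codeℤ^ (offset r) ∷ codeℤ^ (image r) ∷ [])

-- An instance consists of an alphabet size and a substitution on that alphabet.
Instance : ℕ → Set
Instance d = Σ[ k ∈ ℕ ] Substitution d k

codeInstance : ∀ {d} → Instance d → ℕ
codeInstance (k , σ) = codeList
  ( k
  ∷ codeList (List.map (λ t → codePattern (base σ t)) (List.allFin k))
  ∷ codeList (List.map codeRule (rules σ))
  ∷ [])

{-
Each symbol t of the substitutions built here has a fixed offset off t, and
every rule (s , t , off s) ↦ v has v = 𝟎, except for one rule of image
e = (1 , 0). So a cell has at most one successor in a pattern, and "the chain
of successors reaches the exceptional rule" is a potential showing that the
substitution is inconsistent iff some pattern contains a chain from the target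
of the exceptional rule back to its source.

A chain is made to follow a machine that sweeps back and forth over a word:
row r + 1 of the plane holds the word after r + 1 sweeps, a letter b is written
by occupying one of several places, and reading a letter a visits the places of
all letters other than a. A wrong guess makes two cells with different symbols
meet, which no pattern allows. One sweep performs one instruction of a counter
machine, whose j-th counter is the number of letters 2 + j in the word.

Given a decision procedure f, let the machine compute f on the code of its own
substitution: apart from a chain of rules that writes the input, the rules do
not depend on the input, and their code N is the input. If f answers 1, the
machine accepts, the chain closes up, and the substitution is inconsistent; if
f answers 0, every run gets stuck, so no chain exists and it is consistent.
-}

module Submission where

-- The offset of a step depends on the source symbol alone, so a chain cannot inspect a place and
-- branch on it: its only freedom is the symbol of the next cell. Every reading is therefore a
-- guess, and so is the number of blanks in row 0; the one check available is that a place of a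
-- pattern holds a single cell. A word with too few blanks merely gets stuck, which is harmless:
-- consistency asks that every guess fails, inconsistency that one guess, with enough blanks,
-- succeeds.
--
-- For the self-reference, the rules coded by N must be numbered before N is known. Their symbols
-- are numbered by lists of fields, whatever the size of the alphabet. A list code exceeds its
-- entries, so these numbers lie below N, and the symbols of the input chain take N, ..., 2N. The
-- rest of the code of the substitution is then an explicit recursive function of N, and the machine
-- is built from f composed with this function, a program in which N does not occur.

module Consistency where

  open import Defs
  open import Data.Integer as ℤ using (ℤ; +_; -[1+_]; +[1+_])
  import Data.Integer.Properties as ℤₚ
  open import Data.Fin using (Fin)
  open import Data.List using (List; []; _∷_; head; last; map)
  open import Data.List.Membership.Propositional using (_∈_)
  open import Data.List.Membership.Propositional.Properties using (∈-map⁺; ∈-map⁻)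
  open import Data.List.Relation.Binary.BagAndSetEquality using (_∼[_]_; set)
  open import Data.List.Relation.Unary.All as All using (All; []; _∷_)
  open import Data.List.Relation.Unary.AllPairs using (AllPairs; []; _∷_)
  open import Data.List.Relation.Unary.Any using (here; there)
  open import Data.List.Relation.Unary.Linked using (Linked; []; [-]; _∷_)
  open import Data.List.Relation.Unary.Unique.Propositional using (Unique)
  open import Data.Maybe as Maybe using (Maybe; just; nothing)
  open import Data.Maybe.Properties using (just-injective) renaming (≡-dec to ≡-dec-Maybe)
  open import Data.Nat using (ℕ; zero; suc)
  open import Data.Product using (∃; ∃-syntax; _×_; _,_; proj₁; proj₂)
  open import Data.Sum using (_⊎_; inj₁; inj₂)
  open import Data.Vec using ([]; _∷_)
  import Data.Vec.Properties as Vecₚ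
  open import Function using (_∘_; mk⇔; Equivalence)
  open import Relation.Binary.PropositionalEquality hiding ([_])
  open import Relation.Nullary using (¬_; Dec; yes; no; contradiction)
  open import Relation.Nullary.Decidable using (decidable-stable; ¬¬-excluded-middle)

  private variable
    d k : ℕ

  -- Lattice arithmetic and the image vector of a single step

  ⊖-involutive : (u : ℤ^ d) → ⊖ (⊖ u) ≡ u
  ⊖-involutive []      = refl
  ⊖-involutive (i ∷ u) = cong₂ _∷_ (ℤₚ.neg-involutive i) (⊖-involutive u)

  ⊕-⊖-cancelˡ : (u o : ℤ^ d) → (u ⊕ o) ⊖ u ≡ o
  ⊕-⊖-cancelˡ []      []      = refl
  ⊕-⊖-cancelˡ (i ∷ u) (j ∷ o) = cong₂ _∷_ eq (⊕-⊖-cancelˡ u o)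
    where
    open ≡-Reasoning
    eq : (i ℤ.+ j) ℤ.- i ≡ j
    eq = begin
      (i ℤ.+ j) ℤ.- i    ≡⟨ cong (ℤ._- i) (ℤₚ.+-comm i j) ⟩
      (j ℤ.+ i) ℤ.- i    ≡⟨ ℤₚ.+-assoc j i (ℤ.- i) ⟩
      j ℤ.+ (i ℤ.- i)    ≡⟨ cong (λ z → j ℤ.+ z) (ℤₚ.+-inverseʳ i) ⟩
      j ℤ.+ + 0          ≡⟨ ℤₚ.+-identityʳ j ⟩
      j                  ∎

  ⊖-⊕-cancelˡ : (u o : ℤ^ d) → u ⊖ (u ⊕ o) ≡ ⊖ o
  ⊖-⊕-cancelˡ []      []      = refl
  ⊖-⊕-cancelˡ (i ∷ u) (j ∷ o) = cong₂ _∷_ eq (⊖-⊕-cancelˡ u o)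
    where
    open ≡-Reasoning
    eq : i ℤ.- (i ℤ.+ j) ≡ ℤ.- j
    eq = begin
      i ℤ.- (i ℤ.+ j)            ≡⟨ cong (λ z → i ℤ.+ z) (ℤₚ.neg-distrib-+ i j) ⟩
      i ℤ.+ (ℤ.- i ℤ.- j)        ≡⟨ ℤₚ.+-assoc i (ℤ.- i) (ℤ.- j) ⟨
      (i ℤ.- i) ℤ.- j            ≡⟨ cong (ℤ._- j) (ℤₚ.+-inverseʳ i) ⟩
      + 0 ℤ.- j                  ≡⟨ ℤₚ.+-identityˡ (ℤ.- j) ⟩
      ℤ.- j                      ∎

  ⊕-identityʳ : (u : ℤ^ d) → u ⊕ 𝟎 ≡ u
  ⊕-identityʳ []      = refl
  ⊕-identityʳ (i ∷ u) = cong₂ _∷_ (ℤₚ.+-identityʳ i) (⊕-identityʳ u)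

  ⊖-inverse : (u : ℤ^ d) → u ⊖ u ≡ 𝟎
  ⊖-inverse []      = refl
  ⊖-inverse (i ∷ u) = cong₂ _∷_ (ℤₚ.+-inverseʳ i) (⊖-inverse u)

  ⊖-telescope : (x y z : ℤ^ d) → (y ⊖ x) ⊕ (z ⊖ y) ≡ z ⊖ x
  ⊖-telescope []      []      []      = refl
  ⊖-telescope (a ∷ x) (b ∷ y) (c ∷ z) = cong₂ _∷_ eq (⊖-telescope x y z)
    where
    open ≡-Reasoning
    eq : (b ℤ.- a) ℤ.+ (c ℤ.- b) ≡ c ℤ.- a
    eq = begin
      (b ℤ.- a) ℤ.+ (c ℤ.- b)        ≡⟨ ℤₚ.+-comm (b ℤ.- a) (c ℤ.- b) ⟩
      (c ℤ.- b) ℤ.+ (b ℤ.- a)        ≡⟨ ℤₚ.+-assoc c (ℤ.- b) (b ℤ.- a) ⟩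
      c ℤ.+ (ℤ.- b ℤ.+ (b ℤ.- a))    ≡⟨ cong (λ z → c ℤ.+ z) (ℤₚ.+-assoc (ℤ.- b) b (ℤ.- a)) ⟨
      c ℤ.+ ((ℤ.- b ℤ.+ b) ℤ.- a)    ≡⟨ cong (λ z → c ℤ.+ (z ℤ.- a)) (ℤₚ.+-inverseˡ b) ⟩
      c ℤ.+ (+ 0 ℤ.- a)              ≡⟨ cong (λ z → c ℤ.+ z) (ℤₚ.+-identityˡ (ℤ.- a)) ⟩
      c ℤ.- a                        ∎

  ⊖𝟎 : ⊖ (𝟎 {d}) ≡ 𝟎
  ⊖𝟎 {zero}  = refl
  ⊖𝟎 {suc d} = cong₂ _∷_ refl ⊖𝟎

  neg-fixed⇒0 : (i : ℤ) → i ≡ ℤ.- i → i ≡ + 0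
  neg-fixed⇒0 (+ 0)      _ = refl
  neg-fixed⇒0 (+[1+ n ]) ()
  neg-fixed⇒0 (-[1+ n ]) ()

  ⊖-fixed⇒𝟎 : (u : ℤ^ d) → u ≡ ⊖ u → u ≡ 𝟎
  ⊖-fixed⇒𝟎 []      _  = refl
  ⊖-fixed⇒𝟎 (i ∷ u) eq = cong₂ _∷_
    (neg-fixed⇒0 i (Vecₚ.∷-injectiveˡ eq)) (⊖-fixed⇒𝟎 u (Vecₚ.∷-injectiveʳ eq))

  Fwd : Rule d k → Cell d k → Cell d k → Set
  Fwd r c c′ = type c ≡ source r × type c′ ≡ target r × vector c′ ≡ vector c ⊕ offset r

  offset-moves : (r : Rule d k) (u : ℤ^ d) → u ≢ u ⊕ offset r
  offset-moves r u eq =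
    offset≢𝟎 r (sym (⊕-cancelˡ u (trans (⊕-identityʳ u) eq)))

  ≡-lhs : (l l′ : LHS d k) → proj₁ l ≡ proj₁ l′ → proj₁ (proj₂ l) ≡ proj₁ (proj₂ l′) →
          proj₂ (proj₂ l) ≡ proj₂ (proj₂ l′) → l ≡ l′
  ≡-lhs l l′ refl refl refl = refl

  module _ (σ : Substitution d k) where

    -- Equality of two-element sets forgets the order, so the rule may run either way. If `c` and
    -- `c′` were the same end of the starting pattern, its other end would coincide with it, against
    -- the nonzero offset.
    adjacent⁻ : ∀ {c c′} → Adjacent σ c c′ →
                ∃[ r ] r ∈ rules σ × (Fwd r c c′ ⊎ Fwd r c′ c)
    adjacent⁻ {c} {c′} (S , S∈ , w , same) with ∈-map⁻ startingPattern S∈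
    ... | r , r∈ , refl = r , r∈ , orient (to (here refl)) (to (there (here refl)))
                                          (from (here refl)) (from (there (here refl)))
      where
      a b : Cell _ _
      a = [ w ⊕ 𝟎 , source r ]
      b = [ w ⊕ offset r , target r ]

      to : ∀ {x} → x ∈ c ∷ c′ ∷ [] → x ∈ a ∷ b ∷ []
      to = Equivalence.to same

      from : ∀ {x} → x ∈ a ∷ b ∷ [] → x ∈ c ∷ c′ ∷ []
      from = Equivalence.from same

      a≢b : a ≢ b
      a≢b eq = offset-moves r w (trans (sym (⊕-identityʳ w)) (cong vector eq))

      a→b : Fwd r a b
      a→b = refl , refl , cong (_⊕ offset r) (sym (⊕-identityʳ w))

      orient : c ∈ a ∷ b ∷ [] → c′ ∈ a ∷ b ∷ [] → a ∈ c ∷ c′ ∷ [] → b ∈ c ∷ c′ ∷ [] →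
               Fwd r c c′ ⊎ Fwd r c′ c
      orient (here refl)         (there (here refl)) _ _ = inj₁ a→b
      orient (there (here refl)) (here refl)         _ _ = inj₂ a→b
      orient (here refl) (here refl) _ (here eq)         = contradiction (sym eq) a≢b
      orient (here refl) (here refl) _ (there (here eq)) = contradiction (sym eq) a≢b
      orient (there (here refl)) (there (here refl)) (here eq)         _ = contradiction eq a≢b
      orient (there (here refl)) (there (here refl)) (there (here eq)) _ = contradiction eq a≢b

    adjacent-fwd : ∀ {r c c′} → r ∈ rules σ → Fwd r c c′ → Adjacent σ c c′
    adjacent-fwd {r} {[ u , _ ]} r∈ (refl , refl , refl) =
      startingPattern r , ∈-map⁺ startingPattern r∈ , u ,
      subst (λ v → ([ u , source r ] ∷ [ u ⊕ offset r , target r ] ∷ []) ∼[ set ]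
                   ([ v , source r ] ∷ [ u ⊕ offset r , target r ] ∷ []))
            (sym (⊕-identityʳ u)) (mk⇔ (λ x → x) (λ x → x))

    adjacent-sym : ∀ {c c′} → Adjacent σ c c′ → Adjacent σ c′ c
    adjacent-sym {c} {c′} (S , S∈ , w , same) =
      S , S∈ , w , mk⇔ (Equivalence.to same ∘ flip) (flip ∘ Equivalence.from same)
      where
      flip : ∀ {x y z : Cell d k} → z ∈ x ∷ y ∷ [] → z ∈ y ∷ x ∷ []
      flip (here eq)         = there (here eq)
      flip (there (here eq)) = here eq

    lookupRule-nothing : ∀ (rs : List (Rule d k)) l → (∀ {r} → r ∈ rs → lhs r ≢ l) →
                         lookupRule rs l ≡ nothing
    lookupRule-nothing []       l ∉ = refl
    lookupRule-nothing (r ∷ rs) l ∉ with lhs r ≟-lhs l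
    ... | yes eq = contradiction eq (∉ (here refl))
    ... | no  _  = lookupRule-nothing rs l (∉ ∘ there)

    lookupRule-just : ∀ {rs : List (Rule d k)} {r} → AllPairs (λ r r′ → ¬ Clash r r′) rs →
                      r ∈ rs → lookupRule rs (lhs r) ≡ just (image r)
    lookupRule-just {r₀ ∷ rs} {r} (_ ∷ _) (here refl) with lhs r ≟-lhs lhs r
    ... | yes _  = refl
    ... | no neq = contradiction refl neq
    lookupRule-just {r₀ ∷ rs} {r} (px ∷ ps) (there r∈) with lhs r₀ ≟-lhs lhs r
    ... | yes eq = contradiction (inj₁ (sym eq)) (All.lookup px r∈)
    ... | no  _  = lookupRule-just ps r∈

    -- `AllPairs` compares earlier rules with later ones only; negating the offset twice turns a
    -- reversed clash around, which covers the other order. No rule is its own reverse, since only 𝟎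
    -- equals its negative.
    not-reversed : ∀ {r r′} → r ∈ rules σ → r′ ∈ rules σ → lhs r ≢ reversed-lhs r′
    not-reversed r∈ r′∈ eq = go (deterministic σ) r∈ r′∈ eq
      where
      swap : ∀ (r r′ : Rule d k) → lhs r ≡ reversed-lhs r′ → lhs r′ ≡ reversed-lhs r
      swap r r′ eq = sym (≡-lhs (reversed-lhs r) (lhs r′)
        (cong (λ l → proj₁ (proj₂ l)) eq) (cong proj₁ eq)
        (trans (cong (λ l → ⊖ proj₂ (proj₂ l)) eq) (⊖-involutive (offset r′))))

      go : ∀ {rs} {r r′ : Rule d k} → AllPairs (λ r r′ → ¬ Clash r r′) rs →
           r ∈ rs → r′ ∈ rs → lhs r ≢ reversed-lhs r′
      go {r = r} _         (here refl) (here refl) eq =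
        offset≢𝟎 r (⊖-fixed⇒𝟎 (offset r) (cong (proj₂ ∘ proj₂) eq))
      go {r = r} {r′} (px ∷ _)  (here refl) (there r′∈) eq = All.lookup px r′∈ (inj₂ (swap r r′ eq))
      go (px ∷ _)  (there r∈)  (here refl) eq = All.lookup px r∈ (inj₂ eq)
      go (_ ∷ ps)  (there r∈)  (there r′∈) eq = go ps r∈ r′∈ eq

    σ-rule-fwd : ∀ {r c c′} → r ∈ rules σ → Fwd r c c′ → σ-rule σ c c′ ≡ just (image r)
    σ-rule-fwd {r} {[ u , _ ]} r∈ (refl , refl , refl)
      rewrite ⊕-⊖-cancelˡ u (offset r) | lookupRule-just (deterministic σ) r∈ = refl

    -- `σ-rule` tries the pair in the given order first, so that lookup has to be shown to fail
    -- before the negated one counts.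
    σ-rule-bwd : ∀ {r c c′} → r ∈ rules σ → Fwd r c c′ → σ-rule σ c′ c ≡ just (⊖ image r)
    σ-rule-bwd {r} {[ u , _ ]} r∈ (refl , refl , refl)
      rewrite ⊖-⊕-cancelˡ u (offset r)
            | lookupRule-nothing (rules σ) (reversed-lhs r) (λ r′∈ → not-reversed r′∈ r∈)
            | ⊕-⊖-cancelˡ u (offset r) | lookupRule-just (deterministic σ) r∈ = refl

  distinct-vectors : (P : Pattern d k) → ∀ {c c′} → c ∈ cells P → c′ ∈ cells P →
                     vector c ≡ vector c′ → c ≡ c′
  distinct-vectors P = go (distinct P)
    where
    go : ∀ {cs : List (Cell d k)} → Unique (map vector cs) → ∀ {c c′} → c ∈ cs → c′ ∈ cs →
         vector c ≡ vector c′ → c ≡ c′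
    go _        (here refl) (here refl)  _  = refl
    go (px ∷ _) (here refl) (there c′∈)  eq = contradiction eq (All.lookup px (∈-map⁺ vector c′∈))
    go (px ∷ _) (there c∈)  (here refl)  eq = contradiction (sym eq) (All.lookup px (∈-map⁺ vector c∈))
    go (_ ∷ ps) (there c∈)  (there c′∈)  eq = go ps c∈ c′∈ eq

  -- A consistency criterion

  module _ (σ : Substitution d k) (e : ℤ^ d) where

    -- The index counts the steps before the exceptional rule; the stretches of a chain whose length
    -- is not fixed in advance are refuted by recursion on it.
    data Reaches (P : Pattern d k) : ℕ → Cell d k → Set where
      arrive : ∀ {r c c′} → r ∈ rules σ → image r ≡ e → Fwd r c c′ → c′ ∈ cells P →
               Reaches P zero c
      step   : ∀ {n r c c′} → r ∈ rules σ → image r ≡ 𝟎 → Fwd r c c′ → c′ ∈ cells P →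
               Reaches P n c′ → Reaches P (suc n) c

    module _ (functional : ∀ {r r′} → r ∈ rules σ → r′ ∈ rules σ →
                           source r ≡ source r′ → offset r ≡ offset r′)
             (binary     : ∀ {r} → r ∈ rules σ → image r ≡ 𝟎 ⊎ image r ≡ e)
             (no-return  : ∀ {P r c c′ n} → r ∈ rules σ → image r ≡ e → Fwd r c c′ →
                           c′ ∈ cells P → ¬ Reaches P n c′)
             where

      private
        module _ (P : Pattern d k) where

          Reach : Cell d k → Set
          Reach c = ∃[ n ] Reaches P n c

          fwd-unique : ∀ {r r′ c c₁ c₂} → r ∈ rules σ → r′ ∈ rules σ → Fwd r c c₁ → Fwd r′ c c₂ →
                       c₁ ∈ cells P → c₂ ∈ cells P → c₁ ≡ c₂
          fwd-unique {c = c} r∈ r′∈ (s₁ , _ , v₁) (s₂ , _ , v₂) c₁∈ c₂∈ = distinct-vectors P c₁∈ c₂∈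
            (trans v₁ (trans (cong (vector c ⊕_) (functional r∈ r′∈ (trans (sym s₁) s₂))) (sym v₂)))

          -- Successors are unique, so a chain from `c` passes through `c′`. Were its first step the
          -- exceptional one, `σ-rule` would take both values 𝟎 and `e` on the same pair of cells.
          reach-step : ∀ {r c c′} → r ∈ rules σ → image r ≡ 𝟎 → e ≢ 𝟎 → Fwd r c c′ → c′ ∈ cells P →
                       Reach c → Reach c′
          reach-step r∈ i0 e≢𝟎 f c′∈ (_ , arrive r′∈ ie f′ c″∈)
            with refl ← fwd-unique r∈ r′∈ f f′ c′∈ c″∈ =
            contradiction (trans (sym ie) (trans (sym (just-injective
              (trans (sym (σ-rule-fwd σ r∈ f)) (σ-rule-fwd σ r′∈ f′)))) i0)) e≢𝟎
          reach-step r∈ i0 e≢𝟎 f c′∈ (_ , step r′∈ _ f′ c″∈ reach)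
            with refl ← fwd-unique r∈ r′∈ f f′ c′∈ c″∈ = _ , reach

          -- A relation rather than a function, because reachability is not decided. Image vectors
          -- of paths will be differences of potentials.
          Potential : Cell d k → ℤ^ d → Set
          Potential c x = (Reach c × x ≡ 𝟎) ⊎ (¬ Reach c × x ≡ e)

          potential-unique : ∀ {c x y} → Potential c x → Potential c y → x ≡ y
          potential-unique (inj₁ (_ , refl)) (inj₁ (_ , refl)) = refl
          potential-unique (inj₂ (_ , refl)) (inj₂ (_ , refl)) = refl
          potential-unique (inj₁ (r , _))    (inj₂ (¬r , _))   = contradiction r ¬r
          potential-unique (inj₂ (¬r , _))   (inj₁ (r , _))    = contradiction r ¬r

          potential-transfer : ∀ {c c′ x} → (Reach c → Reach c′) → (Reach c′ → Reach c) →
                               Potential c x → Potential c′ x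
          potential-transfer f g (inj₁ (r , eq))  = inj₁ (f r , eq)
          potential-transfer f g (inj₂ (¬r , eq)) = inj₂ (¬r ∘ g , eq)

          potential-step : e ≢ 𝟎 → ∀ {c c′ x} → c ∈ cells P → c′ ∈ cells P → Adjacent σ c c′ →
                           Potential c x → ∃[ y ] Potential c′ y × σ-rule σ c c′ ≡ just (y ⊖ x)
          potential-step e≢𝟎 {x = x} c∈ c′∈ adj pot with adjacent⁻ σ adj
          ... | r , r∈ , dir with binary r∈
          potential-step e≢𝟎 {x = x} c∈ c′∈ adj pot | r , r∈ , inj₁ f | inj₁ i0 =
            x , potential-transfer (reach-step r∈ i0 e≢𝟎 f c′∈)
                                   (λ (_ , reach) → _ , step r∈ i0 f c′∈ reach) pot
            , trans (σ-rule-fwd σ r∈ f) (cong just (trans i0 (sym (⊖-inverse x))))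
          potential-step e≢𝟎 {x = x} c∈ c′∈ adj pot | r , r∈ , inj₂ f | inj₁ i0 =
            x , potential-transfer (λ (_ , reach) → _ , step r∈ i0 f c∈ reach)
                                   (reach-step r∈ i0 e≢𝟎 f c∈) pot
            , trans (σ-rule-bwd σ r∈ f) (cong just
                (trans (cong ⊖_ i0) (trans ⊖𝟎 (sym (⊖-inverse x)))))
          -- The source of an exceptional step reaches by that very step and has potential 𝟎; by
          -- `no-return` the target does not reach and has potential `e`.
          potential-step e≢𝟎 c∈ c′∈ adj pot | r , r∈ , inj₁ f | inj₂ ie
            with refl ← potential-unique pot (inj₁ ((_ , arrive r∈ ie f c′∈) , refl)) =
            e , inj₂ ((λ (_ , reach) → no-return r∈ ie f c′∈ reach) , refl)
            , trans (σ-rule-fwd σ r∈ f) (cong just (trans ie (sym (minus-𝟎 e))))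
            where
            minus-𝟎 : ∀ {d} (u : ℤ^ d) → u ⊖ 𝟎 ≡ u
            minus-𝟎 []      = refl
            minus-𝟎 (i ∷ u) = cong₂ _∷_ (ℤₚ.+-identityʳ i) (minus-𝟎 u)
          potential-step e≢𝟎 c∈ c′∈ adj pot | r , r∈ , inj₂ f | inj₂ ie
            with refl ← potential-unique pot
                   (inj₂ ((λ (_ , reach) → no-return r∈ ie f c∈ reach) , refl)) =
            𝟎 , inj₁ ((_ , arrive r∈ ie f c∈) , refl)
            , trans (σ-rule-bwd σ r∈ f) (cong just (trans (cong ⊖_ ie) (sym (𝟎-minus e))))
            where
            𝟎-minus : ∀ {d} (u : ℤ^ d) → 𝟎 ⊖ u ≡ ⊖ u
            𝟎-minus []      = refl
            𝟎-minus (i ∷ u) = cong₂ _∷_ (ℤₚ.+-identityˡ (ℤ.- i)) (𝟎-minus u)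

          ω-potential : e ≢ 𝟎 → ∀ {c c′ x} γ → head γ ≡ just c → last γ ≡ just c′ →
                        Linked (Adjacent σ) γ → All (_∈ cells P) γ → Potential c x →
                        ∃[ y ] Potential c′ y × ω σ γ ≡ just (y ⊖ x)
          ω-potential e≢𝟎 {x = x} (c ∷ []) refl refl _ _ pot =
            x , pot , cong just (sym (⊖-inverse x))
          ω-potential e≢𝟎 {x = x} (c ∷ c₁ ∷ γ) refl end (adj ∷ link) (c∈ ∷ c₁∈ ∷ γ⊆) pot
            with potential-step e≢𝟎 c∈ c₁∈ adj pot
          ... | y , pot₁ , eq₁ with ω-potential e≢𝟎 (c₁ ∷ γ) refl end link (c₁∈ ∷ γ⊆) pot₁
          ... | z , pot₂ , eq₂ = z , pot₂
            , trans (cong₂ (Maybe.zipWith _⊕_) eq₁ eq₂) (cong just (⊖-telescope x y z))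

      consistent : e ≢ 𝟎 → Consistent σ
      consistent e≢𝟎 P covered {c} {c′} c∈ c′∈ {γ} {γ′} (p , γ⊆) (p′ , γ′⊆) =
        -- Equality of image vectors is decidable, hence stable under double negation, so it may be
        -- proved assuming that reachability of `c` is decided.
        decidable-stable (≡-dec-Maybe (Vecₚ.≡-dec ℤ._≟_) (ω σ γ) (ω σ γ′))
          (λ ω≢ → ¬¬-excluded-middle {A = Reach P c} (λ reach? → ω≢ (equal (potential reach?))))
        where
        potential : Dec (Reach P c) → ∃[ x ] Potential P c x
        potential (yes reach) = 𝟎 , inj₁ (reach , refl)
        potential (no ¬reach) = e , inj₂ (¬reach , refl)

        equal : ∃[ x ] Potential P c x → ω σ γ ≡ ω σ γ′
        equal (x , pot)
          with y , pot₁ , eq₁ ← ω-potential P e≢𝟎 γ (IsPath.starts p) (IsPath.ends p) (IsPath.steps p) γ⊆ pot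
             | z , pot₂ , eq₂ ← ω-potential P e≢𝟎 γ′ (IsPath.starts p′) (IsPath.ends p′) (IsPath.steps p′) γ′⊆ pot
          = trans eq₁ (trans (cong (λ v → just (v ⊖ x)) (potential-unique P pot₁ pot₂)) (sym eq₂))

  -- An inconsistency criterion

  module _ (σ : Substitution d k) where

    module _ (P : Pattern d k) where

      data Walk : Cell d k → Cell d k → Set where
        done : ∀ {c} → c ∈ cells P → Walk c c
        move : ∀ {c c₁ c₂} → c ∈ cells P → Adjacent σ c c₁ → Walk c₁ c₂ → Walk c c₂

      walk-trans : ∀ {c₁ c₂ c₃} → Walk c₁ c₂ → Walk c₂ c₃ → Walk c₁ c₃
      walk-trans (done _)        w′ = w′
      walk-trans (move c∈ adj w) w′ = move c∈ adj (walk-trans w w′)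

      walk-start : ∀ {c₁ c₂} → Walk c₁ c₂ → c₁ ∈ cells P
      walk-start (done c∈)     = c∈
      walk-start (move c∈ _ _) = c∈

      walk-sym : ∀ {c₁ c₂} → Walk c₁ c₂ → Walk c₂ c₁
      walk-sym (done c∈)       = done c∈
      walk-sym (move c∈ adj w) =
        walk-trans (walk-sym w) (move (walk-start w) (adjacent-sym σ adj) (done c∈))

      trace : ∀ {c₁ c₂} → Walk c₁ c₂ → List (Cell d k)
      trace (done {c} _)     = c ∷ []
      trace (move {c} _ _ w) = c ∷ trace w

      trace-last : ∀ {c₁ c₂} (w : Walk c₁ c₂) → last (trace w) ≡ just c₂
      trace-last (done _)                       = refl
      trace-last (move _ _ (done _))            = refl
      trace-last (move _ _ w@(move _ _ _))      = trace-last w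

      trace-head : ∀ {c₁ c₂} (w : Walk c₁ c₂) → head (trace w) ≡ just c₁
      trace-head (done _)     = refl
      trace-head (move _ _ _) = refl

      trace-linked : ∀ {c₁ c₂} (w : Walk c₁ c₂) → Linked (Adjacent σ) (trace w)
      trace-linked (done _)                       = [-]
      trace-linked (move _ adj (done _))          = adj ∷ [-]
      trace-linked (move _ adj w@(move _ _ _))    = adj ∷ trace-linked w

      trace-⊆ : ∀ {c₁ c₂} (w : Walk c₁ c₂) → All (_∈ cells P) (trace w)
      trace-⊆ (done c∈)     = c∈ ∷ []
      trace-⊆ (move c∈ _ w) = c∈ ∷ trace-⊆ w

      pathOf : ∀ {c c′ γ} → head γ ≡ just c → last γ ≡ just c′ → Linked (Adjacent σ) γ →
               All (_∈ cells P) γ → IsPathOf σ P c c′ γ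
      pathOf starts ends steps γ⊆ = record
        { starts = starts ; ends = ends ; steps = steps
        ; nonOverlap = λ a∈ b∈ → distinct-vectors P (All.lookup γ⊆ a∈) (All.lookup γ⊆ b∈)
        } , γ⊆

      walk-path : ∀ {c c′} → Walk c c′ → ∃ (IsPathOf σ P c c′)
      walk-path w = trace w , pathOf (trace-head w) (trace-last w) (trace-linked w) (trace-⊆ w)

      linked-covered : ∀ {h H} → Linked (Adjacent σ) (h ∷ H) → (∀ {c} → c ∈ h ∷ H → c ∈ cells P) →
                       ∀ {c} → c ∈ h ∷ H → Walk h c
      linked-covered link         ⊆P (here refl) = done (⊆P (here refl))
      linked-covered (adj ∷ link) ⊆P (there c∈)  =
        move (⊆P (here refl)) adj (linked-covered link (⊆P ∘ there) c∈)

    -- The later cell is the first argument: chains are lists with the latest cell at the head, so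
    -- that they grow by `_∷_`.
    ZeroStep : Cell d k → Cell d k → Set
    ZeroStep c′ c = ∃[ r ] r ∈ rules σ × image r ≡ 𝟎 × Fwd r c c′

    zeroStep-adjacent : ∀ {c′ c} → ZeroStep c′ c → Adjacent σ c′ c
    zeroStep-adjacent (r , r∈ , _ , f) = adjacent-sym σ (adjacent-fwd σ r∈ f)

    zeroSteps-adjacent : ∀ {H} → Linked ZeroStep H → Linked (Adjacent σ) H
    zeroSteps-adjacent []         = []
    zeroSteps-adjacent [-]        = [-]
    zeroSteps-adjacent (z ∷ link) = zeroStep-adjacent z ∷ zeroSteps-adjacent link

    ω-zeroSteps : ∀ {H} → Linked ZeroStep H → ω σ H ≡ just 𝟎
    ω-zeroSteps []  = refl
    ω-zeroSteps [-] = refl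
    ω-zeroSteps ((r , r∈ , i0 , f) ∷ link) =
      trans (cong₂ (Maybe.zipWith _⊕_) (σ-rule-bwd σ r∈ f) (ω-zeroSteps link))
            (cong just (trans (⊕-identityʳ _) (trans (cong ⊖_ i0) ⊖𝟎)))

    -- The closed chain is a loop at `c₀` that crosses the exceptional rule once, backwards, and
    -- otherwise only steps of image 𝟎. It competes with the one-cell path at `c₀`.
    inconsistent : ∀ {h c₀ H r} → Unique (map vector (h ∷ H)) → Linked ZeroStep (h ∷ H) →
                   last (h ∷ H) ≡ just c₀ → r ∈ rules σ → image r ≢ 𝟎 → Fwd r h c₀ →
                   ¬ Consistent σ
    inconsistent {h} {c₀} {H} {r} unique link end r∈ i≢𝟎 f consistent =
      i≢𝟎 (trans (sym (⊖-involutive (image r))) (trans (cong ⊖_ loop-image) ⊖𝟎))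
      where
      P : Pattern d k
      P = record { cells = h ∷ H ; distinct = unique }

      link′ : Linked (Adjacent σ) (h ∷ H)
      link′ = zeroSteps-adjacent link

      last-∈ : ∀ {A : Set} {x : A} xs → last xs ≡ just x → x ∈ xs
      last-∈ (x ∷ [])     refl = here refl
      last-∈ (x ∷ y ∷ xs) eq   = there (last-∈ (y ∷ xs) eq)

      c₀∈ : c₀ ∈ cells P
      c₀∈ = last-∈ (h ∷ H) end

      covered : Covered σ P
      covered c∈ c′∈ = walk-path P (walk-trans P (walk-sym P (linked-covered P link′ (λ x → x) c∈))
                                                (linked-covered P link′ (λ x → x) c′∈))

      loop-image : ⊖ image r ≡ 𝟎
      loop-image = trans (sym (⊕-identityʳ (⊖ image r))) (just-injective (trans
        (sym (cong₂ (Maybe.zipWith _⊕_) (σ-rule-bwd σ r∈ f) (ω-zeroSteps link)))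
        (consistent P covered c₀∈ c₀∈ {c₀ ∷ h ∷ H} {c₀ ∷ []}
          (pathOf P refl end (adjacent-sym σ (adjacent-fwd σ r∈ f) ∷ link′)
            (c₀∈ ∷ All.tabulate (λ x → x)))
          (pathOf P refl refl [-] (c₀∈ ∷ [])))))

-- Closure properties of total recursive functions

module Recursion where

  open import Defs using (zeroᴿ; succᴿ; projᴿ; compᴿ; precᴿ; _·_⇓_; _·_⇓*_;
    zero⇓; succ⇓; proj⇓; comp⇓; precZero⇓; precSuc⇓; []; _∷_)
  open import Data.Fin using (Fin; zero; suc)
  open import Data.Nat using (ℕ; zero; suc; pred; _+_; _*_; _^_)
  open import Data.Product using (∃-syntax; _,_)
  open import Data.Vec using (Vec; []; _∷_; lookup; map; tabulate; allFin; head; tail)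
  open import Data.Vec.Properties using (map-lookup-allFin; tabulate-allFin; map-∘)
  open import Relation.Binary.PropositionalEquality

  private variable
    m n : ℕ
    F G H : Vec ℕ n → ℕ

  Computable : (Vec ℕ n → ℕ) → Set
  Computable {n} F = ∃[ f ] ∀ xs → f · xs ⇓ F xs

  Computable* : (Vec ℕ n → Vec ℕ m) → Set
  Computable* {n} {m} F = ∃[ fs ] ∀ xs → fs · xs ⇓* F xs

  -- Takes index and previous value in the order of `precᴿ`, so a function written with it is shown
  -- computable by following its shape.
  natrec : ℕ → (ℕ → ℕ → ℕ) → ℕ → ℕ
  natrec z s zero    = z
  natrec z s (suc n) = s n (natrec z s n)

  respᶜ : (∀ xs → F xs ≡ G xs) → Computable F → Computable G
  respᶜ eq (f , f⇓) = f , λ xs → subst (f · xs ⇓_) (eq xs) (f⇓ xs)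

  var : (i : Fin n) → Computable (λ xs → lookup xs i)
  var i = projᴿ i , λ xs → proj⇓

  []ᶜ : Computable* {n} (λ xs → [])
  []ᶜ = [] , λ xs → []

  _∷ᶜ_ : ∀ {G : Vec ℕ n → Vec ℕ m} → Computable F → Computable* G → Computable* (λ xs → F xs ∷ G xs)
  (f , f⇓) ∷ᶜ (gs , gs⇓) = f ∷ gs , λ xs → f⇓ xs ∷ gs⇓ xs

  call : ∀ {G : Vec ℕ n → Vec ℕ m} → Computable F → Computable* G → Computable (λ xs → F (G xs))
  call (f , f⇓) (gs , gs⇓) = compᴿ f gs , λ xs → comp⇓ (gs⇓ xs) (f⇓ _)

  vars : (is : Vec (Fin n) m) → Computable* (λ xs → map (lookup xs) is)
  vars []       = []ᶜ
  vars (i ∷ is) = var i ∷ᶜ vars is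

  idᶜ : Computable* {n} (λ xs → xs)
  idᶜ {n} with gs , gs⇓ ← vars (allFin n) =
    gs , λ xs → subst (gs · xs ⇓*_) (map-lookup-allFin xs) (gs⇓ xs)

  -- Weakening by the two extra variables of the step function of natrec.
  weaken : Computable F → Computable (λ xs → F (tail (tail xs)))
  weaken {n} Fᶜ with gs , gs⇓ ← vars {suc (suc n)} (tabulate (λ i → suc (suc i))) =
    call Fᶜ (gs , λ { (x ∷ y ∷ xs) → subst (gs · x ∷ y ∷ xs ⇓*_) (drop₂ x y xs) (gs⇓ (x ∷ y ∷ xs)) })
    where
    drop₂ : ∀ {n} x y (xs : Vec ℕ n) → map (lookup (x ∷ y ∷ xs)) (tabulate (λ i → suc (suc i))) ≡ xs
    drop₂ x y xs = trans (cong (map (lookup (x ∷ y ∷ xs))) (tabulate-allFin (λ i → suc (suc i))))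
      (trans (sym (map-∘ _ _ (allFin _))) (map-lookup-allFin xs))

  sucᶜ : Computable F → Computable (λ xs → suc (F xs))
  sucᶜ Fᶜ = call {F = λ xs → suc (head xs)} (succᴿ , λ { (x ∷ []) → succ⇓ }) (Fᶜ ∷ᶜ []ᶜ)

  lit : ∀ k → Computable {n} (λ xs → k)
  lit zero    = zeroᴿ , λ xs → zero⇓
  lit (suc k) = sucᶜ (lit k)

  natrecᶜ : ∀ {S : Vec ℕ (suc (suc n)) → ℕ} → Computable F → Computable S → Computable G →
            Computable (λ xs → natrec (F xs) (λ x y → S (x ∷ y ∷ xs)) (G xs))
  natrecᶜ {F = F} {S = S} (f , f⇓) (s , s⇓) G =
    call {F = λ xs → natrec (F (tail xs)) (λ x y → S (x ∷ y ∷ tail xs)) (head xs)}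
      (precᴿ f s , λ { (x ∷ xs) → run x xs }) (G ∷ᶜ idᶜ)
    where
    run : ∀ x xs → precᴿ f s · x ∷ xs ⇓ natrec (F xs) (λ x y → S (x ∷ y ∷ xs)) x
    run zero    xs = precZero⇓ (f⇓ xs)
    run (suc x) xs = precSuc⇓ (run x xs) (s⇓ _)

  acc : Computable {suc (suc n)} (λ xs → head (tail xs))
  acc = respᶜ (λ { (x ∷ y ∷ xs) → refl }) (var (suc zero))

  headᶜ : Computable {suc n} head
  headᶜ = respᶜ (λ { (x ∷ xs) → refl }) (var zero)

  predᶜ : Computable F → Computable (λ xs → pred (F xs))
  predᶜ {F = F} Fᶜ = respᶜ (λ xs → eq (F xs)) (natrecᶜ (lit 0) headᶜ Fᶜ)
    where
    eq : ∀ x → natrec 0 (λ x y → x) x ≡ pred x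
    eq zero    = refl
    eq (suc x) = refl

  _+ᶜ_ : Computable F → Computable G → Computable (λ xs → F xs + G xs)
  _+ᶜ_ {F = F} {G = G} Fᶜ Gᶜ = respᶜ (λ xs → eq (F xs) (G xs)) (natrecᶜ Gᶜ (sucᶜ acc) Fᶜ)
    where
    eq : ∀ x y → natrec y (λ x y → suc y) x ≡ x + y
    eq zero    y = refl
    eq (suc x) y = cong suc (eq x y)

  _*ᶜ_ : Computable F → Computable G → Computable (λ xs → F xs * G xs)
  _*ᶜ_ {F = F} {G = G} Fᶜ Gᶜ = respᶜ (λ xs → eq (F xs) (G xs)) (natrecᶜ (lit 0) (weaken Gᶜ +ᶜ acc) Fᶜ)
    where
    eq : ∀ x y → natrec 0 (λ _ z → y + z) x ≡ x * y
    eq zero    y = refl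
    eq (suc x) y = cong (y +_) (eq x y)

  2^ᶜ_ : Computable F → Computable (λ xs → 2 ^ F xs)
  2^ᶜ_ {F = F} Fᶜ = respᶜ (λ xs → eq (F xs)) (natrecᶜ (lit 1) (lit 2 *ᶜ acc) Fᶜ)
    where
    eq : ∀ x → natrec 1 (λ _ z → 2 * z) x ≡ 2 ^ x
    eq zero    = refl
    eq (suc x) = cong (2 *_) (eq x)

  consCode : ℕ → ℕ → ℕ
  consCode x c = 2 ^ x * (1 + 2 * c)

  consCodeᶜ : Computable F → Computable G → Computable (λ xs → consCode (F xs) (G xs))
  consCodeᶜ Fᶜ Gᶜ = (2^ᶜ Fᶜ) *ᶜ (lit 1 +ᶜ (lit 2 *ᶜ Gᶜ))

-- From recursive functions to loop programs on registers

module Compilation where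

  open import Defs using (Rec; zeroᴿ; succᴿ; projᴿ; compᴿ; precᴿ; minᴿ; _·_⇓_; _·_⇓*_;
    zero⇓; succ⇓; proj⇓; comp⇓; precZero⇓; precSuc⇓; min⇓; []; _∷_)
  open import Data.Fin using (Fin; zero; suc; _↑ˡ_; _↑ʳ_)
  open import Data.Nat using (ℕ; zero; suc; _+_; _<_; s≤s)
  open import Data.Nat.Properties using (+-suc; +-identityʳ; m≤m+n)
  open import Data.Product using (∃-syntax; _×_; _,_)
  open import Data.Vec using (Vec; []; _∷_; _++_; lookup; map; tabulate; updateAt; _[_]≔_)
  open import Data.Vec.Properties
  open import Relation.Binary.PropositionalEquality

  infixr 5 _⨾_
  infix 4 _⊢_⇒_

  private variable
    m n k : ℕ

  data Prog : ℕ → Set where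
    inc clr : Fin m → Prog m
    loop    : Fin m → Prog m → Prog m
    _⨾_     : Prog m → Prog m → Prog m
    new     : Prog (suc m) → Prog m

  -- loop i p decrements register i before each run of p, until it reads 0.
  data _⊢_⇒_ : Prog m → Vec ℕ m → Vec ℕ m → Set where
    inc⇒  : ∀ {i : Fin m} {ρ} → inc i ⊢ ρ ⇒ updateAt ρ i suc
    clr⇒  : ∀ {i : Fin m} {ρ} → clr i ⊢ ρ ⇒ ρ [ i ]≔ 0
    stop⇒ : ∀ {i : Fin m} {p ρ} → lookup ρ i ≡ 0 → loop i p ⊢ ρ ⇒ ρ
    iter⇒ : ∀ {i : Fin m} {p ρ ρ₁ ρ₂ x} → lookup ρ i ≡ suc x →
            p ⊢ ρ [ i ]≔ x ⇒ ρ₁ → loop i p ⊢ ρ₁ ⇒ ρ₂ → loop i p ⊢ ρ ⇒ ρ₂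
    seq⇒  : ∀ {p q : Prog m} {ρ ρ₁ ρ₂} → p ⊢ ρ ⇒ ρ₁ → q ⊢ ρ₁ ⇒ ρ₂ → p ⨾ q ⊢ ρ ⇒ ρ₂
    new⇒  : ∀ {p : Prog (suc m)} {ρ ρ₁ x} → p ⊢ 0 ∷ ρ ⇒ x ∷ ρ₁ → new p ⊢ ρ ⇒ ρ₁

  drain : Fin m → Prog (suc m)
  drain j = loop zero (inc (suc j))

  drain⇒ : ∀ x (j : Fin m) ρ → drain j ⊢ x ∷ ρ ⇒ 0 ∷ updateAt ρ j (x +_)
  drain⇒ zero    j ρ = subst (λ ρ₁ → drain j ⊢ 0 ∷ ρ ⇒ 0 ∷ ρ₁)
    (sym (updateAt-id-local j ρ refl)) (stop⇒ refl)
  drain⇒ (suc x) j ρ = iter⇒ refl inc⇒ (subst (λ ρ₁ → drain j ⊢ x ∷ updateAt ρ j suc ⇒ 0 ∷ ρ₁)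
    (updateAt-updateAt-local j ρ (+-suc x (lookup ρ j))) (drain⇒ x j (updateAt ρ j suc)))

  -- A loop destroys the register it counts, so the value also goes to a scratch register, from
  -- which the original is refilled.
  copy : Fin m → Prog (suc m)
  copy a = new (loop (suc (suc a)) (inc (suc zero) ⨾ inc zero) ⨾ drain (suc a))

  copy-loop⇒ : ∀ x (a : Fin m) s o ρ → lookup ρ a ≡ x →
               loop (suc (suc a)) (inc (suc zero) ⨾ inc zero) ⊢ s ∷ o ∷ ρ ⇒
               x + s ∷ x + o ∷ (ρ [ a ]≔ 0)
  copy-loop⇒ zero    a s o ρ eq = subst (λ ρ₁ → _ ⊢ _ ⇒ s ∷ o ∷ ρ₁)
    (trans (sym ([]≔-lookup ρ a)) (cong (ρ [ a ]≔_) eq)) (stop⇒ eq)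
  copy-loop⇒ (suc x) a s o ρ eq = iter⇒ eq (seq⇒ inc⇒ inc⇒)
    (subst₂ (λ s′ ρ₁ → loop (suc (suc a)) (inc (suc zero) ⨾ inc zero) ⊢
                       suc s ∷ suc o ∷ (ρ [ a ]≔ x) ⇒ s′ ∷ ρ₁) (+-suc x s)
      (cong₂ _∷_ (+-suc x o) ([]≔-idempotent ρ a))
      (copy-loop⇒ x a (suc s) (suc o) (ρ [ a ]≔ x) (lookup∘update a ρ x)))

  copy⇒ : ∀ (a : Fin m) ρ → copy a ⊢ 0 ∷ ρ ⇒ lookup ρ a ∷ ρ
  copy⇒ a ρ = new⇒ (seq⇒ (copy-loop⇒ x a 0 0 ρ refl)
    (subst₂ (λ s ρ₁ → drain (suc a) ⊢ s ∷ x + 0 ∷ (ρ [ a ]≔ 0) ⇒ 0 ∷ ρ₁)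
      (sym (+-identityʳ x)) (cong₂ _∷_ (+-identityʳ x) restore)
      (drain⇒ x (suc a) (x + 0 ∷ (ρ [ a ]≔ 0)))))
    where
    x = lookup ρ a

    restore : updateAt (ρ [ a ]≔ 0) a (x +_) ≡ ρ
    restore = trans (updateAt-updateAt-local a {h = λ z → z} ρ (+-identityʳ x)) (updateAt-id-local a ρ refl)

  -- The program compile f ins leaves the value of f at the registers ins in the
  -- new top register 0.
  compile  : Rec n → Vec (Fin m) n → Prog (suc m)
  compile* : Vec (Rec n) k → Vec (Fin m) n → Prog (k + m) → Prog m

  compile zeroᴿ        ins       = clr zero
  compile succᴿ        (a ∷ [])  = copy a ⨾ inc zero
  compile (projᴿ i)    ins       = copy (lookup ins i)
  compile {m = m} (compᴿ {k} f gs) ins = compile* gs (map suc ins)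
    -- From the top, the registers are the value of `f`, its `k` arguments, and then the result
    -- register of the composite, which the drain fills.
    (new (compile f (tabulate (_↑ˡ suc m)) ⨾ drain (k ↑ʳ zero)))
  compile (precᴿ g h)  (c ∷ ins) =
    -- Above the value, first that of `g`, lie the number of rounds left and, on top, the index of
    -- the current round.
    compile g ins ⨾ new (copy (suc c) ⨾ new (loop (suc zero) (precBody (compile h (precIns ins)))))
    where
    precIns : Vec (Fin m) n → Vec (Fin (3 + m)) (2 + n)
    precIns ins = zero ∷ suc (suc zero) ∷ map (3 ↑ʳ_) ins

    precBody : Prog (4 + m) → Prog (3 + m)
    precBody p = new (p ⨾ clr (suc (suc (suc zero))) ⨾ drain (suc (suc zero))) ⨾ inc zero
  compile (minᴿ f)     ins       =
    -- The result register itself holds the candidate, initially 0. The loop ends at the value 0 of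
    -- `f`; otherwise the rest of the value is cleared, as compiled code expects its result register
    -- to be 0.
    new (compile f (zero ∷ map suc ins) ⨾
         loop zero (clr zero ⨾ inc (suc zero) ⨾ compile f (zero ∷ map suc ins)))

  compile* []       ins p = p
  -- The tail is computed first, hence the shift of `ins` by `k`; the continuation finds all values
  -- in order on top.
  compile* {k = suc k} (g ∷ gs) ins p =
    compile* gs ins (new (compile g (map (k ↑ʳ_) ins) ⨾ p))

  map-lookup-↑ʳ : (ys : Vec ℕ k) (ρ : Vec ℕ m) (ins : Vec (Fin m) n) →
                  map (lookup ρ) ins ≡ map (lookup (ys ++ ρ)) (map (k ↑ʳ_) ins)
  map-lookup-↑ʳ ys ρ ins = trans (map-cong (λ i → sym (lookup-++ʳ ys ρ i)) ins) (map-∘ _ _ ins)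

  map-lookup-↑ˡ : (ys : Vec ℕ k) (ρ : Vec ℕ m) → map (lookup (ys ++ ρ)) (tabulate (_↑ˡ m)) ≡ ys
  map-lookup-↑ˡ {m = m} ys ρ = trans (sym (tabulate-∘ (lookup (ys ++ ρ)) (_↑ˡ m)))
    (trans (tabulate-cong (lookup-++ˡ ys ρ)) (tabulate∘lookup ys))

  updateAt-++ʳ : ∀ (ys : Vec ℕ k) (ρ : Vec ℕ m) i f → updateAt (ys ++ ρ) (k ↑ʳ i) f ≡ ys ++ updateAt ρ i f
  updateAt-++ʳ []       ρ i f = refl
  updateAt-++ʳ (y ∷ ys) ρ i f = cong (y ∷_) (updateAt-++ʳ ys ρ i f)

  compile⇒  : ∀ (f : Rec n) (ins : Vec (Fin m) n) {ρ y} → f · map (lookup ρ) ins ⇓ y →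
              compile f ins ⊢ 0 ∷ ρ ⇒ y ∷ ρ
  compile*⇒ : ∀ (gs : Vec (Rec n) k) (ins : Vec (Fin m) n) {ρ ρ₁ ys zs p} →
              gs · map (lookup ρ) ins ⇓* ys → p ⊢ ys ++ ρ ⇒ zs ++ ρ₁ →
              compile* gs ins p ⊢ ρ ⇒ ρ₁

  compile⇒ zeroᴿ     ins      zero⇓ = clr⇒
  compile⇒ succᴿ     (a ∷ []) succ⇓ = seq⇒ (copy⇒ a _) inc⇒
  compile⇒ (projᴿ i) ins {ρ}  proj⇓ = subst (λ x → copy (lookup ins i) ⊢ 0 ∷ ρ ⇒ x ∷ ρ)
    (sym (lookup-map i (lookup ρ) ins)) (copy⇒ (lookup ins i) ρ)
  compile⇒ (compᴿ {k} f gs) ins {ρ} {y} (comp⇓ {ys = ys} gs⇓ f⇓) =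
    compile*⇒ gs (map suc ins) {zs = ys} (subst (λ xs → gs · xs ⇓* ys) (map-∘ _ _ ins) gs⇓)
      (new⇒ (seq⇒ (compile⇒ f _ (subst (λ xs → f · xs ⇓ y) (sym (map-lookup-↑ˡ ys (0 ∷ ρ))) f⇓))
        (subst (λ ρ₁ → drain (k ↑ʳ zero) ⊢ y ∷ ys ++ 0 ∷ ρ ⇒ 0 ∷ ρ₁)
          (trans (updateAt-++ʳ ys (0 ∷ ρ) zero (y +_)) (cong (λ z → ys ++ z ∷ ρ) (+-identityʳ y)))
          (drain⇒ y (k ↑ʳ zero) (ys ++ 0 ∷ ρ)))))
  compile⇒ {m = m} (precᴿ {n} g h) (c ∷ ins) {ρ} {y} f⇓ =
    let y₀ , g⇓ , loop⇒ = rounds (lookup ρ c) f⇓ 0 (stop⇒ refl)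
    in seq⇒ (compile⇒ g ins g⇓) (new⇒ (seq⇒ (copy⇒ (suc c) (y₀ ∷ ρ)) (new⇒
         (subst (λ x → loop (suc zero) body ⊢ 0 ∷ x ∷ y₀ ∷ ρ ⇒ lookup ρ c ∷ 0 ∷ y ∷ ρ)
           (+-identityʳ (lookup ρ c)) loop⇒))))
    where
    xs = map (lookup ρ) ins
    insₕ = zero ∷ suc (suc zero) ∷ map (3 ↑ʳ_) ins
    body = new (compile h insₕ ⨾ clr (suc (suc (suc zero))) ⨾ drain (suc (suc zero))) ⨾ inc zero

    body⇒ : ∀ {x y z r} → h · x ∷ y ∷ xs ⇓ z → body ⊢ x ∷ r ∷ y ∷ ρ ⇒ suc x ∷ r ∷ z ∷ ρ
    body⇒ {x} {y} {z} {r} h⇓ = seq⇒ (new⇒ (seq⇒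
      (compile⇒ h insₕ (subst (λ xs → h · x ∷ y ∷ xs ⇓ z) (map-lookup-↑ʳ (x ∷ r ∷ y ∷ []) ρ ins) h⇓))
      (seq⇒ clr⇒ (subst (λ z′ → drain (suc (suc zero)) ⊢ z ∷ x ∷ r ∷ 0 ∷ ρ ⇒ 0 ∷ x ∷ r ∷ z′ ∷ ρ)
        (+-identityʳ z) (drain⇒ z (suc (suc zero)) (x ∷ r ∷ 0 ∷ ρ)))))) inc⇒

    -- A derivation for `precᴿ` exposes its last round first, while the loop executes its first
    -- round first. So the remaining run is carried along and each round peeled off is put in front
    -- of it.
    rounds : ∀ x {y} → precᴿ g h · x ∷ xs ⇓ y → ∀ r {ρ₁} →
             loop (suc zero) body ⊢ x ∷ r ∷ y ∷ ρ ⇒ ρ₁ →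
             ∃[ y₀ ] g · xs ⇓ y₀ × loop (suc zero) body ⊢ 0 ∷ x + r ∷ y₀ ∷ ρ ⇒ ρ₁
    rounds zero    (precZero⇓ g⇓)    r run = _ , g⇓ , run
    rounds (suc x) (precSuc⇓ f⇓ h⇓) r {ρ₁} run with rounds x f⇓ (suc r) (iter⇒ refl (body⇒ h⇓) run)
    ... | y₀ , g⇓ , run₀ = y₀ , g⇓ ,
      subst (λ n → loop (suc zero) body ⊢ 0 ∷ n ∷ y₀ ∷ ρ ⇒ ρ₁) (+-suc x r) run₀
  compile⇒ (minᴿ f) ins {ρ} {y} (min⇓ below at) =
    let v , f⇓ , run = search y 0 refl in new⇒ (seq⇒ (eval f⇓) run)
    where
    xs = map (lookup ρ) ins
    body = clr zero ⨾ inc (suc zero) ⨾ compile f (zero ∷ map suc ins)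

    eval : ∀ {x v} → f · x ∷ xs ⇓ v → compile f (zero ∷ map suc ins) ⊢ 0 ∷ x ∷ ρ ⇒ v ∷ x ∷ ρ
    eval {x} {v} f⇓ = compile⇒ f (zero ∷ map suc ins)
      (subst (λ xs → f · x ∷ xs ⇓ v) (map-∘ _ _ ins) f⇓)

    -- `r` candidates are left before `y`, and the value of `f` at the current one already sits in
    -- the loop register.
    search : ∀ r x → x + r ≡ y → ∃[ v ] f · x ∷ xs ⇓ v × loop zero body ⊢ v ∷ x ∷ ρ ⇒ 0 ∷ y ∷ ρ
    search zero    x eq = 0 , subst (λ x → f · x ∷ xs ⇓ 0) (sym x≡y) at ,
      subst (λ x → loop zero body ⊢ 0 ∷ x ∷ ρ ⇒ 0 ∷ y ∷ ρ) (sym x≡y) (stop⇒ refl)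
      where
      x≡y : x ≡ y
      x≡y = trans (sym (+-identityʳ x)) eq
    search (suc r) x eq
      with z , f⇓ ← below x (subst (x <_) (trans (sym (+-suc x r)) eq) (s≤s (m≤m+n x r)))
         | v , f⇓′ , run ← search r (suc x) (trans (sym (+-suc x r)) eq) =
      suc z , f⇓ , iter⇒ refl (seq⇒ clr⇒ (seq⇒ inc⇒ (eval f⇓′))) run

  compile*⇒ [] ins {zs = []} [] p⇒ = p⇒
  compile*⇒ {k = suc k} (g ∷ gs) ins {ρ} {zs = z ∷ zs} (_∷_ {y = y} {ys = ys} g⇓ gs⇓) p⇒ =
    compile*⇒ gs ins {zs = zs} gs⇓ (new⇒ (seq⇒
      (compile⇒ g _ (subst (λ xs → g · xs ⇓ y) (map-lookup-↑ʳ ys ρ ins) g⇓)) p⇒))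

-- The list code is injective and exceeds its entries

module Coding where

  open import Defs using (codeList)
  open import Data.List using (List; []; _∷_)
  open import Data.List.Membership.Propositional using (_∈_)
  open import Data.List.Relation.Unary.Any using (here; there)
  open import Data.Nat
  open import Data.Nat.DivMod using ([m+kn]%n≡m%n; m*n%n≡0)
  open import Data.Nat.Properties
  open import Data.Product using (_×_; _,_)
  open import Relation.Binary.PropositionalEquality
  open import Relation.Nullary using (contradiction)

  1+2c≢2^[1+y]n : ∀ y c n → 2 ^ 0 * (1 + 2 * c) ≢ 2 ^ suc y * n
  1+2c≢2^[1+y]n y c n eq = contradiction 1≡0 λ ()
    where
    open ≡-Reasoning
    1≡0 : 1 ≡ 0
    1≡0 = begin
      1                          ≡⟨ [m+kn]%n≡m%n 1 c 2 ⟨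
      (1 + c * 2) % 2            ≡⟨ cong (λ n → (1 + n) % 2) (*-comm c 2) ⟩
      (1 + 2 * c) % 2            ≡⟨ cong (_% 2) (*-identityˡ (1 + 2 * c)) ⟨
      (1 * (1 + 2 * c)) % 2      ≡⟨ cong (_% 2) eq ⟩
      (2 * 2 ^ y * n) % 2        ≡⟨ cong (_% 2) (*-assoc 2 (2 ^ y) n) ⟩
      (2 * (2 ^ y * n)) % 2      ≡⟨ cong (_% 2) (*-comm 2 (2 ^ y * n)) ⟩
      (2 ^ y * n * 2) % 2        ≡⟨ m*n%n≡0 (2 ^ y * n) 2 ⟩
      0                          ∎

  2^x[1+2c]-injective : ∀ x y {c d} → 2 ^ x * (1 + 2 * c) ≡ 2 ^ y * (1 + 2 * d) → x ≡ y × c ≡ d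
  2^x[1+2c]-injective zero    zero    eq = refl , *-cancelˡ-≡ _ _ 2
    (suc-injective (trans (sym (*-identityˡ _)) (trans eq (*-identityˡ _))))
  2^x[1+2c]-injective zero    (suc y) {c} eq = contradiction eq (1+2c≢2^[1+y]n y c _)
  2^x[1+2c]-injective (suc x) zero {d = d} eq = contradiction (sym eq) (1+2c≢2^[1+y]n x d _)
  2^x[1+2c]-injective (suc x) (suc y) {c} {d} eq
    with 2^x[1+2c]-injective x y (*-cancelˡ-≡ (2 ^ x * (1 + 2 * c)) (2 ^ y * (1 + 2 * d)) 2
      (trans (sym (*-assoc 2 (2 ^ x) _)) (trans eq (*-assoc 2 (2 ^ y) _))))
  ... | refl , c≡d = refl , c≡d

  n<2^n : ∀ n → n < 2 ^ n
  n<2^n zero    = s≤s z≤n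
  n<2^n (suc n) = ≤-trans (s≤s (n<2^n n)) (+-mono-≤ (m^n>0 2 n) (m≤m+n (2 ^ n) 0))

  codeList-positive : ∀ x xs → 0 < codeList (x ∷ xs)
  codeList-positive x xs = *-mono-≤ (m^n>0 2 x) (s≤s z≤n)

  codeList-injective : ∀ {xs ys} → codeList xs ≡ codeList ys → xs ≡ ys
  codeList-injective {[]}     {[]}     eq = refl
  codeList-injective {[]}     {y ∷ ys} eq = contradiction (sym eq) (m<n⇒n≢0 (codeList-positive y ys))
  codeList-injective {x ∷ xs} {[]}     eq = contradiction eq (m<n⇒n≢0 (codeList-positive x xs))
  codeList-injective {x ∷ xs} {y ∷ ys} eq with 2^x[1+2c]-injective x y eq
  ... | refl , eq′ = cong (x ∷_) (codeList-injective eq′)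

  -- Applied twice, to the list of rules and to a rule in it, this keeps the numbers of the fixed
  -- symbols below `N`.
  ∈⇒<codeList : ∀ {x xs} → x ∈ xs → x < codeList xs
  ∈⇒<codeList {x} {_ ∷ xs} (here refl) = ≤-trans (n<2^n x)
    (≤-trans (≤-reflexive (sym (*-identityʳ (2 ^ x)))) (*-monoʳ-≤ (2 ^ x) (s≤s z≤n)))
  ∈⇒<codeList {x} {y ∷ xs} (there x∈) = ≤-trans (∈⇒<codeList x∈)
    (≤-trans (≤-trans (m≤m+n _ _) (n≤1+n _))
      (≤-trans (≤-reflexive (sym (*-identityˡ (1 + 2 * codeList xs))))
        (*-monoˡ-≤ (1 + 2 * codeList xs) (m^n>0 2 y))))

-- The substitution attached to a sweeping machine

module Walker where

  open import Defs
  open Consistency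
  open Coding
  open import Data.Fin using (Fin; toℕ)
  import Data.Fin.Properties as Finₚ
  open import Data.Integer as ℤ using (ℤ; +_)
  import Data.Integer.Properties as ℤₚ
  open import Data.List using (List; []; _∷_; _++_; map; upTo; concatMap; cartesianProduct; deduplicate)
  open import Data.List.Membership.Propositional using (_∈_)
  open import Data.List.Membership.Propositional.Properties
  open import Data.List.Relation.Unary.All as All using (All; []; _∷_)
  import Data.List.Relation.Unary.All.Properties as Allₚ
  open import Data.List.Relation.Unary.AllPairs using (AllPairs; []; _∷_)
  import Data.List.Relation.Unary.AllPairs.Properties as AllPairsₚ
  open import Data.List.Relation.Unary.Any as Any using (here; there)
  open import Data.List.Relation.Unary.Unique.Propositional using (Unique)
  import Data.List.Relation.Unary.Unique.Propositional.Properties as Uniqueₚ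
  import Data.List.Relation.Unary.Unique.DecPropositional.Properties as UniqueDec
  open import Data.Maybe using (Maybe; just; nothing)
  open import Data.Nat as ℕ using (ℕ; zero; suc; _+_; _≤_; _<_; z≤n; s≤s)
  open import Data.Nat.DivMod using (_mod_; m<n⇒m%n≡m)
  import Data.Nat.Properties as ℕₚ
  open import Data.Product using (∃-syntax; _×_; _,_; proj₁; proj₂)
  open import Data.Product.Properties using (≡-dec)
  open import Data.Sum using (_⊎_; inj₁; inj₂)
  open import Data.Vec using ([]; _∷_)
  import Data.Vec.Properties as Vecₚ
  open import Function using (_∘_)
  open import Relation.Binary.Definitions using (DecidableEquality)
  open import Relation.Binary.PropositionalEquality hiding ([_])
  open import Relation.Nullary using (¬_; yes; no; contradiction)
  open import Relation.Nullary.Decidable using (map′)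

  data Dir : Set where
    left right : Dir

  flip : Dir → Dir
  flip left  = right
  flip right = left

  data Move : Set where
    go turn accept : Move

  Action : Set → Set
  Action State = Maybe (ℕ × State × Move)

  -- A sweeper moves back and forth over a word, rewriting each letter it
  -- passes; letter 1 marks both ends of the initial word, letter 2 is the
  -- input letter, and letter 0 is blank.
  record Sweeper : Set₁ where
    field
      State         : Set
      label         : State → List ℕ
      unlabel       : List ℕ → State
      unlabel-label : ∀ s → unlabel (label s) ≡ s
      states        : List State
      top           : ℕ
      2≤top         : 2 ≤ top
      δ             : Dir → State → ℕ → Action State
      start         : State
      start∈        : start ∈ states
      closed        : ∀ {d s a b s′ m} → s ∈ states → a ≤ top → δ d s a ≡ just (b , s′ , m) →
                      s′ ∈ states × b ≤ top

  module Graph (M : Sweeper) where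
    open Sweeper M public

    -- The letters are 0, …, top. Rows have height H; the block of column i and
    -- row r reads a letter in row r and writes one in row r + 1.
    A H : ℕ
    A = suc top
    H = suc A

    -- A chain starts at st, writes row 0 (ws and ze the end marks, wl the last
    -- input letter, zr and zl the blanks), runs through blocks (en enters one, rd
    -- reads, wr writes), and after acceptance descends along dn back to st.
    data FTy : Set where
      st ws wl zr zl ze dn : FTy
      en wr : Dir → State → ℕ → FTy
      rd    : Dir → State → ℕ → ℕ → FTy

    dirCode : Dir → ℕ
    dirCode left  = 0
    dirCode right = 1

    dirDecode : ℕ → Dir
    dirDecode zero    = left
    dirDecode (suc _) = right

    -- The numbering must not refer to the size of the alphabet, which depends on `N`, which in turn
    -- is computed from these numbers.
    fields : FTy → List ℕ
    fields st           = 0 ∷ []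
    fields ws            = 1 ∷ []
    fields wl            = 2 ∷ []
    fields zr           = 3 ∷ []
    fields zl           = 4 ∷ []
    fields ze           = 5 ∷ []
    fields dn           = 6 ∷ []
    fields (en d s a)   = 7 ∷ dirCode d ∷ a ∷ label s
    fields (wr d s a)   = 8 ∷ dirCode d ∷ a ∷ label s
    fields (rd d s a p) = 9 ∷ dirCode d ∷ a ∷ p ∷ label s

    parse : List ℕ → FTy
    parse (1 ∷ [])                 = ws
    parse (2 ∷ [])                 = wl
    parse (3 ∷ [])                 = zr
    parse (4 ∷ [])                 = zl
    parse (5 ∷ [])                 = ze
    parse (6 ∷ [])                 = dn
    parse (7 ∷ d ∷ a ∷ l)          = en (dirDecode d) (unlabel l) a
    parse (8 ∷ d ∷ a ∷ l)          = wr (dirDecode d) (unlabel l) a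
    parse (9 ∷ d ∷ a ∷ p ∷ l)      = rd (dirDecode d) (unlabel l) a p
    parse _                        = st

    dirDecode-dirCode : ∀ d → dirDecode (dirCode d) ≡ d
    dirDecode-dirCode left  = refl
    dirDecode-dirCode right = refl

    parse-fields : ∀ t → parse (fields t) ≡ t
    parse-fields st = refl
    parse-fields ws  = refl
    parse-fields wl  = refl
    parse-fields zr = refl
    parse-fields zl = refl
    parse-fields ze = refl
    parse-fields dn = refl
    parse-fields (en d s a)   = cong₂ (λ d s → en d s a) (dirDecode-dirCode d) (unlabel-label s)
    parse-fields (wr d s a)   = cong₂ (λ d s → wr d s a) (dirDecode-dirCode d) (unlabel-label s)
    parse-fields (rd d s a p) = cong₂ (λ d s → rd d s a p) (dirDecode-dirCode d) (unlabel-label s)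

    code : FTy → ℕ
    code t = codeList (fields t)

    code-injective : ∀ {s t} → code s ≡ code t → s ≡ t
    code-injective {s} {t} eq =
      trans (sym (parse-fields s)) (trans (cong parse (codeList-injective eq)) (parse-fields t))

    _≟-edge_ : DecidableEquality (FTy × FTy)
    _≟-edge_ = ≡-dec _≟_ _≟_
      where
      _≟_ : DecidableEquality FTy
      s ≟ t = map′ code-injective (cong code) (code s ℕ.≟ code t)

    opaque
      -- Differences of naturals in each coordinate: a move is then verified by two additive
      -- equations, free of subtraction.
      Δ : ℕ → ℕ → ℕ → ℕ → ℤ^ 2
      Δ m n m′ n′ = (m ℤ.⊖ n) ∷ (m′ ℤ.⊖ n′) ∷ []

    opaque
      β : ℕ → ℕ → ℕ
      β a p with p ℕ.≟ a
      ... | yes _ = 1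
      ... | no  _ = 0

      β-same : ∀ a → β a a ≡ 1
      β-same a with a ℕ.≟ a
      ... | yes _  = refl
      ... | no a≢a = contradiction refl a≢a

      β-other : ∀ {a p} → p ≢ a → β a p ≡ 0
      β-other {a} {p} p≢a with p ℕ.≟ a
      ... | yes p≡a = contradiction p≡a p≢a
      ... | no _    = refl

    written : Action State → ℕ
    written nothing            = 0
    written (just (b , _ , _)) = b

    -- From height (r + 1)H + b, subtracting H + b and adding A gives the entry height rH + A, in
    -- the next column. For a turn only b is subtracted: the same column is entered again, in row r
    -- + 1. Acceptance steps from x = 2 to x = 0. Without an action, any nonzero offset would do.
    exitOffset : Dir → Action State → ℤ^ 2
    exitOffset left  nothing                  = Δ 1 0 0 0
    exitOffset right nothing                  = Δ 1 0 0 0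
    exitOffset right (just (b , _ , go))      = Δ 3 0 A (H + b)
    exitOffset left  (just (b , _ , go))      = Δ 0 1 A (H + b)
    exitOffset left  (just (b , _ , turn))    = Δ 1 0 A b
    exitOffset right (just (b , _ , turn))    = Δ 1 0 A b
    exitOffset left  (just (b , _ , accept))  = Δ 0 2 0 0
    exitOffset right (just (b , _ , accept))  = Δ 0 2 0 0

    -- Positions (x , y), with column i at x = 2(i + 1) and x = 2(i + 1) + 1:
    --   en  (2(i + 1) + 1     , rH + A)
    --   rd  (2(i + 1) + β a p , rH + p), for p = top, …, 0
    --   wr  (2(i + 1)         , (r + 1)H + b).
    -- A reader of letter a thus visits the place of every letter other than a.
    off : FTy → ℤ^ 2
    -- Row 0 runs through the heights 1 (mark), 2 (input), 0 (blank) and 1 (mark). The last cell of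
    -- a stretch needs a symbol of its own, because its offset leads to another height.
    off st                 = Δ 2 0 1 0
    off ws                  = Δ 2 0 1 0
    off wl                  = Δ 2 0 0 2
    off zr                 = Δ 2 0 0 0
    off zl                 = Δ 2 0 1 0
    off ze                 = Δ 1 0 A 1
    off dn                 = Δ 0 0 0 1
    off (en d s a)         = Δ (β a top) 1 0 1
    off (rd d s a (suc p)) = Δ (β a p) (β a (suc p)) 0 1
    off (rd d s a zero)    = Δ 0 (β a 0) (H + written (δ d s a)) 0
    off (wr d s a)         = exitOffset d (δ d s a)

    e : ℤ^ 2
    e = + 1 ∷ + 0 ∷ []

    e≢𝟎 : e ≢ 𝟎
    e≢𝟎 ()

    img : FTy → FTy → ℤ^ 2
    img dn st = e
    img _  _  = 𝟎

    opaque
      unfolding Δ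

      off≢𝟎 : ∀ t → off t ≢ 𝟎
      off≢𝟎 st ()
      off≢𝟎 ws  ()
      off≢𝟎 wl  ()
      off≢𝟎 zr ()
      off≢𝟎 zl ()
      off≢𝟎 ze ()
      off≢𝟎 dn ()
      off≢𝟎 (en d s a)         eq with () ← Vecₚ.∷-injectiveˡ (Vecₚ.∷-injectiveʳ eq)
      off≢𝟎 (rd d s a (suc p)) eq with () ← Vecₚ.∷-injectiveˡ (Vecₚ.∷-injectiveʳ eq)
      off≢𝟎 (rd d s a zero)    eq with () ← Vecₚ.∷-injectiveˡ (Vecₚ.∷-injectiveʳ eq)
      off≢𝟎 (wr d s a)         eq = exit d (δ d s a) eq
        where
        exit : ∀ d o → exitOffset d o ≢ 𝟎
        exit left  nothing                 ()
        exit right nothing                 ()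
        exit right (just (b , _ , go))     ()
        exit left  (just (b , _ , go))     ()
        exit left  (just (b , _ , turn))   ()
        exit right (just (b , _ , turn))   ()
        exit right (just (b , _ , accept)) ()
        exit left  (just (b , _ , accept)) ()

    -- The letter `a` of the entered block is free: this is where a chain guesses the letter it is
    -- about to read.
    data Next : Dir → Action State → FTy → Set where
      go     : ∀ {d b s a} → Next d (just (b , s , go)) (en d s a)
      turn   : ∀ {d b s a} → Next d (just (b , s , turn)) (en (flip d) s a)
      accept : ∀ {b s} → Next right (just (b , s , accept)) dn

    data FEdge : FTy → FTy → Set where
      st-ws  : FEdge st ws
      wl-zr  : FEdge wl zr
      zr-zr : FEdge zr zr
      zr-zl : FEdge zr zl
      zl-ze : FEdge zl ze
      ze-en : ∀ {a} → FEdge ze (en left start a)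
      dn-dn : FEdge dn dn
      dn-st : FEdge dn st
      en-rd : ∀ {d s a} → FEdge (en d s a) (rd d s a top)
      rd-rd : ∀ {d s a p} → FEdge (rd d s a (suc p)) (rd d s a p)
      rd-wr : ∀ {d s a} → FEdge (rd d s a 0) (wr d s a)
      wr-nx : ∀ {d s a o t} → δ d s a ≡ o → Next d o t → FEdge (wr d s a) t

    letters : List ℕ
    letters = upTo A

    nexts : Dir → Action State → List FTy
    nexts d     nothing                 = []
    nexts d     (just (_ , s , go))     = map (en d s) letters
    nexts d     (just (_ , s , turn))   = map (en (flip d) s) letters
    nexts right (just (_ , _ , accept)) = dn ∷ []
    nexts left  (just (_ , _ , accept)) = []

    blocks : List (Dir × State × ℕ)
    blocks = cartesianProduct (left ∷ right ∷ []) (cartesianProduct states letters)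

    blockEdges : Dir × State × ℕ → List (FTy × FTy)
    blockEdges (d , s , a) =
      (en d s a , rd d s a top) ∷ (rd d s a 0 , wr d s a) ∷
      map (λ p → rd d s a (suc p) , rd d s a p) (upTo top) ++
      map (wr d s a ,_) (nexts d (δ d s a))

    basicEdges : List (FTy × FTy)
    basicEdges = (st , ws) ∷ (wl , zr) ∷ (zr , zr) ∷ (zr , zl) ∷ (zl , ze) ∷ (dn , dn) ∷ (dn , st) ∷ []

    candidates : List (FTy × FTy)
    candidates =
      basicEdges ++ map (λ a → ze , en left start a) letters ++ concatMap blockEdges blocks

    opaque
      -- `states` may list a state more than once, whereas determinism excludes repeated rules.
      fixedEdges : List (FTy × FTy)
      fixedEdges = deduplicate _≟-edge_ candidates

      fixedEdges⁻ : ∀ {c} → c ∈ fixedEdges → c ∈ candidates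
      fixedEdges⁻ = ∈-deduplicate⁻ _≟-edge_ candidates

      fixedEdges⁺ : ∀ {c} → c ∈ candidates → c ∈ fixedEdges
      fixedEdges⁺ = ∈-deduplicate⁺ _≟-edge_ {candidates}

      fixedEdges-unique : Unique fixedEdges
      fixedEdges-unique = UniqueDec.deduplicate-! _≟-edge_ candidates

    private
      EdgeOf : FTy × FTy → Set
      EdgeOf (s , t) = FEdge s t

      nexts-next : ∀ d o → All (Next d o) (nexts d o)
      nexts-next d     nothing                 = []
      nexts-next d     (just (_ , s , go))     = Allₚ.map⁺ (All.universal (λ _ → go) letters)
      nexts-next d     (just (_ , s , turn))   = Allₚ.map⁺ (All.universal (λ _ → turn) letters)
      nexts-next right (just (_ , _ , accept)) = accept ∷ []
      nexts-next left  (just (_ , _ , accept)) = []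

      blockEdges-edges : ∀ b → All EdgeOf (blockEdges b)
      blockEdges-edges (d , s , a) = en-rd ∷ rd-wr ∷
        Allₚ.++⁺ (Allₚ.map⁺ (All.universal (λ _ → rd-rd) (upTo top)))
                 (Allₚ.map⁺ (All.map (wr-nx refl) (nexts-next d (δ d s a))))

      candidates-edges : All EdgeOf candidates
      candidates-edges =
        Allₚ.++⁺ (st-ws ∷ wl-zr ∷ zr-zr ∷ zr-zl ∷ zl-ze ∷ dn-dn ∷ dn-st ∷ [])
          (Allₚ.++⁺ (Allₚ.map⁺ (All.universal (λ _ → ze-en) letters))
            (Allₚ.concat⁺ (Allₚ.map⁺ (All.universal blockEdges-edges blocks))))

    fixedEdge⁻ : ∀ {s t} → (s , t) ∈ fixedEdges → FEdge s t
    fixedEdge⁻ st∈ = All.lookup candidates-edges (fixedEdges⁻ st∈)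

    basic∈ : ∀ {s t} → (s , t) ∈ basicEdges → (s , t) ∈ fixedEdges
    basic∈ st∈ = fixedEdges⁺ (∈-++⁺ˡ st∈)

    ze-en∈ : ∀ {a} → a ≤ top → (ze , en left start a) ∈ fixedEdges
    ze-en∈ a≤ = fixedEdges⁺ (∈-++⁺ʳ basicEdges (∈-++⁺ˡ (∈-map⁺ _ (∈-upTo⁺ (s≤s a≤)))))

    block∈ : ∀ {d s a x} → s ∈ states → a ≤ top → x ∈ blockEdges (d , s , a) → x ∈ fixedEdges
    block∈ {d} {s} {a} s∈ a≤ x∈ = fixedEdges⁺
      (∈-++⁺ʳ basicEdges (∈-++⁺ʳ (map (λ a → ze , en left start a) letters)
        (∈-concatMap⁺ blockEdges (Any.map (λ { refl → x∈ }) block∈blocks))))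
      where
      dir∈ : ∀ d → d ∈ left ∷ right ∷ []
      dir∈ left  = here refl
      dir∈ right = there (here refl)

      block∈blocks : (d , s , a) ∈ blocks
      block∈blocks = ∈-cartesianProduct⁺ (dir∈ d) (∈-cartesianProduct⁺ s∈ (∈-upTo⁺ (s≤s a≤)))

    rd-rd∈ : ∀ {d s a p} → s ∈ states → a ≤ top → p < top → (rd d s a (suc p) , rd d s a p) ∈ fixedEdges
    rd-rd∈ s∈ a≤ p< = block∈ s∈ a≤ (there (there (∈-++⁺ˡ (∈-map⁺ _ (∈-upTo⁺ p<)))))

    wr-nx∈ : ∀ {d s a t} → s ∈ states → a ≤ top → t ∈ nexts d (δ d s a) → (wr d s a , t) ∈ fixedEdges
    wr-nx∈ {d} {s} {a} s∈ a≤ t∈ = block∈ s∈ a≤ (there (there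
      (∈-++⁺ʳ (map (λ p → rd d s a (suc p) , rd d s a p) (upTo top)) (∈-map⁺ _ t∈))))

    edgeCode : FTy × FTy → ℕ
    edgeCode (s , t) = codeList (code s ∷ code t ∷ codeℤ^ (off s) ∷ codeℤ^ (img s t) ∷ [])

    opaque
      -- Only fixed symbols occur in these rules, and their numbers are independent of `N`, so the
      -- definition is not circular.
      N : ℕ
      N = codeList (map edgeCode fixedEdges)

      N-def : N ≡ codeList (map edgeCode fixedEdges)
      N-def = refl

    fixed-code< : ∀ {s t} → (s , t) ∈ fixedEdges → code s < N × code t < N
    fixed-code< {s} {t} st∈ = below (here refl) , below (there (here refl))
      where
      below : ∀ {n} → n ∈ code s ∷ code t ∷ codeℤ^ (off s) ∷ codeℤ^ (img s t) ∷ [] → n < N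
      below n∈ = subst (_ <_) (sym N-def)
        (ℕₚ.<-trans (∈⇒<codeList n∈) (∈⇒<codeList (∈-map⁺ edgeCode st∈)))

    -- ix 1, …, ix N and wl write N + 1 input letters; ix 0 is never used by a chain.
    data Ty : Set where
      fix : FTy → Ty
      ix  : ℕ → Ty

    chain : ℕ → List (Ty × Ty)
    chain zero    = []
    chain (suc i) = (ix i , ix (suc i)) ∷ chain i

    edges : List (Ty × Ty)
    edges = (fix ws , ix 1) ∷ (ix N , fix wl) ∷
            chain N ++ map (λ (s , t) → fix s , fix t) fixedEdges

    -- The numbers below `N` serve the fixed symbols, and N, ..., 2N serve `ix 0`, ..., `ix N`.
    k : ℕ
    k = suc (N + N)

    tyCode : Ty → ℕ
    tyCode (fix t) = code t
    tyCode (ix i)   = N + i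

    opaque
      -- The reduction modulo `k` merely makes this total; it does not change the number of a
      -- `Valid` symbol.
      ty : Ty → Fin k
      ty t = tyCode t mod k

    data Valid : Ty → Set where
      valid-fix : ∀ {t} → code t < N → Valid (fix t)
      valid-ix  : ∀ {i} → i ≤ N → Valid (ix i)

    opaque
      unfolding ty

      toℕ-ty : ∀ {t} → Valid t → toℕ (ty t) ≡ tyCode t
      toℕ-ty {t} valid = trans (Finₚ.toℕ-fromℕ< _) (m<n⇒m%n≡m (bound t valid))
        where
        bound : ∀ t → Valid t → tyCode t < k
        bound (fix t) (valid-fix lt) = ℕₚ.≤-trans lt (ℕₚ.≤-trans (ℕₚ.m≤m+n N N) (ℕₚ.n≤1+n _))
        bound (ix i)   (valid-ix le) = s≤s (ℕₚ.+-monoʳ-≤ N le)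

    ty-injective : ∀ {s t} → Valid s → Valid t → ty s ≡ ty t → s ≡ t
    ty-injective {s} {t} vs vt eq =
      codes s t vs vt (trans (sym (toℕ-ty {s} vs)) (trans (cong toℕ eq) (toℕ-ty {t} vt)))
      where
      codes : ∀ s t → Valid s → Valid t → tyCode s ≡ tyCode t → s ≡ t
      codes (fix s) (fix t) _  _  eq = cong fix (code-injective eq)
      codes (fix s) (ix i)   (valid-fix lt) _  eq = contradiction (ℕₚ.≤-trans (s≤s (ℕₚ.m≤m+n N i)) (ℕₚ.≤-trans (s≤s (ℕₚ.≤-reflexive (sym eq))) lt)) (ℕₚ.<-irrefl refl)
      codes (ix i)   (fix t) _  (valid-fix lt) eq = contradiction (ℕₚ.≤-trans (s≤s (ℕₚ.m≤m+n N i)) (ℕₚ.≤-trans (s≤s (ℕₚ.≤-reflexive eq)) lt)) (ℕₚ.<-irrefl refl)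
      codes (ix i)   (ix j)   _  _  eq = cong ix (ℕₚ.+-cancelˡ-≡ N i j eq)

    offT : Ty → ℤ^ 2
    offT (fix t) = off t
    offT (ix _)   = Δ 2 0 0 0

    opaque
      unfolding Δ

      offT≢𝟎 : ∀ t → offT t ≢ 𝟎
      offT≢𝟎 (fix t) = off≢𝟎 t
      offT≢𝟎 (ix _)   ()

    imgT : Ty → Ty → ℤ^ 2
    imgT (fix s) (fix t) = img s t
    imgT _       _       = 𝟎

    data Edge : Ty → Ty → Set where
      entry : Edge (fix ws) (ix 1)
      leave : ∀ {i} → i ≡ N → Edge (ix i) (fix wl)
      link  : ∀ {i} → i < N → Edge (ix i) (ix (suc i))
      fixed : ∀ {s t} → FEdge s t → Edge (fix s) (fix t)

    chain⁻ : ∀ n {s t} → (s , t) ∈ chain n → ∃[ i ] i < n × s ≡ ix i × t ≡ ix (suc i)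
    chain⁻ (suc n) (here refl) = n , ℕₚ.≤-refl , refl , refl
    chain⁻ (suc n) (there st∈) with i , i<n , eqs ← chain⁻ n st∈ = i , ℕₚ.m≤n⇒m≤1+n i<n , eqs

    chain⁺ : ∀ {n i} → i < n → (ix i , ix (suc i)) ∈ chain n
    chain⁺ {suc n} {i} (s≤s i≤n) with ℕₚ.m≤n⇒m<n∨m≡n i≤n
    ... | inj₁ i<n  = there (chain⁺ i<n)
    ... | inj₂ refl = here refl

    private
      both : FTy × FTy → Ty × Ty
      both (s , t) = fix s , fix t

    edge⁻ : ∀ {s t} → (s , t) ∈ edges → Edge s t
    edge⁻ (here refl)         = entry
    edge⁻ (there (here refl)) = leave refl
    edge⁻ (there (there st∈)) with ∈-++⁻ (chain N) st∈
    ... | inj₁ st∈₁ with _ , i<N , refl , refl ← chain⁻ N st∈₁ = link i<N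
    ... | inj₂ st∈₂ with _ , st∈₃ , refl ← ∈-map⁻ both st∈₂ = fixed (fixedEdge⁻ st∈₃)

    fixed∈ : ∀ {s t} → (s , t) ∈ fixedEdges → (fix s , fix t) ∈ edges
    fixed∈ st∈ = there (there (∈-++⁺ʳ (chain N) (∈-map⁺ both st∈)))

    1≤N : 1 ≤ N
    1≤N = ℕₚ.≤-trans (s≤s z≤n) (proj₁ (fixed-code< (basic∈ (here refl))))

    valid-edge : ∀ {s t} → (s , t) ∈ edges → Valid s × Valid t
    valid-edge (here refl)         = valid-fix (proj₂ (fixed-code< (basic∈ (here refl)))) , valid-ix 1≤N
    valid-edge (there (here refl)) = valid-ix ℕₚ.≤-refl , valid-fix (proj₁ (fixed-code< (basic∈ (there (here refl)))))
    valid-edge (there (there st∈)) with ∈-++⁻ (chain N) st∈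
    ... | inj₁ st∈₁ with _ , i<N , refl , refl ← chain⁻ N st∈₁ = valid-ix (ℕₚ.<⇒≤ i<N) , valid-ix i<N
    ... | inj₂ st∈₂ with _ , st∈₃ , refl ← ∈-map⁻ both st∈₂ =
      valid-fix (proj₁ (fixed-code< st∈₃)) , valid-fix (proj₂ (fixed-code< st∈₃))

    valid-start : Valid (fix st)
    valid-start = valid-fix (proj₁ (fixed-code< (basic∈ (here refl))))

    edges-unique : Unique edges
    edges-unique = All.tabulate head₁ ∷ All.tabulate head₂ ∷
      AllPairsₚ.++⁺ (chain-unique N)
        (Uniqueₚ.map⁺ (λ { refl → refl }) fixedEdges-unique)
        (All.tabulate λ c∈ → All.tabulate (chain≢fixed c∈))
      where
      chain≢fixed : ∀ {c f} → c ∈ chain N → f ∈ map both fixedEdges → c ≢ f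
      chain≢fixed c∈ f∈ refl with _ , _ , refl ← ∈-map⁻ both f∈ with () ← chain⁻ N c∈

      chain-unique : ∀ n → Unique (chain n)
      chain-unique zero    = []
      chain-unique (suc n) = All.tabulate fresh ∷ chain-unique n
        where
        fresh : ∀ {c} → c ∈ chain n → (ix n , ix (suc n)) ≢ c
        fresh c∈ refl with _ , n<n , refl , _ ← chain⁻ n c∈ = ℕₚ.<-irrefl refl n<n

      head₂ : ∀ {c} → c ∈ chain N ++ map both fixedEdges → (ix N , fix wl) ≢ c
      head₂ c∈ refl with ∈-++⁻ (chain N) c∈
      ... | inj₁ c∈₁ with () ← chain⁻ N c∈₁
      ... | inj₂ c∈₂ with () ← ∈-map⁻ both c∈₂

      head₁ : ∀ {c} → c ∈ (ix N , fix wl) ∷ chain N ++ map both fixedEdges → (fix ws , ix 1) ≢ c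
      head₁ (there c∈) refl with ∈-++⁻ (chain N) c∈
      ... | inj₁ c∈₁ with () ← chain⁻ N c∈₁
      ... | inj₂ c∈₂ with () ← ∈-map⁻ both c∈₂

    -- This rules out reversed clashes between different rules: an edge has an opposite edge only if
    -- it is the loop at `zr` or at `dn`.
    antisymmetric : ∀ {s t} → Edge s t → Edge t s → s ≡ t
    antisymmetric (fixed zr-zr) (fixed zr-zr) = refl
    antisymmetric (fixed dn-dn) (fixed dn-dn) = refl
    antisymmetric (link _) ()
    antisymmetric (fixed rd-wr)        (fixed (wr-nx _ ()))
    antisymmetric (fixed (wr-nx _ ())) (fixed rd-wr)

    mkRule : Ty × Ty → Rule 2 k
    mkRule (s , t) = record
      { source = ty s ; target = ty t ; offset = offT s ; image = imgT s t ; offset≢𝟎 = offT≢𝟎 s }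

    emptyPattern : Pattern 2 k
    emptyPattern = record { cells = [] ; distinct = [] }

    no-clash : ∀ {c c′} → c ∈ edges → c′ ∈ edges → c ≢ c′ → ¬ Clash (mkRule c) (mkRule c′)
    no-clash {s , t} {s′ , t′} c∈ c′∈ c≢c′ clash
      with vs , vt ← valid-edge c∈ | vs′ , vt′ ← valid-edge c′∈ = refute clash
      where
      refute : ¬ Clash (mkRule (s , t)) (mkRule (s′ , t′))
      refute (inj₁ eq)
        with refl ← ty-injective {s′} {s} vs′ vs (cong proj₁ eq)
           | refl ← ty-injective {t′} {t} vt′ vt (cong (proj₁ ∘ proj₂) eq) = c≢c′ refl
      refute (inj₂ eq)
        with refl ← ty-injective {s′} {t} vs′ vt (cong proj₁ eq)
           | refl ← ty-injective {t′} {s} vt′ vs (cong (proj₁ ∘ proj₂) eq)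
        with refl ← antisymmetric (edge⁻ c∈) (edge⁻ c′∈) = c≢c′ refl

    no-clashes : ∀ {cs} → (∀ {c} → c ∈ cs → c ∈ edges) → Unique cs →
                 AllPairs (λ c c′ → ¬ Clash (mkRule c) (mkRule c′)) cs
    no-clashes ⊆ []       = []
    no-clashes ⊆ (p ∷ ps) =
      All.tabulate (λ c′∈ → no-clash (⊆ (here refl)) (⊆ (there c′∈)) (All.lookup p c′∈))
      ∷ no-clashes (⊆ ∘ there) ps

    opaque
      σ : Substitution 2 k
      σ = record
        { base          = λ _ → emptyPattern
        ; rules         = map mkRule edges
        ; deterministic = AllPairsₚ.map⁺ (no-clashes (λ c∈ → c∈) edges-unique)
        }

      rules-σ : rules σ ≡ map mkRule edges
      rules-σ = refl

      base-σ : ∀ t → base σ t ≡ emptyPattern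
      base-σ t = refl

    rule⁺ : ∀ {c} → c ∈ edges → mkRule c ∈ rules σ
    rule⁺ c∈ = subst (mkRule _ ∈_) (sym rules-σ) (∈-map⁺ mkRule c∈)

    rule⁻ : ∀ {r} → r ∈ rules σ → ∃[ c ] c ∈ edges × r ≡ mkRule c
    rule⁻ r∈ = ∈-map⁻ mkRule {xs = edges} (subst (_ ∈_) rules-σ r∈)

    -- Cells at given positions, and the consistency criterion for `σ`

    pos : ℕ → ℕ → ℤ^ 2
    pos x y = + x ∷ + y ∷ []

    at : ℤ^ 2 → ℕ → ℕ → ℤ^ 2
    at w x y = w ⊕ pos x y

    cell : ℤ^ 2 → ℕ → ℕ → Ty → Cell 2 k
    cell w x y t = [ at w x y , ty t ]

    at-injective : ∀ w {x y x′ y′} → at w x y ≡ at w x′ y′ → x ≡ x′ × y ≡ y′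
    at-injective w eq with refl ← ⊕-cancelˡ w eq = refl , refl

    opaque
      unfolding Δ

      at-move : ∀ w {x y m n m′ n′ x′ y′} → x + m ≡ x′ + n → y + m′ ≡ y′ + n′ →
                at w x y ⊕ Δ m n m′ n′ ≡ at w x′ y′
      at-move w {x} {y} {m} {n} {m′} {n′} eqx eqy = trans (⊕-assoc w (pos x y) (Δ m n m′ n′))
        (cong (w ⊕_) (cong₂ (λ i j → i ∷ j ∷ []) (+-⊖ {x} {m} eqx) (+-⊖ {y} {m′} eqy)))
        where
        ⊕-assoc : ∀ {d} (u v w : ℤ^ d) → (u ⊕ v) ⊕ w ≡ u ⊕ (v ⊕ w)
        ⊕-assoc []      []      []      = refl
        ⊕-assoc (i ∷ u) (j ∷ v) (l ∷ w) = cong₂ _∷_ (ℤₚ.+-assoc i j l) (⊕-assoc u v w)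

        +-⊖ : ∀ {x m x′ n} → x + m ≡ x′ + n → + x ℤ.+ (m ℤ.⊖ n) ≡ + x′
        +-⊖ {x} {m} {x′} {n} eq = trans (ℤₚ.distribʳ-⊖-+-pos x m n) (trans (cong (ℤ._⊖ n) eq)
          (trans (ℤₚ.⊖-≥ (ℕₚ.m≤n+m n x′)) (cong +_ (ℕₚ.m+n∸n≡m x′ n))))

    edge-image : ∀ {s t} → Edge s t → (s ≡ fix dn × t ≡ fix st) ⊎ imgT s t ≡ 𝟎
    edge-image entry                 = inj₂ refl
    edge-image (leave _)             = inj₂ refl
    edge-image (link _)              = inj₂ refl
    edge-image (fixed st-ws)         = inj₂ refl
    edge-image (fixed wl-zr)         = inj₂ refl
    edge-image (fixed zr-zr)         = inj₂ refl
    edge-image (fixed zr-zl)         = inj₂ refl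
    edge-image (fixed zl-ze)         = inj₂ refl
    edge-image (fixed ze-en)         = inj₂ refl
    edge-image (fixed dn-dn)         = inj₂ refl
    edge-image (fixed dn-st)         = inj₁ (refl , refl)
    edge-image (fixed en-rd)         = inj₂ refl
    edge-image (fixed rd-rd)         = inj₂ refl
    edge-image (fixed rd-wr)         = inj₂ refl
    edge-image (fixed (wr-nx _ _))   = inj₂ refl

    -- The only exceptional rule ends in `st`, so `no-return` concerns chains from `st`; taking its
    -- vector for `w` puts that cell at position (0 , 0).
    consistent-if : (∀ {P w n} → ¬ Reaches σ e P n (cell w 0 0 (fix st))) → Consistent σ
    consistent-if unreachable = consistent σ e functional binary no-return e≢𝟎
      where
      functional : ∀ {r r′} → r ∈ rules σ → r′ ∈ rules σ → source r ≡ source r′ → offset r ≡ offset r′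
      functional r∈ r′∈ eq with (s , t) , c∈ , refl ← rule⁻ r∈
                              | (s′ , t′) , c′∈ , refl ← rule⁻ r′∈ =
        cong offT (ty-injective {s} {s′} (proj₁ (valid-edge c∈)) (proj₁ (valid-edge c′∈)) eq)

      binary : ∀ {r} → r ∈ rules σ → image r ≡ 𝟎 ⊎ image r ≡ e
      binary r∈ with (s , t) , c∈ , refl ← rule⁻ r∈ with edge-image (edge⁻ c∈)
      ... | inj₁ (refl , refl) = inj₂ refl
      ... | inj₂ eq            = inj₁ eq

      no-return : ∀ {P r c c′ n} → r ∈ rules σ → image r ≡ e → Fwd r c c′ →
                  c′ ∈ cells P → ¬ Reaches σ e P n c′
      no-return {c′ = [ u , _ ]} r∈ ie (_ , refl , _) _ reach
        with (s , t) , c∈ , refl ← rule⁻ r∈ with edge-image (edge⁻ c∈)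
      ... | inj₁ (refl , refl) = unreachable {w = u}
        (subst (λ v → Reaches σ e _ _ [ v , ty (fix st) ]) (sym (⊕-identityʳ u)) reach)
      ... | inj₂ eq            = e≢𝟎 (trans (sym ie) eq)

    reaches-next : ∀ {P w n x y s a b a′ b′ x′ y′} → Valid s → s ≢ fix dn → offT s ≡ Δ a b a′ b′ →
                   x + a ≡ x′ + b → y + a′ ≡ y′ + b′ →
                   Reaches σ e P (suc n) (cell w x y s) →
                   ∃[ t ] (s , t) ∈ edges × cell w x′ y′ t ∈ cells P × Reaches σ e P n (cell w x′ y′ t)
    reaches-next {P} {w} {s = s} vs s≢dn o eqx eqy (step {c′ = [ u , _ ]} r∈ _ (ty≡ , refl , refl) c′∈ reach)
      with (s′ , t) , c∈ , refl ← rule⁻ r∈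
      with refl ← ty-injective {s} {s′} vs (proj₁ (valid-edge c∈)) ty≡
      with eq ← trans (cong (at w _ _ ⊕_) o) (at-move w eqx eqy) =
      t , c∈ , subst (λ v → [ v , ty t ] ∈ cells P) eq c′∈ ,
      subst (λ v → Reaches σ e _ _ [ v , ty t ]) eq reach

    not-arrived : ∀ {P c s} → Valid s → s ≢ fix dn → type c ≡ ty s → ¬ Reaches σ e P zero c
    not-arrived {s = s} vs s≢dn ty≡ (arrive r∈ ie (ty≡′ , _) _)
      with (s′ , t) , c∈ , refl ← rule⁻ r∈
      with refl ← ty-injective {s} {s′} vs (proj₁ (valid-edge c∈)) (trans (sym ty≡) ty≡′)
      with edge-image (edge⁻ c∈)
    ... | inj₁ (refl , _) = s≢dn refl
    ... | inj₂ eq         = e≢𝟎 (trans (sym ie) eq)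

-- Runs of the machine as chains of cells in the plane

module Geometry where

  open import Defs
  open Consistency
  open Walker
  open import Data.List using (List; []; _∷_; _++_; map; last; length; replicate)
  open import Data.List.Membership.Propositional using (_∈_)
  open import Data.List.Relation.Unary.All as All using (All; []; _∷_)
  import Data.List.Relation.Unary.All.Properties as Allₚ
  open import Data.List.Relation.Unary.AllPairs using ([]; _∷_)
  open import Data.List.Relation.Unary.Any using (here; there)
  open import Data.List.Relation.Unary.Linked using (Linked; [-]; _∷_)
  open import Data.List.Relation.Unary.Unique.Propositional using (Unique)
  open import Data.List.Membership.Propositional.Properties using (∈-map⁺; ∈-upTo⁺; ∈-++⁺ˡ)
  open import Data.Maybe using (Maybe; just; nothing)
  open import Data.Maybe.Properties using (just-injective)
  open import Data.Nat
  open import Data.Nat.Properties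
  open import Data.Product using (∃-syntax; _×_; _,_; proj₁; proj₂)
  open import Data.Sum using (_⊎_; inj₁; inj₂)
  open import Data.Unit using (⊤; tt)
  open import Data.Vec using ([]; _∷_)
  open import Relation.Binary.Construct.Closure.ReflexiveTransitive using (Star; ε; _◅_)
  open import Relation.Binary.PropositionalEquality hiding ([_])
  open import Relation.Nullary using (¬_; yes; no; contradiction)

  +-swapʳ : ∀ m n o → m + n + o ≡ m + o + n
  +-swapʳ m n o = trans (+-assoc m n o) (trans (cong (m +_) (+-comm n o)) (sym (+-assoc m o n)))

  module Run (M : Sweeper) where
    open Graph M public

    -- A configuration lists the letters already rewritten in the current pass
    -- (nearest first), the current letter, and the letters ahead.
    record Conf : Set where
      constructor ⟨_,_,_,_,_⟩
      field
        dir     : Dir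
        state   : State
        behind  : List ℕ
        current : ℕ
        ahead   : List ℕ
    open Conf public

    infix 4 _⟶_ _⟶*_

    data _⟶_ : Conf → Conf → Set where
      go   : ∀ {d s bh a a′ ah b s′} → δ d s a ≡ just (b , s′ , go) →
             ⟨ d , s , bh , a , a′ ∷ ah ⟩ ⟶ ⟨ d , s′ , b ∷ bh , a′ , ah ⟩
      turn : ∀ {d s bh a b s′} → δ d s a ≡ just (b , s′ , turn) →
             ⟨ d , s , bh , a , [] ⟩ ⟶ ⟨ flip d , s′ , [] , b , bh ⟩

    _⟶*_ : Conf → Conf → Set
    _⟶*_ = Star _⟶_

    Stuck : Conf → Set
    Stuck c = δ (dir c) (state c) (current c) ≡ nothing

    data Accepting : Conf → Set where
      accepting : ∀ {s a ah b s′} → δ right s a ≡ just (b , s′ , accept) →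
                  Accepting ⟨ right , s , [] , a , ah ⟩

    inputRow : List ℕ
    inputRow = replicate (suc N) 2 ++ 1 ∷ []

    initial : ℕ → Conf
    initial q = ⟨ left , start , [] , 1 , replicate (suc (suc q)) 0 ++ inputRow ⟩

    -- The row and the letter last written in each column.
    Frontier : Set
    Frontier = ℕ → Maybe (ℕ × ℕ)

    opaque
      update : Frontier → ℕ → ℕ × ℕ → Frontier
      update F i v j with j ≟ i
      ... | yes _ = just v
      ... | no  _ = F j

      update-same : ∀ F i v → update F i v i ≡ just v
      update-same F i v with i ≟ i
      ... | yes _  = refl
      ... | no i≢i = contradiction refl i≢i

      update-other : ∀ F {i v j} → j ≢ i → update F i v j ≡ F j
      update-other F {i} {v} {j} j≢i with j ≟ i
      ... | yes j≡i = contradiction j≡i j≢i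
      ... | no _    = refl

      update-cases : ∀ F {i v j w} → update F i v j ≡ just w → (j ≡ i × v ≡ w) ⊎ F j ≡ just w
      update-cases F {i} {v} {j} eq with j ≟ i
      ... | yes j≡i = inj₁ (j≡i , just-injective eq)
      ... | no  _   = inj₂ eq

    Leftward : Frontier → ℕ → List ℕ → Set
    Leftward F r []       = ⊤
    Leftward F r (a ∷ as) = F (length as) ≡ just (r , a) × Leftward F r as

    Rightward : Frontier → ℕ → ℕ → List ℕ → Set
    Rightward F r i []       = ⊤
    Rightward F r i (a ∷ as) = F i ≡ just (r , a) × Rightward F r (suc i) as

    -- The lists of a configuration are nearest first, but columns count from the left; so the
    -- column of the head is the length of whichever list lies to its left.
    Represents : Frontier → ℕ → ℕ → Conf → Set
    Represents F i r ⟨ right , _ , bh , a , ah ⟩ =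
      i ≡ length bh × Leftward F (suc r) bh × Rightward F r (length bh) (a ∷ ah)
    Represents F i r ⟨ left  , _ , bh , a , ah ⟩ =
      i ≡ length ah × Rightward F (suc r) (suc (length ah)) bh × Leftward F r (a ∷ ah)

    leftward-update : ∀ {F r i v} as → length as ≤ i → Leftward F r as → Leftward (update F i v) r as
    leftward-update []       _  _        = tt
    leftward-update {F} (a ∷ as) le (eq , l) =
      trans (update-other F (<⇒≢ le)) eq , leftward-update as (<⇒≤ le) l

    rightward-update : ∀ {F r i v j} as → i < j → Rightward F r j as → Rightward (update F i v) r j as
    rightward-update []       _  _        = tt
    rightward-update {F} (a ∷ as) lt (eq , l) =
      trans (update-other F (λ j≡i → <⇒≢ lt (sym j≡i))) eq , rightward-update as (m<n⇒m<1+n lt) l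

    represents-current : ∀ {F i r} c → Represents F i r c → F i ≡ just (r , current c)
    represents-current ⟨ right , _ , _ , _ , _ ⟩ (refl , _ , eq , _) = eq
    represents-current ⟨ left  , _ , _ , _ , _ ⟩ (refl , _ , eq , _) = eq

    represents-right : ∀ {F i r s bh a a′ ah b s′} →
      Represents F i r ⟨ right , s , bh , a , a′ ∷ ah ⟩ →
      Represents (update F i (suc r , b)) (suc i) r ⟨ right , s′ , b ∷ bh , a′ , ah ⟩
    represents-right {F} {bh = bh} {a′ = a′} {ah} (refl , l , _ , rw) =
      refl , (update-same F _ _ , leftward-update bh ≤-refl l) , rightward-update (a′ ∷ ah) ≤-refl rw

    represents-left : ∀ {F i r s bh a a′ ah b s′} →
      Represents F i r ⟨ left , s , bh , a , a′ ∷ ah ⟩ →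
      i ≡ suc (length ah) ×
      Represents (update F i (suc r , b)) (length ah) r ⟨ left , s′ , b ∷ bh , a′ , ah ⟩
    represents-left {F} {bh = bh} {a′ = a′} {ah} (refl , rw , _ , l) =
      refl , refl , (update-same F _ _ , rightward-update bh ≤-refl rw)
           , leftward-update (a′ ∷ ah) ≤-refl l

    represents-turn : ∀ {F i r d s bh a b s′} →
      Represents F i r ⟨ d , s , bh , a , [] ⟩ →
      Represents (update F i (suc r , b)) i (suc r) ⟨ flip d , s′ , [] , b , bh ⟩
    represents-turn {F} {d = right} {bh = bh} (refl , l , _ , _) =
      refl , tt , update-same F _ _ , leftward-update bh ≤-refl l
    represents-turn {F} {d = left} {bh = bh} (refl , rw , _ , _) =
      refl , tt , update-same F _ _ , rightward-update bh ≤-refl rw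

    -- The head of the list is the rightmost letter: row 0 is written from left to right and first
    -- read from right to left.
    row : List ℕ → Frontier
    row []       = λ _ → nothing
    row (a ∷ as) = update (row as) (length as) (0 , a)

    row-leftward : ∀ as → Leftward (row as) 0 as
    row-leftward []       = tt
    row-leftward (a ∷ as) = update-same (row as) _ _ , leftward-update as ≤-refl (row-leftward as)

    row-beyond : ∀ as {j} → length as ≤ j → row as j ≡ nothing
    row-beyond []       _  = refl
    row-beyond (a ∷ as) le = trans (update-other (row as) (λ j≡ → <⇒≢ le (sym j≡))) (row-beyond as (<⇒≤ le))

    row-represents : ∀ q → Represents (row (1 ∷ replicate (suc (suc q)) 0 ++ inputRow))
                       (length (replicate (suc (suc q)) 0 ++ inputRow)) 0 (initial q)
    row-represents q = refl , tt , row-leftward (1 ∷ replicate (suc (suc q)) 0 ++ inputRow)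

    -- Coordinates of successive cells

    opaque
      -- Column 0 starts at x = 2, which leaves x = 0 to the descent after acceptance.
      X : ℕ → ℕ
      X i = suc i * 2

      Y : ℕ → ℕ → ℕ
      Y r p = r * H + p

      en-x : ∀ i b → suc (X i) + b ≡ X i + b + 1
      en-x i b = sym (+-comm (X i + b) 1)

      down-x : ∀ i b c → X i + b + c ≡ X i + c + b
      down-x i b c = +-swapʳ (X i) b c

      down-y : ∀ r p → Y r (suc p) + 0 ≡ Y r p + 1
      down-y r p = trans (+-identityʳ _)
        (trans (cong (λ n → r * H + n) (sym (+-comm p 1))) (sym (+-assoc (r * H) p 1)))

      wr-y : ∀ r b → Y r 0 + (H + b) ≡ Y (suc r) b + 0
      wr-y r b = trans (cong (_+ (H + b)) (+-identityʳ (r * H)))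
        (trans (sym (+-assoc (r * H) H b)) (trans (cong (_+ b) (+-comm (r * H) H)) (sym (+-identityʳ _))))

      right-x : ∀ i → X i + 3 ≡ suc (X (suc i)) + 0
      right-x i = trans (+-comm (X i) 3) (sym (+-identityʳ _))

      left-x : ∀ i → X (suc i) + 0 ≡ suc (X i) + 1
      left-x i = trans (+-identityʳ _) (+-comm 1 (suc (X i)))

      go-y : ∀ r b → Y (suc r) b + A ≡ Y r A + (H + b)
      go-y r b = trans (+-swapʳ (suc r * H) b A) (trans (cong (λ n → n + A + b) (+-comm H (r * H)))
        (trans (cong (_+ b) (+-swapʳ (r * H) H A)) (+-assoc (r * H + A) H b)))

      turn-x : ∀ i → X i + 1 ≡ suc (X i) + 0
      turn-x i = trans (+-comm (X i) 1) (sym (+-identityʳ _))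

      turn-y : ∀ r b → Y r b + A ≡ Y r A + b
      turn-y r b = +-swapʳ (r * H) b A

      row-x : ∀ i → X i + 2 ≡ X (suc i) + 0
      row-x i = trans (+-comm (X i) 2) (sym (+-identityʳ _))

      X-zero : X 0 ≡ 2
      X-zero = refl

      Y-zero : ∀ p → Y 0 p ≡ p
      Y-zero p = refl

      Y-suc : ∀ r p → ∃[ n ] Y (suc r) p ≡ suc n
      Y-suc r p = _ , refl

      X≢0 : ∀ i → X i ≢ 0
      X≢0 i ()

      X-injective : ∀ i j → X i ≡ X j → i ≡ j
      X-injective i j eq = suc-injective (*-cancelʳ-≡ (suc i) (suc j) 2 eq)

      X≢1+X : ∀ i j → X i ≢ suc (X j)
      X≢1+X i j eq = even≢odd (suc i) (suc j)
        (trans (*-comm 2 (suc i)) (trans eq (cong suc (*-comm (suc j) 2))))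

      Y-mono-≤ : ∀ r {p q} → p ≤ q → Y r p ≤ Y r q
      Y-mono-≤ r p≤q = +-monoʳ-≤ (r * H) p≤q

      Y-mono-< : ∀ r {p q} → p < q → Y r p < Y r q
      Y-mono-< r p<q = +-monoʳ-< (r * H) p<q

      Y<Y-suc : ∀ r {p} → p ≤ A → Y r p < Y (suc r) 0
      Y<Y-suc r p≤A = ≤-trans (+-monoʳ-< (r * H) (s≤s p≤A))
        (≤-reflexive (trans (+-comm (r * H) H) (sym (+-identityʳ _))))

      Y-injective : ∀ r {p q} → Y r p ≡ Y r q → p ≡ q
      Y-injective r eq = +-cancelˡ-≡ (r * H) _ _ eq

    -- Every chain in a pattern follows the run

    module _ (P : Pattern 2 k) (w : ℤ^ 2) where

      ReachesAt : ℕ → ℕ → ℕ → Ty → Set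
      ReachesAt n x y t = Reaches σ e P n (cell w x y t)

      InP : ℕ → ℕ → Ty → Set
      InP x y t = cell w x y t ∈ cells P

      -- The symbol fixes the place of the next cell, and only `dn` can take the exceptional step;
      -- all that stays open is the next symbol.
      advance : ∀ {n x y s a b a′ b′ x′ y′} → Valid s → s ≢ fix dn → offT s ≡ Δ a b a′ b′ →
                x + a ≡ x′ + b → y + a′ ≡ y′ + b′ → ReachesAt n x y s →
                ∃[ m ] n ≡ suc m × ∃[ t ] Edge s t × Valid t × InP x′ y′ t × ReachesAt m x′ y′ t
      advance {zero}  {s = s} vs s≢dn o eqx eqy reach = contradiction reach (not-arrived {s = s} vs s≢dn refl)
      advance {suc n} {s = s} vs s≢dn o eqx eqy reach
        with t , st∈ , c∈ , reach′ ← reaches-next {s = s} vs s≢dn o eqx eqy reach =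
        n , refl , t , edge⁻ st∈ , proj₂ (valid-edge st∈) , c∈ , reach′

      -- The occupant may be a writer or a symbol of row 0. It is enough that it is not a reader, so
      -- that a reader arriving at its place contradicts it.
      Written : ℕ → ℕ → ℕ → Set
      Written i r a = ∃[ t ] Valid t × (∀ {d s a p} → t ≢ fix (rd d s a p)) × InP (X i) (Y r a) t

      Holds : Frontier → Set
      Holds F = ∀ {i r a} → F i ≡ just (r , a) → a ≤ top × Written i r a

      holds-update : ∀ {F i r a} → Holds F → a ≤ top → Written i r a → Holds (update F i (r , a))
      holds-update {F} holds a≤ written {j} eq with update-cases F {j = j} eq
      ... | inj₁ (refl , refl) = a≤ , written
      ... | inj₂ eq′           = holds eq′

      -- At height `a₀`, a reader of another letter stands on the even track, exactly where the
      -- letter is written, and one place cannot hold two symbols.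
      no-misread : ∀ {i r a₀ d s a} → Written i r a₀ → Valid (fix (rd d s a a₀)) →
                   InP (X i + β a a₀) (Y r a₀) (fix (rd d s a a₀)) → a ≡ a₀
      no-misread {i} {r} {a₀} {d} {s} {a} (t , vt , not-rd , t∈) vrd rd∈ with a₀ ≟ a
      ... | yes a₀≡a = sym a₀≡a
      ... | no  a₀≢a = contradiction
        (ty-injective {t} {fix (rd d s a a₀)} vt vrd (cong type (distinct-vectors P t∈ rd∈
          (cong (λ x → at w x (Y r a₀)) (trans (sym (+-identityʳ (X i)))
            (cong (X i +_) (sym (β-other a₀≢a)))))))) not-rd

      WritesAt : ℕ → ℕ → Dir → State → ℕ → Set
      WritesAt i r d s a = ∃[ n ] let t = fix (wr d s a); y = Y (suc r) (written (δ d s a)) in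
        ReachesAt n (X i) y t × InP (X i) y t × Valid t

      -- The reader descends through every height from `p` to 0; the guess is tested at the single
      -- height `a₀`.
      read-down : ∀ {n i r a₀ d s a} → Written i r a₀ → ∀ p → Valid (fix (rd d s a p)) →
                  InP (X i + β a p) (Y r p) (fix (rd d s a p)) →
                  ReachesAt n (X i + β a p) (Y r p) (fix (rd d s a p)) →
                  (a₀ ≤ p → a ≡ a₀) × WritesAt i r d s a
      read-down {i = i} {r} {a₀} {d} {s} {a} writ zero vrd rd∈ reach
        with advance {s = fix (rd d s a zero)} vrd (λ ()) refl
               (+-identityʳ (X i + β a 0)) (wr-y r (written (δ d s a))) reach
      ... | m , _ , _ , fixed rd-wr , vt , c∈ , reach′ =
        (λ { z≤n → no-misread writ vrd rd∈ }) , m , reach′ , c∈ , vt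
      read-down {i = i} {r} {a₀} {d} {s} {a} writ (suc p) vrd rd∈ reach
        with advance {s = fix (rd d s a (suc p))} vrd (λ ()) refl
               (down-x i (β a (suc p)) (β a p)) (down-y r p) reach
      ... | m , _ , _ , fixed rd-rd , vt , c∈ , reach′
        with read , writes ← read-down writ p vt c∈ reach′ = read′ , writes
        where
        read′ : a₀ ≤ suc p → a ≡ a₀
        read′ a₀≤ with m≤n⇒m<n∨m≡n a₀≤
        ... | inj₁ (s≤s a₀≤p) = read a₀≤p
        ... | inj₂ refl       = no-misread writ vrd rd∈

      block : ∀ {n i r a₀ d s a} → a₀ ≤ top → Written i r a₀ → Valid (fix (en d s a)) →
              ReachesAt n (suc (X i)) (Y r A) (fix (en d s a)) → a ≡ a₀ × WritesAt i r d s a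
      block {i = i} {r} {a₀} {d} {s} {a} a₀≤ writ ven reach
        with advance {s = fix (en d s a)} ven (λ ()) refl (en-x i (β a top)) (down-y r top) reach
      ... | m , _ , _ , fixed en-rd , vt , c∈ , reach′
        with read , writes ← read-down writ top vt c∈ reach′ = read a₀≤ , writes

      some-edge : ∀ {n x y s} → Valid s → s ≢ fix dn → ReachesAt n x y s → ∃[ t ] Edge s t
      some-edge {zero}  {s = s} vs s≢dn reach = contradiction reach (not-arrived {s = s} vs s≢dn refl)
      some-edge {suc n} {s = s} vs s≢dn (step r∈ _ (ty≡ , _ , _) _ _)
        with (s′ , t) , c∈ , refl ← rule⁻ r∈
        with refl ← ty-injective {s} {s′} vs (proj₁ (valid-edge c∈)) ty≡ = t , edge⁻ c∈

      next-unique : ∀ {d s a o t} → δ d s a ≡ o → Edge (fix (wr d s a)) t → ∃[ u ] t ≡ fix u × Next d o u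
      next-unique refl (fixed (wr-nx refl nx)) = _ , refl , nx

      -- The guess `a` is arbitrary, and `block` forces it to be the current letter. The action then
      -- fixes everything about the next block but its guess, so the chain follows the run until a
      -- writer has no outgoing edge.
      stuck-unreachable : ∀ {c c′ F i r n a} → c ⟶* c′ → Stuck c′ → state c ∈ states →
        Represents F i r c → Holds F → Valid (fix (en (dir c) (state c) a)) →
        ¬ ReachesAt n (suc (X i)) (Y r A) (fix (en (dir c) (state c) a))
      stuck-unreachable {c} {r = r} run stuck s∈ rep holds ven reach
        with holds (represents-current c rep)
      ... | a₀≤ , writ with block {r = r} a₀≤ writ ven reach
      stuck-unreachable ε stuck s∈ rep holds ven reach | a₀≤ , writ | refl , m , reach′ , wr∈ , vwr
        with t , edge ← some-edge vwr (λ ()) reach′ with () ← proj₂ (proj₂ (next-unique stuck edge))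
      stuck-unreachable {⟨ right , s , bh , a , _ ⟩} {F = F} {i} {r} (go {b = b} eq ◅ run) stuck s∈ rep holds ven reach
        | a₀≤ , writ | refl , m , reach′ , wr∈ , vwr rewrite eq
        with advance {s = fix (wr right s a)} {x′ = suc (X (suc i))} vwr (λ ()) (cong (exitOffset right) eq)
               (right-x i) (go-y r b) reach′
      ... | _ , _ , _ , edge , vt , _ , reach″ with next-unique eq edge
      ... | _ , refl , go = stuck-unreachable run stuck (proj₁ (closed s∈ a₀≤ eq)) (represents-right {s = s} {bh = bh} {b = b} {s} rep)
        (holds-update holds (proj₂ (closed s∈ a₀≤ eq)) (_ , vwr , (λ ()) , wr∈)) vt reach″
      stuck-unreachable {⟨ left , s , bh , a , _ ∷ ah ⟩} {F = F} {i} {r} (go {b = b} eq ◅ run) stuck s∈ rep holds ven reach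
        | a₀≤ , writ | refl , m , reach′ , wr∈ , vwr rewrite eq
        with refl , rep′ ← represents-left {s = s} {bh = bh} {b = b} {s} rep
        with advance {s = fix (wr left s a)} {x′ = suc (X (length ah))} vwr (λ ()) (cong (exitOffset left) eq)
               (left-x (length ah)) (go-y r b) reach′
      ... | _ , _ , _ , edge , vt , _ , reach″ with next-unique eq edge
      ... | _ , refl , go = stuck-unreachable run stuck (proj₁ (closed s∈ a₀≤ eq)) rep′
        (holds-update holds (proj₂ (closed s∈ a₀≤ eq)) (_ , vwr , (λ ()) , wr∈)) vt reach″
      stuck-unreachable {⟨ d , s , bh , a , _ ⟩} {F = F} {i} {r} (turn {b = b} eq ◅ run) stuck s∈ rep holds ven reach
        | a₀≤ , writ | refl , m , reach′ , wr∈ , vwr rewrite eq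
        with advance {s = fix (wr d s a)} {x′ = suc (X i)} vwr (λ ()) (trans (cong (exitOffset d) eq) (exit-turn d))
               (turn-x i) (turn-y (suc r) b) reach′
        where
        exit-turn : ∀ d {b s} → exitOffset d (just (b , s , turn)) ≡ Δ 1 0 A b
        exit-turn left  = refl
        exit-turn right = refl
      ... | _ , _ , _ , edge , vt , _ , reach″ with next-unique eq edge
      ... | _ , refl , turn = stuck-unreachable run stuck (proj₁ (closed s∈ a₀≤ eq)) (represents-turn {d = d} {bh = bh} {b = b} rep)
        (holds-update holds (proj₂ (closed s∈ a₀≤ eq)) (_ , vwr , (λ ()) , wr∈)) vt reach″

      holds-row : ∀ {as a t} → Holds (row as) → a ≤ top → Valid t → (∀ {d s a p} → t ≢ fix (rd d s a p)) →
                  InP (X (length as)) (Y 0 a) t → Holds (row (a ∷ as))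
      holds-row holds a≤ vt not-rd t∈ = holds-update holds a≤ (_ , vt , not-rd , t∈)

      record Along (n : ℕ) (as : List ℕ) (a : ℕ) (t : Ty) : Set where
        constructor placed
        field
          reaches : ReachesAt n (X (length as)) (Y 0 a) t
          valid   : Valid t
          holds   : Holds (row (a ∷ as))

      along : ∀ {n as a b t m m′} → (∀ {d s a p u} → Edge t u → u ≢ fix (rd d s a p)) → b ≤ top →
              t ≢ fix dn → offT t ≡ Δ 2 0 m m′ → a + m ≡ b + m′ →
              Along n as a t → ∃[ n′ ] n ≡ suc n′ × ∃[ u ] Edge t u × Along n′ (a ∷ as) b u
      along {as = as} {a} {b} {t} {m} {m′} not-rd b≤ t≢dn o eqy (placed reach vt holds)
        with advance {s = t} vt t≢dn o (row-x (length as))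
               (trans (cong (_+ m) (Y-zero a)) (trans eqy (cong (_+ m′) (sym (Y-zero b))))) reach
      ... | n′ , refl , u , edge , vu , u∈ , reach′ =
        n′ , refl , u , edge , placed reach′ vu (holds-row {a ∷ as} holds b≤ vu (not-rd edge) u∈)

      module _ (blocked : ∀ q → ∃[ c ] initial q ⟶* c × Stuck c) where

        private
          zeros : ℕ → List ℕ
          zeros q = replicate q 0 ++ inputRow

        from-ze : ∀ {n} q → ¬ Along n (zeros (suc (suc q))) 1 (fix ze)
        from-ze q (placed reach vt holds)
          with advance {s = fix ze} {x′ = suc (X (length (zeros (suc (suc q)))))} {y′ = Y 0 A}
                 vt (λ ()) refl (turn-x _) (turn-y 0 1) reach
        ... | _ , _ , _ , fixed ze-en , vu , _ , reach′
          with c , run , stuck ← blocked q =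
          stuck-unreachable run stuck start∈ (row-represents q) holds vu reach′

        -- The chain chooses the number of blanks, and `blocked` covers every choice; since its
        -- length `n` is finite, it must stop writing blanks.
        from-zr : ∀ n q → ¬ Along n (zeros q) 0 (fix zr)
        from-zr n q al with along (λ { (fixed zr-zr) () ; (fixed zr-zl) () }) z≤n (λ ()) refl refl al
        ... | n′ , refl , _ , fixed zr-zr , al′ = from-zr n′ (suc q) al′
        ... | _ , refl , _ , fixed zr-zl , al′
          with along (λ { (fixed zl-ze) () }) (≤-trans (s≤s z≤n) 2≤top) (λ ()) refl refl al′
        ... | _ , _ , _ , fixed zl-ze , al″ = from-ze q al″

        from-ix : ∀ n i → ¬ Along n (replicate i 2 ++ 1 ∷ []) 2 (ix (suc i))
        from-ix n i al with along (λ { (leave _) () ; (link _) () }) 2≤top (λ ()) refl refl al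
        ... | n′ , refl , _ , link _ , al′ = from-ix n′ (suc i) al′
        ... | _ , refl , _ , leave i≡N , al′
          with along (λ { (fixed wl-zr) () }) z≤n (λ ()) refl refl al′
        ... | n″ , _ , _ , fixed wl-zr , al″ =
          from-zr n″ 0 (subst (λ m → Along n″ (replicate (suc m) 2 ++ 1 ∷ []) 0 (fix zr)) i≡N al″)

        start-unreachable : ∀ {n} → ¬ ReachesAt n 0 0 (fix st)
        start-unreachable reach
          with advance {s = fix st} valid-start (λ ()) refl
                 (sym (trans (+-identityʳ _) X-zero)) (sym (trans (+-identityʳ _) (Y-zero 1))) reach
        ... | _ , _ , _ , fixed st-ws , vws , ws∈ , reach′
          with along {as = []} (λ { entry () }) 2≤top (λ ()) refl refl
                 (placed reach′ vws (holds-row {[]} (λ ()) (≤-trans (s≤s z≤n) 2≤top) vws (λ ()) ws∈))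
        ... | n″ , _ , _ , entry , al = from-ix n″ 0 al

    blocked⇒consistent : (∀ q → ∃[ c ] initial q ⟶* c × Stuck c) → Consistent σ
    blocked⇒consistent blocked = consistent-if (λ {P} {w} → start-unreachable P w blocked)

    -- The closed chain of an accepting run

    data InColumn (i : ℕ) (x : ℕ) : Set where
      even : x ≡ X i → InColumn i x
      odd  : x ≡ suc (X i) → InColumn i x

    column-unique : ∀ {i j x} → InColumn i x → InColumn j x → i ≡ j
    column-unique {i} {j} (even eq) (even eq′) = X-injective i j (trans (sym eq) eq′)
    column-unique {i} {j} (even eq) (odd eq′)  = contradiction (trans (sym eq) eq′) (X≢1+X i j)
    column-unique {i} {j} (odd eq)  (even eq′) = contradiction (trans (sym eq′) eq) (X≢1+X j i)
    column-unique {i} {j} (odd eq)  (odd eq′)  = X-injective i j (suc-injective (trans (sym eq) eq′))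

    column≢0 : ∀ {i} → ¬ InColumn i 0
    column≢0 {i} (even eq) = X≢0 i (sym eq)
    column≢0     (odd ())

    -- A region containing all earlier cells between blocks: in each column both tracks below the
    -- frontier row, and the frontier letter itself. Distinctness of the chain then means that each
    -- new place lies outside a region, with no comparison of individual cells.
    data Swept (F : Frontier) (x y : ℕ) : Set where
      origin : x ≡ 0 → y ≡ 0 → Swept F x y
      below  : ∀ {i r a} → F i ≡ just (r , a) → InColumn i x → y < Y r 0 → Swept F x y
      front  : ∀ {i r a} → F i ≡ just (r , a) → x ≡ X i → y ≡ Y r a → Swept F x y

    InBlock : Frontier → ℕ → ℕ → ℕ → ℕ → ℕ → Set
    InBlock F i r p x y = Swept F x y ⊎ (InColumn i x × Y r p ≤ y × y < Y (suc r) 0)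

    same-entry : ∀ {F : Frontier} {i j r a r′ a′} → F i ≡ just (r , a) → F j ≡ just (r′ , a′) → j ≡ i →
                 (r ≡ r′) × (a ≡ a′)
    same-entry eq eq′ refl with refl ← trans (sym eq) eq′ = refl , refl

    β-column : ∀ i a p → InColumn i (X i + β a p)
    β-column i a p with p ≟ a
    ... | yes refl = odd (trans (cong (X i +_) (β-same a)) (+-comm (X i) 1))
    ... | no p≢a   = even (trans (cong (X i +_) (β-other p≢a)) (+-identityʳ (X i)))

    module _ {F : Frontier} {i r a : ℕ} (now : F i ≡ just (r , a)) where

      en-fresh : ¬ Swept F (suc (X i)) (Y r A)
      en-fresh (origin () _)
      en-fresh (below at-j col lt) with refl , _ ← same-entry {F} now at-j (column-unique col (odd refl)) =
        <⇒≱ lt (Y-mono-≤ r z≤n)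
      en-fresh (front {j} _ eq _) = X≢1+X j i (sym eq)

      -- A correct reader avoids the frontier letter: at its height the reader is on the odd track,
      -- and at all others the heights differ.
      rd-fresh : ∀ p → ¬ InBlock F i r (suc p) (X i + β a p) (Y r p)
      rd-fresh p (inj₁ (origin eq _)) = X≢0 i (m+n≡0⇒m≡0 (X i) eq)
      rd-fresh p (inj₁ (below at-j col lt))
        with refl , _ ← same-entry {F} now at-j (column-unique col (β-column i a p)) =
        <⇒≱ lt (Y-mono-≤ r z≤n)
      rd-fresh p (inj₁ (front {j} at-j eqx eqy))
        with refl , refl ← same-entry {F} now at-j (column-unique (even eqx) (β-column i a p))
        with refl ← Y-injective r eqy
        with refl ← column-unique (even eqx) (β-column i a p) =
        X≢1+X i i (trans (sym eqx) (trans (cong (X i +_) (β-same a)) (+-comm (X i) 1)))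
      rd-fresh p (inj₂ (_ , le , _)) = <⇒≱ (Y-mono-< r ≤-refl) le

      wr-fresh : a ≤ top → ∀ b → ¬ InBlock F i r 0 (X i) (Y (suc r) b)
      wr-fresh a≤ b (inj₁ (origin eq _)) = X≢0 i eq
      wr-fresh a≤ b (inj₁ (below at-j col lt))
        with refl , _ ← same-entry {F} now at-j (column-unique col (even refl)) =
        <⇒≱ (<-trans (Y<Y-suc r z≤n) (≤-<-trans (Y-mono-≤ (suc r) z≤n) lt)) ≤-refl
      wr-fresh a≤ b (inj₁ (front at-j eqx eqy))
        with refl , refl ← same-entry {F} now at-j (X-injective _ _ (sym eqx)) =
        <⇒≱ (Y<Y-suc r (m≤n⇒m≤1+n a≤)) (≤-trans (Y-mono-≤ (suc r) z≤n) (≤-reflexive eqy))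
      wr-fresh a≤ b (inj₂ (_ , _ , lt)) = <⇒≱ lt (Y-mono-≤ (suc r) z≤n)

      block-swept : a ≤ top → ∀ b {x y} → InBlock F i r 0 x y → Swept (update F i (suc r , b)) x y
      block-swept a≤ b (inj₁ (origin eqx eqy)) = origin eqx eqy
      block-swept a≤ b (inj₁ (below {j} at-j col lt)) with j ≟ i
      ... | no j≢i   = below (trans (update-other F j≢i) at-j) col lt
      ... | yes refl with refl , _ ← same-entry {F} now at-j refl =
        below (update-same F i _) col (<-trans lt (Y<Y-suc r z≤n))
      block-swept a≤ b (inj₁ (front {j} at-j eqx eqy)) with j ≟ i
      ... | no j≢i   = front (trans (update-other F j≢i) at-j) eqx eqy
      ... | yes refl with refl , refl ← same-entry {F} now at-j refl =
        below (update-same F i _) (even eqx) (≤-<-trans (≤-reflexive eqy) (Y<Y-suc r (m≤n⇒m≤1+n a≤)))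
      block-swept a≤ b (inj₂ (col , _ , lt)) = below (update-same F i _) col lt

    -- The region `Q` stands in for the whole history, so `extend` asks only that the new place be
    -- outside it.
    record Trail (Q : ℕ → ℕ → Set) (t : Ty) (x y : ℕ) : Set where
      field
        earlier : List (Cell 2 k)
        unique  : Unique (map vector (cell 𝟎 x y t ∷ earlier))
        linked  : Linked (ZeroStep σ) (cell 𝟎 x y t ∷ earlier)
        ends    : last (cell 𝟎 x y t ∷ earlier) ≡ just (cell 𝟎 0 0 (fix st))
        inside  : All (λ c → ∃[ x ] ∃[ y ] vector c ≡ at 𝟎 x y × Q x y) (cell 𝟎 x y t ∷ earlier)

    extend : ∀ {Q Q′ : ℕ → ℕ → Set} {s t x y a b a′ b′ x′ y′} → (s , t) ∈ edges → imgT s t ≡ 𝟎 →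
             offT s ≡ Δ a b a′ b′ → x + a ≡ x′ + b → y + a′ ≡ y′ + b′ →
             (∀ {x y} → Q x y → Q′ x y) → Q′ x′ y′ → ¬ Q x′ y′ → Trail Q s x y → Trail Q′ t x′ y′
    extend {Q} {s = s} {t} {x} {y} {x′ = x′} {y′} st∈ zero-image o eqx eqy mono q fresh trail = record
      { earlier = cell 𝟎 x y s ∷ earlier
      ; unique  = Allₚ.map⁺ (All.map (λ {c} → new c) inside) ∷ unique
      ; linked  = (mkRule (s , t) , rule⁺ st∈ , zero-image , refl , refl ,
                   sym (trans (cong (at 𝟎 x y ⊕_) o) (at-move 𝟎 eqx eqy))) ∷ linked
      ; ends    = ends
      ; inside  = (x′ , y′ , refl , q) ∷ All.map (λ (u , v , eq , q) → u , v , eq , mono q) inside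
      }
      where
      open Trail trail

      new : ∀ (c : Cell 2 k) → (∃[ u ] ∃[ v ] vector c ≡ at 𝟎 u v × Q u v) → at 𝟎 x′ y′ ≢ vector c
      new c (u , v , eq , q) eq′ with refl , refl ← at-injective 𝟎 (trans eq′ eq) = fresh q

    Bounded : Frontier → Set
    Bounded F = ∀ {i r a} → F i ≡ just (r , a) → a ≤ top

    bounded-update : ∀ {F i r a} → Bounded F → a ≤ top → Bounded (update F i (r , a))
    bounded-update {F} bounded a≤ {j} eq with update-cases F {j = j} eq
    ... | inj₁ (refl , refl) = a≤
    ... | inj₂ eq′           = bounded eq′

    enter : ∀ {F i r a d s t x y m n m′ n′} → F i ≡ just (r , a) → (t , fix (en d s a)) ∈ edges →
            imgT t (fix (en d s a)) ≡ 𝟎 → offT t ≡ Δ m n m′ n′ →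
            x + m ≡ suc (X i) + n → y + m′ ≡ Y r A + n′ →
            Trail (Swept F) t x y → Trail (InBlock F i r A) (fix (en d s a)) (suc (X i)) (Y r A)
    enter {r = r} now e∈ zero-image o eqx eqy = extend e∈ zero-image o eqx eqy inj₁
      (inj₂ (odd refl , ≤-refl , Y<Y-suc r ≤-refl)) (en-fresh now)

    module _ {F : Frontier} {i r a : ℕ} (now : F i ≡ just (r , a)) (a≤ : a ≤ top)
             {d : Dir} {s : State} (s∈ : s ∈ states) where

      private
        in-block : ∀ {p} → p ≤ top → InBlock F i r p (X i + β a p) (Y r p)
        in-block {p} p≤ = inj₂ (β-column i a p , ≤-refl , Y<Y-suc r (m≤n⇒m≤1+n p≤))

        mono : ∀ {p x y} → InBlock F i r (suc p) x y → InBlock F i r p x y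
        mono (inj₁ q)               = inj₁ q
        mono (inj₂ (col , le , lt)) = inj₂ (col , ≤-trans (Y-mono-≤ r (n≤1+n _)) le , lt)

        b : ℕ
        b = written (δ d s a)

      read-trail : ∀ p → p ≤ top →
        Trail (InBlock F i r p) (fix (rd d s a p)) (X i + β a p) (Y r p) →
        Trail (Swept (update F i (suc r , b))) (fix (wr d s a)) (X i) (Y (suc r) b)
      read-trail zero    p≤ = extend (fixed∈ (block∈ s∈ a≤ (there (here refl)))) refl refl
        (+-identityʳ (X i + β a 0)) (wr-y r b) (block-swept now a≤ b)
        (front (update-same F i _) refl refl) (wr-fresh now a≤ b)
      read-trail (suc p) p≤ trail = read-trail p (<⇒≤ p≤)
        (extend (fixed∈ (rd-rd∈ s∈ a≤ p≤)) refl refl (down-x i (β a (suc p)) (β a p)) (down-y r p)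
          mono (in-block (<⇒≤ p≤)) (rd-fresh now p) trail)

      block-trail : Trail (InBlock F i r A) (fix (en d s a)) (suc (X i)) (Y r A) →
                    Trail (Swept (update F i (suc r , b))) (fix (wr d s a)) (X i) (Y (suc r) b)
      block-trail trail = read-trail top ≤-refl
        (extend (fixed∈ (block∈ s∈ a≤ (here refl))) refl refl (en-x i (β a top)) (down-y r top)
          mono (in-block ≤-refl) (rd-fresh now top) trail)

    private
      dn-edge : (fix dn , fix st) ∈ edges
      dn-edge = fixed∈ (basic∈ (there (there (there (there (there (there (here refl))))))))

      Lane : (ℕ → ℕ → Set) → ℕ → ℕ → ℕ → Set
      Lane Q y₀ x y = Q x y ⊎ (x ≡ 0 × y₀ ≤ y)

    -- The descent along x = 0 stays `dn` until height 1, where the exceptional rule is the one that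
    -- leads to the origin.
    close : ∀ {Q} y → (∀ {y} → ¬ Q 0 (suc y)) → Trail (Lane Q (suc y)) (fix dn) 0 (suc y) → ¬ Consistent σ
    close zero free trail = inconsistent σ unique linked ends (rule⁺ dn-edge) e≢𝟎
      (refl , refl , sym (at-move 𝟎 {0} {1} {0} {0} {0} {1} {0} {0} refl refl))
      where open Trail trail
    close {Q} (suc y) free trail = close y free (extend
      (fixed∈ (basic∈ (there (there (there (there (there (here refl)))))))) refl refl refl (cong suc (sym (down y)))
      (λ { (inj₁ q) → inj₁ q ; (inj₂ (x≡0 , le)) → inj₂ (x≡0 , ≤-trans (n≤1+n _) le) })
      (inj₂ (refl , ≤-refl)) (λ { (inj₁ q) → free q ; (inj₂ (_ , le)) → <⇒≱ ≤-refl le }) trail)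
      where
      down : ∀ y → y + 1 ≡ suc y + 0
      down y = trans (+-comm y 1) (sym (+-identityʳ _))

    private
      letter : ∀ {a} → a ≤ top → a ∈ letters
      letter a≤ = ∈-upTo⁺ (s≤s a≤)

      en∈ : ∀ {d s a o t} → s ∈ states → a ≤ top → δ d s a ≡ o → t ∈ nexts d o →
            (fix (wr d s a) , fix t) ∈ edges
      en∈ s∈ a≤ refl t∈ = fixed∈ (wr-nx∈ s∈ a≤ t∈)

      written-as : ∀ {d s a o t F i r x} → δ d s a ≡ o →
        Trail (Swept (update F i (r , written (δ d s a)))) t x (Y r (written (δ d s a))) →
        Trail (Swept (update F i (r , written o))) t x (Y r (written o))
      written-as refl trail = trail

      exit-turn : ∀ d {b s} → exitOffset d (just (b , s , turn)) ≡ Δ 1 0 A b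
      exit-turn left  = refl
      exit-turn right = refl

    -- The counterpart of `stuck-unreachable`, with the guesses now chosen: each block is entered
    -- with the letter that the configuration really has.
    accepted⇒inconsistent : ∀ {c c′ F i r} → c ⟶* c′ → Accepting c′ → state c ∈ states →
      Represents F i r c → Bounded F →
      Trail (InBlock F i r A) (fix (en (dir c) (state c) (current c))) (suc (X i)) (Y r A) →
      ¬ Consistent σ
    accepted⇒inconsistent {F = F} {i} {r} ε (accepting {s} {a} {b = b} eq) s∈ rep@(refl , _) bounded trail
      -- The accepting letter is written in row r + 1, hence at a positive height, and the descent
      -- starts above the origin.
      with n , y≡ ← Y-suc r (written (δ right s a)) =
      close n free (subst (λ y → Trail (Lane (Swept F′) y) (fix dn) 0 y) y≡ lane)
      where
      now = represents-current ⟨ right , s , [] , a , _ ⟩ rep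
      F′ = update F 0 (suc r , written (δ right s a))

      free : ∀ {y} → ¬ Swept F′ 0 (suc y)
      free (origin _ ())
      free (below _ col _)        = column≢0 col
      free (front {i} _ eq _)     = X≢0 i (sym eq)

      lane : Trail (Lane (Swept F′) (Y (suc r) (written (δ right s a)))) (fix dn) 0 (Y (suc r) (written (δ right s a)))
      lane = extend (fixed∈ (wr-nx∈ s∈ (bounded now) (subst (λ o → dn ∈ nexts right o) (sym eq) (here refl))))
        refl (cong (exitOffset right) eq) (trans (+-identityʳ _) X-zero) refl inj₁ (inj₂ (refl , ≤-refl))
        (λ q → free (subst (Swept F′ 0) y≡ q)) (block-trail now (bounded now) s∈ trail)
    accepted⇒inconsistent {c = ⟨ right , s , bh , a , a′ ∷ ah ⟩} {F = F} {i} {r}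
                          (go {b = b} {s′} eq ◅ run) acc s∈ rep bounded trail =
      accepted⇒inconsistent run acc s′∈ rep′ bounded′
        (enter now′ (en∈ s∈ (bounded now) eq (∈-map⁺ (en right s′) (letter (bounded′ now′)))) refl
          (cong (exitOffset right) eq) (right-x i) (go-y r b)
          (written-as eq (block-trail now (bounded now) s∈ trail)))
      where
      now  = represents-current ⟨ right , s , bh , a , a′ ∷ ah ⟩ rep
      rep′ = represents-right {s = s} {bh = bh} {b = b} {s} rep
      now′ = represents-current ⟨ right , s′ , b ∷ bh , a′ , ah ⟩ rep′
      s′∈  = proj₁ (closed s∈ (bounded now) eq)

      bounded′ : Bounded (update F i (suc r , b))
      bounded′ = bounded-update bounded (proj₂ (closed s∈ (bounded now) eq))
    accepted⇒inconsistent {c = ⟨ left , s , bh , a , a′ ∷ ah ⟩} {F = F} {i} {r}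
                          (go {b = b} {s′} eq ◅ run) acc s∈ rep@(refl , _) bounded trail =
      accepted⇒inconsistent run acc s′∈ rep′ bounded′
        (enter now′ (en∈ s∈ (bounded now) eq (∈-map⁺ (en left s′) (letter (bounded′ now′)))) refl
          (cong (exitOffset left) eq) (left-x (length ah)) (go-y r b)
          (written-as eq (block-trail now (bounded now) s∈ trail)))
      where
      now  = represents-current ⟨ left , s , bh , a , a′ ∷ ah ⟩ rep
      rep′ = proj₂ (represents-left {s = s} {bh = bh} {b = b} {s} rep)
      now′ = represents-current ⟨ left , s′ , b ∷ bh , a′ , ah ⟩ rep′
      s′∈  = proj₁ (closed s∈ (bounded now) eq)

      bounded′ : Bounded (update F i (suc r , b))
      bounded′ = bounded-update bounded (proj₂ (closed s∈ (bounded now) eq))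
    accepted⇒inconsistent {c = ⟨ d , s , bh , a , [] ⟩} {F = F} {i} {r}
                          (turn {b = b} {s′} eq ◅ run) acc s∈ rep bounded trail =
      accepted⇒inconsistent run acc s′∈ rep′ bounded′
        (enter now′ (en∈ s∈ (bounded now) eq (∈-map⁺ (en (flip d) s′) (letter (bounded′ now′)))) refl
          (trans (cong (exitOffset d) eq) (exit-turn d)) (turn-x i) (turn-y (suc r) b)
          (written-as eq (block-trail now (bounded now) s∈ trail)))
      where
      now  = represents-current ⟨ d , s , bh , a , [] ⟩ rep
      rep′ = represents-turn {d = d} {s} {bh} {b = b} {s′} rep
      now′ = represents-current ⟨ flip d , s′ , [] , b , bh ⟩ rep′
      s′∈  = proj₁ (closed s∈ (bounded now) eq)

      bounded′ : Bounded (update F i (suc r , b))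
      bounded′ = bounded-update bounded (proj₂ (closed s∈ (bounded now) eq))

    row-trail : ∀ {as s t x y a b m m′} → (s , t) ∈ edges → imgT s t ≡ 𝟎 → offT s ≡ Δ b 0 m m′ →
                x + b ≡ X (length as) + 0 → y + m ≡ Y 0 a + m′ →
                Trail (Swept (row as)) s x y → Trail (Swept (row (a ∷ as))) t (X (length as)) (Y 0 a)
    row-trail {as} {a = a} st∈ zero-image o eqx eqy =
      extend st∈ zero-image o eqx eqy keep (front (update-same (row as) _ _) refl refl) fresh
      where
      empty : row as (length as) ≡ nothing
      empty = row-beyond as ≤-refl

      occupied : ∀ {i v} → row as i ≡ just v → i ≢ length as
      occupied eq refl with () ← trans (sym eq) empty

      keep : ∀ {x y} → Swept (row as) x y → Swept (row (a ∷ as)) x y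
      keep (origin eqx eqy)    = origin eqx eqy
      keep (below eq col lt)   = below (trans (update-other (row as) (occupied eq)) eq) col lt
      keep (front eq eqx eqy)  = front (trans (update-other (row as) (occupied eq)) eq) eqx eqy

      fresh : ¬ Swept (row as) (X (length as)) (Y 0 a)
      fresh (origin eq _)      = X≢0 (length as) eq
      fresh (below eq col _)   = occupied eq (column-unique col (even refl))
      fresh (front eq eqx _)   = occupied eq (X-injective _ _ (sym eqx))

    next-row-trail : ∀ {as s t a b m m′} → (s , t) ∈ edges → imgT s t ≡ 𝟎 → offT s ≡ Δ 2 0 m m′ →
      a + m ≡ b + m′ →
      Trail (Swept (row (a ∷ as))) s (X (length as)) (Y 0 a) →
      Trail (Swept (row (b ∷ a ∷ as))) t (X (length (a ∷ as))) (Y 0 b)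
    next-row-trail {as} {a = a} {b} {m} {m′} st∈ zero-image o eqy =
      row-trail {a ∷ as} st∈ zero-image o (row-x (length as))
        (trans (cong (_+ m) (Y-zero a)) (trans eqy (cong (_+ m′) (sym (Y-zero b)))))

    start-trail : Trail (Swept (row [])) (fix st) 0 0
    start-trail = record
      { earlier = [] ; unique = [] ∷ [] ; linked = [-] ; ends = refl
      ; inside = (0 , 0 , refl , origin refl refl) ∷ [] }

    ix-trail : ∀ i → i < N → Trail (Swept (row (replicate (suc i) 2 ++ 1 ∷ []))) (ix (suc i))
                               (X (length (replicate i 2 ++ 1 ∷ []))) (Y 0 2)
    ix-trail zero    _   = next-row-trail {[]} (here refl) refl refl refl
      (row-trail {[]} (fixed∈ (basic∈ (here refl))) refl refl
        (sym (trans (+-identityʳ _) X-zero)) (sym (trans (+-identityʳ _) (Y-zero 1))) start-trail)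
    ix-trail (suc i) i<N = next-row-trail {replicate i 2 ++ 1 ∷ []}
      (there (there (∈-++⁺ˡ (chain⁺ i<N)))) refl refl refl (ix-trail i (<⇒≤ i<N))

    zr-trail : ∀ q → Trail (Swept (row (replicate (suc q) 0 ++ inputRow))) (fix zr)
                       (X (length (replicate q 0 ++ inputRow))) (Y 0 0)
    zr-trail zero    = next-row-trail {replicate N 2 ++ 1 ∷ []}
      (fixed∈ (basic∈ (there (here refl)))) refl refl refl (wl-trail N refl 1≤N)
      where
      wl-trail : ∀ n → n ≡ N → 1 ≤ n → Trail (Swept (row (2 ∷ replicate n 2 ++ 1 ∷ []))) (fix wl)
                                         (X (length (replicate n 2 ++ 1 ∷ []))) (Y 0 2)
      wl-trail (suc n) n≡N _ = next-row-trail {replicate n 2 ++ 1 ∷ []}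
        (subst (λ m → (ix m , fix wl) ∈ edges) (sym n≡N) (there (here refl))) refl refl refl
        (ix-trail n (≤-reflexive n≡N))
    zr-trail (suc q) = next-row-trail {replicate q 0 ++ inputRow}
      (fixed∈ (basic∈ (there (there (here refl))))) refl refl refl (zr-trail q)

    ze-trail : ∀ q → Trail (Swept (row (1 ∷ replicate (suc (suc q)) 0 ++ inputRow))) (fix ze)
                       (X (length (replicate (suc (suc q)) 0 ++ inputRow))) (Y 0 1)
    ze-trail q = next-row-trail {replicate (suc q) 0 ++ inputRow}
      (fixed∈ (basic∈ (there (there (there (there (here refl))))))) refl refl refl
      (next-row-trail {replicate q 0 ++ inputRow}
        (fixed∈ (basic∈ (there (there (there (here refl)))))) refl refl refl (zr-trail q))

    bounded-row : ∀ {as} → All (_≤ top) as → Bounded (row as)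
    bounded-row []         ()
    bounded-row (a≤ ∷ as≤) = bounded-update (bounded-row as≤) a≤

    accepts⇒inconsistent : ∀ q {c} → initial q ⟶* c → Accepting c → ¬ Consistent σ
    accepts⇒inconsistent q run acc = accepted⇒inconsistent run acc start∈ rep
      (bounded-row (1≤top ∷ z≤n ∷ z≤n ∷ Allₚ.++⁺ (Allₚ.replicate⁺ q z≤n)
        (2≤top ∷ Allₚ.++⁺ (Allₚ.replicate⁺ N 2≤top) (1≤top ∷ []))))
      (enter (represents-current (initial q) rep) (fixed∈ (ze-en∈ 1≤top)) refl refl
        (turn-x _) (turn-y 0 1) (ze-trail q))
      where
      rep = row-represents q

      1≤top : 1 ≤ top
      1≤top = ≤-trans (s≤s z≤n) 2≤top

-- Counter machines on a sweeping machine

module Machine where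

  open Compilation using (Prog; inc; clr; loop; _⨾_; new; _⊢_⇒_; inc⇒; clr⇒; stop⇒; iter⇒; seq⇒; new⇒)
  open Walker using (Dir; left; right; flip; go; turn; accept; Action; Sweeper)
  open Geometry using (module Run)
  open import Data.Fin using (Fin; zero; suc)
  open import Data.List using (List; []; _∷_; _++_; map; concatMap; length; reverse; _ʳ++_)
  open import Data.List.Membership.Propositional using (_∈_)
  open import Data.List.Membership.Propositional.Properties
    using (∈-map⁺; ∈-map⁻; ∈-++⁺ˡ; ∈-++⁺ʳ; ∈-++⁻; ∈-concatMap⁺)
  open import Data.List.Properties using (++-assoc; ++-ʳ++; ʳ++-defn; length-++; reverse-++; unfold-reverse)
  open import Data.List.Relation.Unary.All as All using (All; []; _∷_)
  import Data.List.Relation.Unary.All.Properties as Allₚ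
  open import Data.List.Relation.Unary.Any as Any using (here; there)
  open import Data.Maybe as Maybe using (Maybe; just; nothing)
  open import Data.Nat
  open import Data.Nat.ListAction using (sum)
  open import Data.Nat.Properties
  open import Data.Product using (∃-syntax; _×_; _,_)
  open import Data.Sum using (inj₁; inj₂)
  open import Data.Unit using (⊤; tt)
  open import Data.Vec using (Vec; []; _∷_; lookup; _[_]≔_)
  open import Data.Vec.Properties using ([]≔-lookup; []≔-idempotent; lookup∘update; updateAt-cong-local)
  open import Relation.Binary.Construct.Closure.ReflexiveTransitive using (ε; _◅_; _◅◅_)
  open import Relation.Binary.PropositionalEquality hiding ([_])
  open import Relation.Nullary using (yes; no; contradiction)

  -- jzd j q₀ q₁ jumps to q₀ if register j is 0; otherwise it decrements it and
  -- jumps to q₁.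
  data Instr : Set where
    inc : ℕ → ℕ → Instr
    jzd : ℕ → ℕ → ℕ → Instr

  register : Instr → ℕ
  register (inc j _)   = j
  register (jzd j _ _) = j

  targets : Instr → List ℕ
  targets (inc _ q)     = q ∷ []
  targets (jzd _ q₀ q₁) = q₀ ∷ q₁ ∷ []

  fetch : List Instr → ℕ → Maybe Instr
  fetch []       _       = nothing
  fetch (i ∷ is) zero    = just i
  fetch (i ∷ is) (suc q) = fetch is q

  fetch-∈ : ∀ is q {i} → fetch is q ≡ just i → i ∈ is
  fetch-∈ (i ∷ is) zero    refl = here refl
  fetch-∈ (i ∷ is) (suc q) eq   = there (fetch-∈ is q eq)

  fetch-length : ∀ is → fetch is (length is) ≡ nothing
  fetch-length []       = refl
  fetch-length (i ∷ is) = fetch-length is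

  At : List Instr → ℕ → List Instr → Set
  At code b []       = ⊤
  At code b (i ∷ is) = fetch code b ≡ just i × At code (suc b) is

  at-++ : ∀ {code b} is {is′} → At code b (is ++ is′) → At code b is × At code (b + length is) is′
  at-++ {code} {b} []       {is′} at = tt , subst (λ n → At code n is′) (sym (+-identityʳ b)) at
  at-++ {code} {b} (i ∷ is) {is′} (here-i , at) with at₁ , at₂ ← at-++ is at =
    (here-i , at₁) , subst (λ n → At code n is′) (sym (+-suc b (length is))) at₂

  at-self : ∀ is is′ → At (is ++ is′) (length is) is′
  at-self is []        = tt
  at-self is (i ∷ is′) = fetch-++ is , subst₂ (λ c n → At c n is′) (++-assoc is (i ∷ []) is′)
    (trans (length-++ is) (+-comm (length is) 1)) (at-self (is ++ i ∷ []) is′)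
    where
    fetch-++ : ∀ is → fetch (is ++ i ∷ is′) (length is) ≡ just i
    fetch-++ []       = refl
    fetch-++ (_ ∷ is) = fetch-++ is

  infix 9 _[_↦_]

  _[_↦_] : (ℕ → ℕ) → ℕ → ℕ → ℕ → ℕ
  (R [ j ↦ v ]) i with i ≟ j
  ... | yes _ = v
  ... | no  _ = R i

  indicator : ℕ → ℕ → ℕ
  indicator a x with x ≟ a
  ... | yes _ = 1
  ... | no  _ = 0

  indicator-same : ∀ a → indicator a a ≡ 1
  indicator-same a with a ≟ a
  ... | yes _  = refl
  ... | no a≢a = contradiction refl a≢a

  indicator-other : ∀ {a x} → x ≢ a → indicator a x ≡ 0
  indicator-other {a} {x} x≢a with x ≟ a
  ... | yes x≡a = contradiction x≡a x≢a
  ... | no _    = refl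

  count : ℕ → List ℕ → ℕ
  count a []      = 0
  count a (x ∷ w) = indicator a x + count a w

  count-++ : ∀ a w w′ → count a (w ++ w′) ≡ count a w + count a w′
  count-++ a []      w′ = refl
  count-++ a (x ∷ w) w′ = trans (cong (indicator a x +_) (count-++ a w w′)) (sym (+-assoc (indicator a x) _ _))

  count-reverse : ∀ a w → count a (reverse w) ≡ count a w
  count-reverse a []      = refl
  count-reverse a (x ∷ w) = begin
    count a (reverse (x ∷ w))                ≡⟨ cong (count a) (reverse-++ (x ∷ []) w) ⟩
    count a (reverse w ++ x ∷ [])            ≡⟨ count-++ a (reverse w) (x ∷ []) ⟩
    count a (reverse w) + (indicator a x + 0) ≡⟨ cong₂ _+_ (count-reverse a w) (+-identityʳ _) ⟩
    count a w + indicator a x                ≡⟨ +-comm (count a w) _ ⟩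
    indicator a x + count a w                ∎
    where open ≡-Reasoning

  -- Stated with the replaced letters added on both sides, so that no subtraction occurs.
  count-replace : ∀ a l x y l′ →
    indicator a x + count a (reverse (l ++ y ∷ l′)) ≡ indicator a y + count a (l ++ x ∷ l′)
  count-replace a l x y l′ = begin
    indicator a x + count a (reverse (l ++ y ∷ l′))              ≡⟨ cong (indicator a x +_) (trans (count-reverse a (l ++ y ∷ l′)) (shift y)) ⟩
    indicator a x + (indicator a y + (count a l + count a l′))   ≡⟨ +-assoc (indicator a x) _ _ ⟨
    indicator a x + indicator a y + (count a l + count a l′)     ≡⟨ cong (_+ (count a l + count a l′)) (+-comm (indicator a x) _) ⟩
    indicator a y + indicator a x + (count a l + count a l′)     ≡⟨ +-assoc (indicator a y) _ _ ⟩
    indicator a y + (indicator a x + (count a l + count a l′))   ≡⟨ cong (indicator a y +_) (shift x) ⟨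
    indicator a y + count a (l ++ x ∷ l′)                        ∎
    where
    open ≡-Reasoning
    shift : ∀ z → count a (l ++ z ∷ l′) ≡ indicator a z + (count a l + count a l′)
    shift z = begin
      count a (l ++ z ∷ l′)                        ≡⟨ count-++ a l (z ∷ l′) ⟩
      count a l + (indicator a z + count a l′)     ≡⟨ +-assoc (count a l) _ _ ⟨
      count a l + indicator a z + count a l′       ≡⟨ cong (_+ count a l′) (+-comm (count a l) _) ⟩
      indicator a z + count a l + count a l′       ≡⟨ +-assoc (indicator a z) _ _ ⟩
      indicator a z + (count a l + count a l′)     ∎

  count-absent : ∀ {a w} → All (_≢ a) w → count a w ≡ 0
  count-absent []          = refl
  count-absent (x≢a ∷ all) = cong₂ _+_ (indicator-other x≢a) (count-absent all)

  count-present : ∀ a l l′ → count a (l ++ a ∷ l′) ≢ 0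
  count-present a []      l′ eq with () ← trans (sym (cong (_+ count a l′) (indicator-same a))) eq
  count-present a (x ∷ l) l′ eq = count-present a l l′ (m+n≡0⇒n≡0 (indicator a x) eq)

  data Occurrence (a : ℕ) : List ℕ → Set where
    first  : ∀ l l′ → All (_≢ a) l → Occurrence a (l ++ a ∷ l′)
    absent : ∀ {w} → All (_≢ a) w → Occurrence a w

  occurrence : ∀ a w → Occurrence a w
  occurrence a [] = absent []
  occurrence a (x ∷ w) with x ≟ a
  ... | yes refl = first [] w []
  ... | no x≢a with occurrence a w
  ... | first l l′ l≢a = first (x ∷ l) l′ (x≢a ∷ l≢a)
  ... | absent w≢a     = absent (x≢a ∷ w≢a)

  -- The value of register j of the simulated machine is the number of letters
  -- 2 + j; every instruction takes one pass over the word, which reverses it.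
  module _ (code : List Instr) (entry : ℕ) where

    data State : Set where
      begin finish : ℕ → State
      execute      : Instr → State

    label : State → List ℕ
    label (begin q)               = 0 ∷ q ∷ []
    label (finish q)              = 1 ∷ q ∷ []
    label (execute (inc j q))     = 2 ∷ j ∷ q ∷ []
    label (execute (jzd j q₀ q₁)) = 3 ∷ j ∷ q₀ ∷ q₁ ∷ []

    unlabel : List ℕ → State
    unlabel (1 ∷ q ∷ [])           = finish q
    unlabel (2 ∷ j ∷ q ∷ [])       = execute (inc j q)
    unlabel (3 ∷ j ∷ q₀ ∷ q₁ ∷ []) = execute (jzd j q₀ q₁)
    unlabel (_ ∷ q ∷ _)            = begin q
    unlabel _                      = begin 0

    unlabel-label : ∀ s → unlabel (label s) ≡ s
    unlabel-label (begin q)               = refl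
    unlabel-label (finish q)              = refl
    unlabel-label (execute (inc j q))     = refl
    unlabel-label (execute (jzd j q₀ q₁)) = refl

    -- Label 0 accepts; label q + 1 is the instruction of index q.
    δ : Dir → State → ℕ → Action State
    -- Acceptance must happen in column 0, next to the lane x = 0. A pass to the left starts at the
    -- right end, so it is completed first.
    δ d     (begin zero)    1 = home d
      where
      home : Dir → Action State
      home left  = just (1 , finish 0 , go)
      home right = just (1 , begin 0 , accept)
    δ d     (begin (suc q)) 1 = Maybe.map (λ i → 1 , execute i , go) (fetch code q)
    δ d     (begin _)       _ = nothing
    δ d     (finish q)      1 = just (1 , begin q , turn)
    δ d     (finish q)      a = just (a , finish q , go)
    δ d (execute (inc j q)) zero = just (2 + j , finish q , go)
    -- The far mark was reached without meeting a blank to overwrite; this is the jam.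
    δ d (execute (inc j q)) 1    = nothing
    δ d (execute (inc j q)) a    = just (a , execute (inc j q) , go)
    -- The far mark was reached without meeting the letter of register `j`, whose value is therefore
    -- 0.
    δ d (execute (jzd j q₀ q₁)) 1 = just (1 , begin q₀ , turn)
    δ d (execute (jzd j q₀ q₁)) a with a ≟ 2 + j
    ... | yes _ = just (0 , finish q₁ , go)
    ... | no  _ = just (a , execute (jzd j q₀ q₁) , go)

    labels : List ℕ
    labels = 0 ∷ entry ∷ concatMap targets code

    states : List State
    states = map begin labels ++ map finish labels ++ map execute code

    top : ℕ
    top = 2 + sum (map register code)

    begin∈ : ∀ {q} → q ∈ labels → begin q ∈ states
    begin∈ q∈ = ∈-++⁺ˡ (∈-map⁺ begin q∈)

    finish∈ : ∀ {q} → q ∈ labels → finish q ∈ states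
    finish∈ q∈ = ∈-++⁺ʳ (map begin labels) (∈-++⁺ˡ (∈-map⁺ finish q∈))

    execute∈ : ∀ {i} → i ∈ code → execute i ∈ states
    execute∈ i∈ = ∈-++⁺ʳ (map begin labels) (∈-++⁺ʳ (map finish labels) (∈-map⁺ execute i∈))

    finish⁻ : ∀ {q} → finish q ∈ states → q ∈ labels
    finish⁻ s∈ with ∈-++⁻ (map begin labels) s∈
    ... | inj₁ s∈₁ with () ← ∈-map⁻ begin s∈₁
    ... | inj₂ s∈₁ with ∈-++⁻ (map finish labels) s∈₁
    ... | inj₁ s∈₂ with q , q∈ , refl ← ∈-map⁻ finish s∈₂ = q∈
    ... | inj₂ s∈₂ with () ← ∈-map⁻ execute s∈₂

    execute⁻ : ∀ {i} → execute i ∈ states → i ∈ code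
    execute⁻ s∈ with ∈-++⁻ (map begin labels) s∈
    ... | inj₁ s∈₁ with () ← ∈-map⁻ begin s∈₁
    ... | inj₂ s∈₁ with ∈-++⁻ (map finish labels) s∈₁
    ... | inj₁ s∈₂ with () ← ∈-map⁻ finish s∈₂
    ... | inj₂ s∈₂ with i , i∈ , refl ← ∈-map⁻ execute s∈₂ = i∈

    target∈ : ∀ {i q} → i ∈ code → q ∈ targets i → q ∈ labels
    target∈ i∈ q∈ = there (there (∈-concatMap⁺ targets (Any.map (λ { refl → q∈ }) i∈)))

    ∈⇒≤sum : ∀ {n ns} → n ∈ ns → n ≤ sum ns
    ∈⇒≤sum (here refl) = m≤m+n _ _
    ∈⇒≤sum (there n∈)  = ≤-trans (∈⇒≤sum n∈) (m≤n+m _ _)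

    letter≤top : ∀ {i} → i ∈ code → 2 + register i ≤ top
    letter≤top i∈ = s≤s (s≤s (∈⇒≤sum (∈-map⁺ register i∈)))

    closed : ∀ {d s a b s′ m} → s ∈ states → a ≤ top → δ d s a ≡ just (b , s′ , m) →
             s′ ∈ states × b ≤ top
    closed {left}  {begin zero} {1} s∈ a≤ refl = finish∈ (here refl) , s≤s z≤n
    closed {right} {begin zero} {1} s∈ a≤ refl = begin∈ (here refl) , s≤s z≤n
    closed {d} {begin (suc q)} {1} s∈ a≤ eq with fetch code q in at-q
    closed {d} {begin (suc q)} {1} s∈ a≤ refl | just i = execute∈ (fetch-∈ code q at-q) , s≤s z≤n
    closed {s = finish q} {0} s∈ a≤ refl = s∈ , a≤
    closed {s = finish q} {1} s∈ a≤ refl = begin∈ (finish⁻ s∈) , s≤s z≤n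
    closed {s = finish q} {suc (suc _)} s∈ a≤ refl = s∈ , a≤
    closed {s = execute (inc j q)} {0} s∈ a≤ refl =
      finish∈ (target∈ (execute⁻ s∈) (here refl)) , letter≤top (execute⁻ s∈)
    closed {s = execute (inc j q)} {suc (suc _)} s∈ a≤ refl = s∈ , a≤
    closed {s = execute (jzd j q₀ q₁)} {1} s∈ a≤ refl =
      begin∈ (target∈ (execute⁻ s∈) (here refl)) , s≤s z≤n
    closed {s = execute (jzd j q₀ q₁)} {0} s∈ a≤ refl = s∈ , a≤
    closed {s = execute (jzd j q₀ q₁)} {suc (suc x)} s∈ a≤ eq with suc (suc x) ≟ 2 + j
    closed {s = execute (jzd j q₀ q₁)} {suc (suc x)} s∈ a≤ refl | yes _ =
      finish∈ (target∈ (execute⁻ s∈) (there (here refl))) , z≤n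
    closed {s = execute (jzd j q₀ q₁)} {suc (suc x)} s∈ a≤ refl | no _ = s∈ , a≤

    sweeper : Sweeper
    sweeper = record
      { State = State ; label = label ; unlabel = unlabel ; unlabel-label = unlabel-label
      ; states = states ; top = top ; 2≤top = s≤s (s≤s z≤n) ; δ = δ
      ; start = begin entry ; start∈ = begin∈ (there (here refl)) ; closed = closed }

    open Run sweeper using (Conf; ⟨_,_,_,_,_⟩; _⟶_; _⟶*_; go; turn; Stuck; Accepting; accepting; initial; N)

    -- The head before a stretch `l` that may be empty; this spares a case distinction wherever
    -- stretches are joined.
    cursor : Dir → State → List ℕ → List ℕ → ℕ → List ℕ → Conf
    cursor d s bh []      a ah = ⟨ d , s , bh , a , ah ⟩
    cursor d s bh (x ∷ l) a ah = ⟨ d , s , bh , x , l ++ a ∷ ah ⟩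

    go-cursor : ∀ {d s bh x b s′} l {a ah} → δ d s x ≡ just (b , s′ , go) →
                ⟨ d , s , bh , x , l ++ a ∷ ah ⟩ ⟶ cursor d s′ (b ∷ bh) l a ah
    go-cursor []      eq = go eq
    go-cursor (y ∷ l) eq = go eq

    copy : ∀ {d s} l {bh a ah} → All (λ x → δ d s x ≡ just (x , s , go)) l →
           cursor d s bh l a ah ⟶* ⟨ d , s , l ʳ++ bh , a , ah ⟩
    copy []      []         = ε
    copy (x ∷ l) (eq ∷ eqs) = go-cursor l eq ◅ copy l eqs

    at-start : Dir → ℕ → List ℕ → Conf
    at-start d q w = ⟨ d , begin q , [] , 1 , w ++ 1 ∷ [] ⟩

    Unmarked : List ℕ → Set
    Unmarked = All (_≢ 1)

    unmarked-reverse : ∀ {w} → Unmarked w → Unmarked (reverse w)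
    unmarked-reverse []           = []
    unmarked-reverse {x ∷ w} (x≢1 ∷ unmarked) =
      subst Unmarked (sym (unfold-reverse x w)) (Allₚ.++⁺ (unmarked-reverse unmarked) (x≢1 ∷ []))

    finish-copies : ∀ {d q l} → Unmarked l → All (λ x → δ d (finish q) x ≡ just (x , finish q , go)) l
    finish-copies = All.map unmarked
      where
      unmarked : ∀ {d q x} → x ≢ 1 → δ d (finish q) x ≡ just (x , finish q , go)
      unmarked {x = 0}           _   = refl
      unmarked {x = 1}           1≢1 = contradiction refl 1≢1
      unmarked {x = suc (suc _)} _   = refl

    pass-end : ∀ {d s q} w → δ d s 1 ≡ just (1 , begin q , turn) →
               ⟨ d , s , w ʳ++ 1 ∷ [] , 1 , [] ⟩ ⟶* at-start (flip d) q (reverse w)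
    pass-end {d} {s} {q} w eq = subst (λ v → ⟨ d , s , w ʳ++ 1 ∷ [] , 1 , [] ⟩ ⟶* ⟨ flip d , begin q , [] , 1 , v ⟩)
      (ʳ++-defn w) (turn eq ◅ ε)

    pass-replace : ∀ {d s a b q bh} l l′ → All (λ x → δ d s x ≡ just (x , s , go)) l →
      δ d s a ≡ just (b , finish q , go) → Unmarked l′ → bh ≡ 1 ∷ [] →
      cursor d s bh l a (l′ ++ 1 ∷ []) ⟶* at-start (flip d) q (reverse (l ++ b ∷ l′))
    pass-replace {d} {s} {a} {b} {q} l l′ copies eq unmarked refl =
      copy l copies ◅◅ (go-cursor l′ eq ◅ copy l′ (finish-copies unmarked)) ◅◅
      subst (λ v → ⟨ d , finish q , v , 1 , [] ⟩ ⟶* at-start (flip d) q (reverse (l ++ b ∷ l′)))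
        (++-ʳ++ l) (pass-end (l ++ b ∷ l′) refl)

    Represented : (ℕ → ℕ) → List ℕ → Set
    Represented R w = ∀ j → count (2 + j) w ≡ R j

    -- The simulation may get stuck, but only for lack of blanks.
    data Outcome (d : Dir) (q : ℕ) (w : List ℕ) (cost e : ℕ) (R : ℕ → ℕ) : Set where
      halt  : ∀ {d′ w′} → at-start d q w ⟶* at-start d′ e w′ → Unmarked w′ → Represented R w′ →
              count 0 w ≤ cost + count 0 w′ → Outcome d q w cost e R
      jam   : ∀ {c} → at-start d q w ⟶* c → Stuck c → count 0 w < cost → Outcome d q w cost e R

    -- The cost is chosen before the word, so that enough blanks can be supplied afterwards.
    Simulates : ℕ → ℕ → (ℕ → ℕ) → (ℕ → ℕ) → Set
    Simulates q e R R′ =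
      ∃[ cost ] ∀ d w → Unmarked w → Represented R w → Outcome d q w cost e R′

    -- The first part loses at most κ blanks; if fewer than κ′ remain, there were fewer than κ + κ′
    -- at the beginning.
    sim-trans : ∀ {q₁ q₂ q₃ R₁ R₂ R₃} → Simulates q₁ q₂ R₁ R₂ → Simulates q₂ q₃ R₂ R₃ → Simulates q₁ q₃ R₁ R₃
    sim-trans {q₁} {q₃ = q₃} {R₃ = R₃} (κ , sim₁) (κ′ , sim₂) = κ + κ′ , both
      where
      both : ∀ d w → Unmarked w → Represented _ w → Outcome d q₁ w (κ + κ′) q₃ R₃
      both d w unmarked rep with sim₁ d w unmarked rep
      ... | jam run stuck lt = jam run stuck (≤-trans lt (m≤m+n κ κ′))
      ... | halt {d′} {w′} run unmarked′ rep′ le with sim₂ d′ w′ unmarked′ rep′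
      ... | jam run′ stuck lt = jam (run ◅◅ run′) stuck (≤-<-trans le (+-monoʳ-< κ lt))
      ... | halt run′ unmarked″ rep″ le′ = halt (run ◅◅ run′) unmarked″ rep″
        (≤-trans le (≤-trans (+-monoʳ-≤ κ le′) (≤-reflexive (sym (+-assoc κ κ′ _)))))

    sim-resp : ∀ {q e R R₁ R′ R₁′} → (∀ j → R₁ j ≡ R j) → (∀ j → R′ j ≡ R₁′ j) →
               Simulates q e R R′ → Simulates q e R₁ R₁′
    sim-resp {q} {e} {R₁ = R₁} {R₁′ = R₁′} eq eq′ (κ , sim) = κ , sim′
      where
      sim′ : ∀ d w → Unmarked w → Represented R₁ w → Outcome d q w κ e R₁′
      sim′ d w unmarked rep with sim d w unmarked (λ j → trans (rep j) (eq j))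
      ... | halt run unmarked′ rep′ le = halt run unmarked′ (λ j → trans (rep′ j) (eq′ j)) le
      ... | jam run stuck lt           = jam run stuck lt

    -- Simulation of single instructions

    module _ {q i} (at-q : fetch code q ≡ just i) where

      begin-executes : ∀ {d} → δ d (begin (suc q)) 1 ≡ just (1 , execute i , go)
      begin-executes = cong (Maybe.map (λ i → 1 , execute i , go)) at-q

      executing : ∀ {d} l {a ah} → ⟨ d , begin (suc q) , [] , 1 , l ++ a ∷ ah ⟩ ⟶*
                                    cursor d (execute i) (1 ∷ []) l a ah
      executing {d} l = go-cursor l (begin-executes {d}) ◅ ε

    unmarked-split : ∀ l {x l′} → Unmarked (l ++ x ∷ l′) → Unmarked l × Unmarked l′
    unmarked-split l unmarked with Allₚ.++⁻ l unmarked
    ... | l₁ , _ ∷ l₂ = l₁ , l₂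

    module _ {q j e} (at-q : fetch code q ≡ just (inc j e)) where

      private
        copies : ∀ {d l} → Unmarked l → All (_≢ 0) l →
                 All (λ x → δ d (execute (inc j e)) x ≡ just (x , execute (inc j e) , go)) l
        copies [] [] = []
        copies {l = zero ∷ _}        (_ ∷ _)   (0≢0 ∷ _)  = contradiction refl 0≢0
        copies {l = suc zero ∷ _}    (1≢1 ∷ _) (_ ∷ _)    = contradiction refl 1≢1
        copies {l = suc (suc _) ∷ _} (_ ∷ us)  (_ ∷ ns)   = refl ∷ copies us ns

      sim-inc : ∀ {R} → Simulates (suc q) e R (R [ j ↦ suc (R j) ])
      sim-inc {R} = 1 , run
        where
        run : ∀ d w → Unmarked w → Represented R w → Outcome d (suc q) w 1 e (R [ j ↦ suc (R j) ])
        run d w unmarked rep with occurrence 0 w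
        ... | absent w≢0 = jam (executing at-q w ◅◅ copy w (copies unmarked w≢0)) refl
          (≤-reflexive (cong suc (count-absent w≢0)))
        ... | first l l′ l≢0 with unmarked-split l unmarked
        ... | ul , ul′ = halt
          (subst (λ v → ⟨ d , begin (suc q) , [] , 1 , v ⟩ ⟶* at-start (flip d) e (reverse (l ++ 2 + j ∷ l′)))
            (sym (++-assoc l (0 ∷ l′) (1 ∷ [])))
            (executing at-q l ◅◅ pass-replace l l′ (copies ul l≢0) refl ul′ refl))
          (unmarked-reverse (Allₚ.++⁺ ul ((λ ()) ∷ ul′)))
          represented (≤-reflexive blanks)
          where
          represented : Represented (R [ j ↦ suc (R j) ]) (reverse (l ++ 2 + j ∷ l′))
          represented i with i ≟ j
          ... | yes refl = trans (count-replace (2 + j) l 0 (2 + j) l′)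
            (cong₂ _+_ (indicator-same (2 + j)) (rep j))
          ... | no i≢j   = trans (count-replace (2 + i) l 0 (2 + j) l′)
            (cong₂ _+_ (indicator-other {2 + i} (λ eq → i≢j (sym (suc-injective (suc-injective eq))))) (rep i))

          blanks : count 0 (l ++ 0 ∷ l′) ≡ 1 + count 0 (reverse (l ++ 2 + j ∷ l′))
          blanks = sym (count-replace 0 l 0 (2 + j) l′)

    module _ {q j q₀ q₁} (at-q : fetch code q ≡ just (jzd j q₀ q₁)) where

      private
        copies : ∀ {d l} → Unmarked l → All (_≢ 2 + j) l →
                 All (λ x → δ d (execute (jzd j q₀ q₁)) x ≡ just (x , execute (jzd j q₀ q₁) , go)) l
        copies [] [] = []
        copies {l = x ∷ _} (x≢1 ∷ us) (x≢j ∷ ns) = copied x x≢1 x≢j ∷ copies us ns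
          where
          copied : ∀ {d} x → x ≢ 1 → x ≢ 2 + j →
                   δ d (execute (jzd j q₀ q₁)) x ≡ just (x , execute (jzd j q₀ q₁) , go)
          copied zero          _   _   = refl
          copied (suc zero)    1≢1 _   = contradiction refl 1≢1
          copied (suc (suc x)) _   x≢j with suc (suc x) ≟ 2 + j
          ... | yes x≡j = contradiction x≡j x≢j
          ... | no _    = refl

        found : ∀ {d} → δ d (execute (jzd j q₀ q₁)) (2 + j) ≡ just (0 , finish q₁ , go)
        found with 2 + j ≟ 2 + j
        ... | yes _  = refl
        ... | no j≢j = contradiction refl j≢j

      sim-zero : ∀ {R} → R j ≡ 0 → Simulates (suc q) q₀ R R
      sim-zero {R} Rj≡0 = 0 , run
        where
        run : ∀ d w → Unmarked w → Represented R w → Outcome d (suc q) w 0 q₀ R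
        run d w unmarked rep with occurrence (2 + j) w
        ... | first l l′ _ = contradiction (trans (rep j) Rj≡0) (count-present (2 + j) l l′)
        ... | absent w≢j   = halt
          (executing at-q w ◅◅ copy w (copies unmarked w≢j) ◅◅ pass-end w refl)
          (unmarked-reverse unmarked) (λ i → trans (count-reverse (2 + i) w) (rep i))
          (≤-reflexive (sym (count-reverse 0 w)))

      sim-suc : ∀ {R n} → R j ≡ suc n → Simulates (suc q) q₁ R (R [ j ↦ n ])
      -- A decrement turns a letter into a blank, so it costs nothing.
      sim-suc {R} {n} Rj≡1+n = 0 , run
        where
        run : ∀ d w → Unmarked w → Represented R w → Outcome d (suc q) w 0 q₁ (R [ j ↦ n ])
        run d w unmarked rep with occurrence (2 + j) w
        ... | absent w≢j = contradiction (trans (sym (count-absent w≢j)) (trans (rep j) Rj≡1+n)) λ ()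
        ... | first l l′ l≢j with unmarked-split l unmarked
        ... | ul , ul′ = halt
          (subst (λ v → ⟨ d , begin (suc q) , [] , 1 , v ⟩ ⟶* at-start (flip d) q₁ (reverse (l ++ 0 ∷ l′)))
            (sym (++-assoc l (2 + j ∷ l′) (1 ∷ [])))
            (executing at-q l ◅◅ pass-replace l l′ (copies ul l≢j) (found {d}) ul′ refl))
          (unmarked-reverse (Allₚ.++⁺ ul ((λ ()) ∷ ul′)))
          represented
          (≤-trans (n≤1+n _) (≤-reflexive (sym (count-replace 0 l (2 + j) 0 l′))))
          where
          represented : Represented (R [ j ↦ n ]) (reverse (l ++ 0 ∷ l′))
          represented i with i ≟ j
          ... | yes refl = suc-injective (trans (trans (cong (_+ count (2 + j) (reverse (l ++ 0 ∷ l′)))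
                  (sym (indicator-same (2 + j)))) (count-replace (2 + j) l (2 + j) 0 l′)) (trans (rep j) Rj≡1+n))
          ... | no i≢j   = trans (trans (cong (_+ count (2 + i) (reverse (l ++ 0 ∷ l′)))
                  (sym (indicator-other {2 + i} (λ eq → i≢j (sym (suc-injective (suc-injective eq)))))))
                  (count-replace (2 + i) l (2 + j) 0 l′)) (rep i)

  -- Structured programs; register i of a program of depth m is the register
  -- level i of the machine.

  level : ∀ {m} → Fin m → ℕ
  level {suc m} zero    = m
  level         (suc i) = level i

  level-< : ∀ {m} (i : Fin m) → level i < m
  level-< zero    = ≤-refl
  level-< (suc i) = m<n⇒m<1+n (level-< i)

  get : ∀ {m} → Vec ℕ m → ℕ → ℕ
  get []      = λ _ → 0
  get {suc m} (x ∷ ρ) = get ρ [ m ↦ x ]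

  get-beyond : ∀ {m} (ρ : Vec ℕ m) {j} → m ≤ j → get ρ j ≡ 0
  get-beyond []      _ = refl
  get-beyond {suc m} (x ∷ ρ) {j} m<j with j ≟ m
  ... | yes refl = contradiction m<j (<-irrefl refl)
  ... | no _     = get-beyond ρ (<⇒≤ m<j)

  get-level : ∀ {m} (ρ : Vec ℕ m) i → get ρ (level i) ≡ lookup ρ i
  get-level {suc m} (x ∷ ρ) zero with m ≟ m
  ... | yes _  = refl
  ... | no m≢m = contradiction refl m≢m
  get-level {suc m} (x ∷ ρ) (suc i) with level i ≟ m
  ... | yes eq = contradiction eq (<⇒≢ (level-< i))
  ... | no _   = get-level ρ i

  get-update : ∀ {m} (ρ : Vec ℕ m) i v j → (get ρ [ level i ↦ v ]) j ≡ get (ρ [ i ]≔ v) j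
  get-update ρ i v j with j ≟ level i
  ... | yes refl = sym (trans (get-level (ρ [ i ]≔ v) i) (lookup∘update i ρ v))
  ... | no j≢i   = other ρ i j≢i
    where
    other : ∀ {m} (ρ : Vec ℕ m) i {j} → j ≢ level i → get ρ j ≡ get (ρ [ i ]≔ v) j
    other {suc m} (x ∷ ρ) zero {j} j≢m with j ≟ m
    ... | yes j≡m = contradiction j≡m j≢m
    ... | no _    = refl
    other {suc m} (x ∷ ρ) (suc i) {j} j≢i with j ≟ m
    ... | yes _ = refl
    ... | no _  = other ρ i j≢i

  -- Opening a register takes no instruction, because the absence of its letter already means 0; the
  -- instruction closing `new` restores that absence.
  get-push : ∀ {m} (ρ : Vec ℕ m) j → get (0 ∷ ρ) j ≡ get ρ j
  get-push {m} ρ j with j ≟ m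
  ... | yes refl = sym (get-beyond ρ ≤-refl)
  ... | no _     = refl

  size : ∀ {m} → Prog m → ℕ
  size (inc i)    = 1
  size (clr i)    = 1
  size (loop i p) = suc (size p)
  size (p ⨾ q)    = size p + size q
  size (new p)    = size p + 1

  -- The code of p for placement at index b (hence label b + 1), with exit label e.
  assemble : ∀ {m} → Prog m → ℕ → ℕ → List Instr
  assemble (inc i)         b e = inc (level i) e ∷ []
  -- `suc b` is the label of this instruction itself, which thus repeats until the register is 0.
  -- Likewise the body of a loop exits to the label of its test.
  assemble (clr i)         b e = jzd (level i) e (suc b) ∷ []
  assemble (loop i p)      b e = jzd (level i) e (suc (suc b)) ∷ assemble p (suc b) (suc b)
  assemble (p ⨾ q)         b e = assemble p b (suc (b + size p)) ++ assemble q (b + size p) e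
  assemble (new {m} p)     b e =
    assemble p b (suc (b + size p)) ++ jzd m e (suc (b + size p)) ∷ []

  length-assemble : ∀ {m} (p : Prog m) b e → length (assemble p b e) ≡ size p
  length-assemble (inc i)    b e = refl
  length-assemble (clr i)    b e = refl
  length-assemble (loop i p) b e = cong suc (length-assemble p (suc b) (suc b))
  length-assemble (p ⨾ q)    b e = trans (length-++ (assemble p b _))
    (cong₂ _+_ (length-assemble p b _) (length-assemble q (b + size p) e))
  length-assemble (new p)    b e = trans (length-++ (assemble p b _)) (cong (_+ 1) (length-assemble p b _))

  module _ (code : List Instr) (entry : ℕ) where

    private
      Sim : ℕ → ℕ → (ℕ → ℕ) → (ℕ → ℕ) → Set
      Sim = Simulates code entry

      at-assemble : ∀ {m b e is} (p : Prog m) → At code b (assemble p b e ++ is) →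
                    At code b (assemble p b e) × At code (b + size p) is
      at-assemble {b = b} {e} {is} p at with at₁ , at₂ ← at-++ (assemble p b e) at =
        at₁ , subst (λ n → At code (b + n) is) (length-assemble p b e) at₂

    sim-clear : ∀ {m b e} n (ρ : Vec ℕ m) i → lookup ρ i ≡ n → fetch code b ≡ just (jzd (level i) e (suc b)) →
                Sim (suc b) e (get ρ) (get (ρ [ i ]≔ 0))
    sim-clear zero    ρ i eq at-b = sim-resp code entry (λ _ → refl)
      (λ j → cong (λ ρ → get ρ j) (trans (sym ([]≔-lookup ρ i)) (cong (ρ [ i ]≔_) eq)))
      (sim-zero code entry at-b (trans (get-level ρ i) eq))
    sim-clear (suc n) ρ i eq at-b = sim-trans code entry
      (sim-resp code entry (λ _ → refl) (get-update ρ i n) (sim-suc code entry at-b (trans (get-level ρ i) eq)))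
      (subst (λ ρ′ → Sim _ _ (get (ρ [ i ]≔ n)) (get ρ′)) ([]≔-idempotent ρ i)
        (sim-clear n (ρ [ i ]≔ n) i (lookup∘update i ρ n) at-b))

    sim-prog : ∀ {m b e ρ ρ′} {p : Prog m} → p ⊢ ρ ⇒ ρ′ → At code b (assemble p b e) →
               Sim (suc b) e (get ρ) (get ρ′)
    sim-prog {ρ = ρ} (inc⇒ {i = i}) (at-b , _) = sim-resp code entry (λ _ → refl)
      (λ j → trans (cong (λ v → (get ρ [ level i ↦ suc v ]) j) (get-level ρ i))
        (trans (get-update ρ i _ j) (cong (λ ρ → get ρ j) (updateAt-cong-local i ρ refl))))
      (sim-inc code entry at-b)
    sim-prog {ρ = ρ} (clr⇒ {i = i}) (at-b , _) = sim-clear (lookup ρ i) ρ i refl at-b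
    sim-prog {ρ = ρ} (stop⇒ {i = i} eq) (at-b , _) = sim-zero code entry at-b (trans (get-level ρ i) eq)
    sim-prog {ρ = ρ} (iter⇒ {i = i} {x = x} eq p⇒ loop⇒) at@(at-b , at-p) =
      sim-trans code entry
        (sim-resp code entry (λ _ → refl) (get-update ρ i x) (sim-suc code entry at-b (trans (get-level ρ i) eq)))
        (sim-trans code entry (sim-prog p⇒ at-p) (sim-prog loop⇒ at))
    sim-prog (seq⇒ {p = p} p⇒ q⇒) at with at-p , at-q ← at-assemble p at =
      sim-trans code entry (sim-prog p⇒ at-p) (sim-prog q⇒ at-q)
    sim-prog {ρ = ρ} (new⇒ {p = p} {ρ₁ = ρ₁} {x} p⇒) at with at-p , at-clr , _ ← at-assemble p at =
      sim-resp code entry (λ j → sym (get-push ρ j)) (get-push ρ₁)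
        (sim-trans code entry (sim-prog p⇒ at-p) (sim-clear x (x ∷ ρ₁) zero refl at-clr))

-- Self-reference and undecidability

open import Defs
open Compilation using (Prog; compile; compile⇒)
open Recursion
open Walker
open Geometry
open Machine
open import Data.Fin using (zero; suc; toℕ)
open import Data.List using (List; []; _∷_; _++_; map; length; replicate; allFin)
open import Data.List.Properties using (++-assoc; map-∘; map-cong; length-tabulate)
open import Data.List.Membership.Propositional using (_∈_)
open import Data.List.Membership.Propositional.Properties using (∈-++⁺ˡ)
import Data.List.Relation.Unary.All.Properties as Allₚ
open import Data.List.Relation.Unary.Any using (here; there)
open import Data.Maybe as Maybe using (nothing)
open import Data.Nat
open import Data.Nat.Properties
open import Data.Product using (∃-syntax; _×_; _,_; proj₁; proj₂)
open import Data.Vec using (Vec; []; _∷_; head)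
open import Function using (_∘_)
open import Relation.Binary.Construct.Closure.ReflexiveTransitive using (_◅_; _◅◅_)
open import Relation.Binary.PropositionalEquality hiding ([_])
open import Relation.Nullary using (¬_; contradiction)

-- The code of a walker as a function of N

linkCode : ℕ → ℕ → ℕ
-- 48 and 144 code the offsets (2 , 0) and (2 , 1), and 3 codes the image 𝟎; below, 2 and 4 are the
-- numbers of `ws` and `wl`.
linkCode n i = codeList (n + i ∷ n + suc i ∷ 48 ∷ 3 ∷ [])

entryCode leaveCode basesCode chainCode : ℕ → ℕ
entryCode n = codeList (2 ∷ n + 1 ∷ 144 ∷ 3 ∷ [])
leaveCode n = codeList (n + n ∷ 4 ∷ 48 ∷ 3 ∷ [])
basesCode k = natrec 0 (λ _ c → consCode 0 c) k
-- The first `n` is the code of the list of fixed rules, onto which the chain rules are consed: here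
-- the input stands for its own rules.
chainCode n = natrec n (λ i c → consCode (linkCode n i) c) n

walkerCode : ℕ → ℕ
walkerCode n = codeList (suc (n + n) ∷ basesCode (suc (n + n)) ∷
  consCode (entryCode n) (consCode (leaveCode n) (chainCode n)) ∷ [])

linkCodeᶜ : ∀ {m} {F G : Vec ℕ m → ℕ} → Computable F → Computable G →
            Computable (λ xs → linkCode (F xs) (G xs))
linkCodeᶜ Fᶜ Gᶜ = consCodeᶜ (Fᶜ +ᶜ Gᶜ) (consCodeᶜ (Fᶜ +ᶜ sucᶜ Gᶜ)
  (consCodeᶜ (lit 48) (consCodeᶜ (lit 3) (lit 0))))

walkerCodeᶜ : ∀ {m} {F : Vec ℕ m → ℕ} → Computable F → Computable (λ xs → walkerCode (F xs))
walkerCodeᶜ Fᶜ = consCodeᶜ kᶜ (consCodeᶜ (natrecᶜ (lit 0) (consCodeᶜ (lit 0) acc) kᶜ)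
  (consCodeᶜ (consCodeᶜ entryᶜ (consCodeᶜ leaveᶜ chainᶜ)) (lit 0)))
  where
  kᶜ     = sucᶜ (Fᶜ +ᶜ Fᶜ)
  entryᶜ = consCodeᶜ (lit 2) (consCodeᶜ (Fᶜ +ᶜ lit 1) (consCodeᶜ (lit 144) (consCodeᶜ (lit 3) (lit 0))))
  leaveᶜ = consCodeᶜ (Fᶜ +ᶜ Fᶜ) (consCodeᶜ (lit 4) (consCodeᶜ (lit 48) (consCodeᶜ (lit 3) (lit 0))))
  chainᶜ = natrecᶜ Fᶜ (consCodeᶜ (linkCodeᶜ (weaken Fᶜ) headᶜ) acc) Fᶜ

module _ (M : Sweeper) where
  open Run M

  private
    ruleCode : Ty × Ty → ℕ
    ruleCode c = codeRule (mkRule c)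

    toℕ-types : ∀ {c} → c ∈ edges → toℕ (ty (proj₁ c)) ≡ tyCode (proj₁ c) × toℕ (ty (proj₂ c)) ≡ tyCode (proj₂ c)
    toℕ-types {s , t} c∈ = toℕ-ty {s} (proj₁ (valid-edge c∈)) , toℕ-ty {t} (proj₂ (valid-edge c∈))

    ruleCode-≡ : ∀ {s t} → (s , t) ∈ edges → ruleCode (s , t) ≡
                 codeList (tyCode s ∷ tyCode t ∷ codeℤ^ (offT s) ∷ codeℤ^ (imgT s t) ∷ [])
    ruleCode-≡ {s} {t} c∈ = cong₂ (λ m n → codeList (m ∷ n ∷ codeℤ^ (offT s) ∷ codeℤ^ (imgT s t) ∷ []))
      (proj₁ (toℕ-types c∈)) (proj₂ (toℕ-types c∈))

    opaque
      unfolding Δ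

      codeΔ : codeℤ^ (Δ 2 0 1 0) ≡ 144 × codeℤ^ (Δ 2 0 0 0) ≡ 48
      codeΔ = refl , refl

    entry-≡ : ruleCode (fix ws , ix 1) ≡ entryCode N
    entry-≡ = trans (ruleCode-≡ (here refl)) (cong (λ m → codeList (2 ∷ N + 1 ∷ m ∷ 3 ∷ [])) (proj₁ codeΔ))

    leave-≡ : ruleCode (ix N , fix wl) ≡ leaveCode N
    leave-≡ = trans (ruleCode-≡ (there (here refl)))
      (cong (λ m → codeList (N + N ∷ 4 ∷ m ∷ 3 ∷ [])) (proj₂ codeΔ))

    link-≡ : ∀ {i} → i < N → ruleCode (ix i , ix (suc i)) ≡ linkCode N i
    link-≡ {i} i<N = trans (ruleCode-≡ (there (there (∈-++⁺ˡ (chain⁺ i<N)))))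
      (cong (λ m → codeList (N + i ∷ N + suc i ∷ m ∷ 3 ∷ [])) (proj₂ codeΔ))

    both : FTy × FTy → Ty × Ty
    both (s , t) = fix s , fix t

    fixed-≡ : codeList (map ruleCode (map both fixedEdges)) ≡ N
    fixed-≡ = trans (cong codeList (codes fixedEdges (λ c∈ → c∈))) (sym N-def)
      where
      codes : ∀ cs → (∀ {c} → c ∈ cs → c ∈ fixedEdges) → map ruleCode (map both cs) ≡ map edgeCode cs
      codes []       _ = refl
      codes (c ∷ cs) ⊆ = cong₂ _∷_ (ruleCode-≡ (fixed∈ (⊆ (here refl)))) (codes cs (⊆ ∘ there))

    chain-≡ : ∀ i → i ≤ N → codeList (map ruleCode (chain i ++ map both fixedEdges)) ≡
              natrec N (λ i c → consCode (linkCode N i) c) i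
    chain-≡ zero    _   = fixed-≡
    chain-≡ (suc i) i<N = cong₂ consCode (link-≡ i<N) (chain-≡ i (<⇒≤ i<N))

    bases-≡ : ∀ {A : Set} (xs : List A) → codeList (map (λ _ → 0) xs) ≡ basesCode (length xs)
    bases-≡ []       = refl
    bases-≡ (x ∷ xs) = cong (consCode 0) (bases-≡ xs)

  -- This makes the self-reference computable: the fixed rules enter the code only as `N`, and
  -- everything else is explicit in `N`.
  codeInstance-σ : codeInstance (k , σ) ≡ walkerCode N
  codeInstance-σ = cong₂ (λ b r → codeList (k ∷ b ∷ r ∷ []))
    (trans (cong codeList (map-cong (λ t → cong codePattern (base-σ t)) (allFin k)))
      (trans (bases-≡ (allFin k)) (cong basesCode (length-tabulate {n = k} (λ i → i)))))
    (trans (cong (λ rs → codeList (map codeRule rs)) rules-σ)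
      (trans (cong codeList (sym (map-∘ {g = codeRule} {f = mkRule} edges)))
        (cong₂ consCode entry-≡ (cong₂ consCode leave-≡ (chain-≡ N ≤-refl)))))

-- The walker that runs a recursive function on N + 1

count-replicate : ∀ a n x → count a (replicate n x) ≡ n * indicator a x
count-replicate a zero    x = refl
count-replicate a (suc n) x = cong (indicator a x +_) (count-replicate a n x)

module _ (f : Rec 1) where

  private
    prog : Prog 2
    prog = compile f (zero ∷ [])

    reject : ℕ
    -- Label q + 1 means index q, and the index meant here is the length of `code`, where there is
    -- no instruction.
    reject = suc (suc (size prog))

    code : List Instr
    -- The input is register 0, that is letter 2, and the result is register 1. The program is
    -- entered at label 2 and exits to label 1, the test of the result: 0 leads to `reject`,
    -- anything else to the accepting label 0.
    code = jzd 1 reject 0 ∷ assemble prog 1 1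

    at-prog : At code 1 (assemble prog 1 1)
    at-prog = at-self (jzd 1 reject 0 ∷ []) (assemble prog 1 1)

  machine : Sweeper
  machine = sweeper code 2

  open Run machine using
    (σ; N; ⟨_,_,_,_,_⟩; _⟶_; _⟶*_; go; turn; Stuck; accepting; initial; blocked⇒consistent; accepts⇒inconsistent)

  private
    registers : ℕ → ℕ → ℕ
    registers y = get (y ∷ suc N ∷ [])

    run-prog : ∀ {y} → f · suc N ∷ [] ⇓ y → Simulates code 2 2 1 (registers 0) (registers y)
    run-prog f⇓ = sim-prog code 2 (compile⇒ f (zero ∷ []) {suc N ∷ []} f⇓) at-prog

    word : ℕ → List ℕ
    word q = replicate (2 + q) 0 ++ replicate (suc N) 2

    initial-≡ : ∀ q → at-start code 2 left 2 (word q) ≡ initial q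
    initial-≡ q = cong (λ w → ⟨ left , begin 2 , [] , 1 , w ⟩)
      (++-assoc (replicate (2 + q) 0) (replicate (suc N) 2) (1 ∷ []))

    from-initial : ∀ q {c} → at-start code 2 left 2 (word q) ⟶* c → initial q ⟶* c
    from-initial q {c} = subst (_⟶* c) (initial-≡ q)

    word-unmarked : ∀ q → Unmarked code 2 (word q)
    word-unmarked q = Allₚ.++⁺ (Allₚ.replicate⁺ (2 + q) (λ ())) (Allₚ.replicate⁺ (suc N) (λ ()))

    count-word : ∀ a q → count a (word q) ≡ (2 + q) * indicator a 0 + suc N * indicator a 2
    count-word a q = trans (count-++ a (replicate (2 + q) 0) (replicate (suc N) 2))
      (cong₂ _+_ (count-replicate a (2 + q) 0) (count-replicate a (suc N) 2))

    word-represents : ∀ q → Represented code 2 (registers 0) (word q)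
    word-represents q j = trans (count-word (2 + j) q) (trans
      (cong (_+ suc N * indicator (2 + j) 2) (*-zeroʳ (2 + q))) (input j))
      where
      input : ∀ j → suc N * indicator (2 + j) 2 ≡ registers 0 j
      input 0             = *-identityʳ (suc N)
      input 1             = *-zeroʳ (suc N)
      input (suc (suc j)) = *-zeroʳ (suc N)

    blanks : ∀ q → q ≤ count 0 (word q)
    blanks q = subst (q ≤_) (sym (count-word 0 q)) (≤-trans (m≤n+m q 2)
      (≤-trans (≤-reflexive (sym (*-identityʳ (2 + q)))) (m≤m+n _ _)))

  output-1⇒inconsistent : f · suc N ∷ [] ⇓ 1 → ¬ Consistent σ
  output-1⇒inconsistent f⇓ with sim-trans code 2 (run-prog f⇓) (sim-suc code 2 {0} refl {registers 1} {0} refl)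
  -- The cost is known at this point, and the word receives more blanks than that, so the run cannot
  -- jam.
  ... | κ , sim with sim left (word κ) (word-unmarked κ) (word-represents κ)
  ... | jam _ _ lt = contradiction (blanks κ) (<⇒≱ lt)
  ... | halt {right} run _ _ _ =
    accepts⇒inconsistent κ (from-initial κ run) (accepting {begin 0} {1} refl)
  ... | halt {left} {w} run unmarked _ _ =
    accepts⇒inconsistent κ (from-initial κ run ◅◅
      (go-cursor code 2 {left} {begin 0} w refl ◅ copy code 2 w (finish-copies code 2 {left} {0} unmarked)) ◅◅
      pass-end code 2 {left} {finish 0} {0} w refl)
      (accepting {begin 0} {1} refl)

  -- However many blanks the chain guesses, the run gets stuck, either for lack of blanks or at
  -- `reject`.
  output-0⇒consistent : f · suc N ∷ [] ⇓ 0 → Consistent σ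
  output-0⇒consistent f⇓ = blocked⇒consistent blocked
    where
    no-instruction : fetch code (suc (size prog)) ≡ nothing
    no-instruction = subst (λ n → fetch code (suc n) ≡ nothing) (length-assemble prog 1 1) (fetch-length code)

    blocked : ∀ q → ∃[ c ] initial q ⟶* c × Stuck c
    blocked q with sim-trans code 2 (run-prog f⇓) (sim-zero code 2 {0} refl {registers 0} refl)
    ... | κ , sim with sim left (word q) (word-unmarked q) (word-represents q)
    ... | jam run stuck _  = _ , from-initial q run , stuck
    ... | halt run _ _ _   = _ , from-initial q run ,
      cong (Maybe.map (λ i → 1 , execute i , go)) no-instruction

theorem3p1 : Undecidable {Instance 2} codeInstance (λ (k , σ) → Consistent σ)
-- Consistency is not decided outright: answer 1 refutes it, and this refutation produces answer 0,
-- which proves it.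
theorem3p1 (f , decides) = inconsistent-σ (output-0⇒consistent F (evaluate 0 (proj₂ (decides (_ , σ)) inconsistent-σ)))
  where
  walkerCodeᴿ : Computable {1} (λ xs → walkerCode (pred (head xs)))
  -- The word holds N + 1 input letters, the last one due to `wl`; the predecessor recovers `N`.
  walkerCodeᴿ = walkerCodeᶜ (predᶜ {F = head} headᶜ)

  F : Rec 1
  F = compᴿ f (proj₁ walkerCodeᴿ ∷ [])

  open Run (machine F) using (σ; N)

  evaluate : ∀ y → f · codeInstance (_ , σ) ∷ [] ⇓ y → F · suc N ∷ [] ⇓ y
  evaluate y f⇓ = comp⇓ (proj₂ walkerCodeᴿ (suc N ∷ []) ∷ [])
    (subst (λ c → f · c ∷ [] ⇓ y) (codeInstance-σ (machine F)) f⇓)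

  inconsistent-σ : ¬ Consistent σ
  inconsistent-σ consistent =
    output-1⇒inconsistent F (evaluate 1 (proj₁ (decides (_ , σ)) consistent)) consistent
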